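{- Using the definition that accumulates $\mathcal{D}(nat)$, $\mathcal{D}_{list}(atm)$, $\mathcal{D}(intuit)$, $\mathcal{D}(\mathrm{PCF})$ and the clause $X\equiv X\triangleq\top$ (for $\equiv\,: i\to i\to o$), the following formulas are derivable in $FO\lambda^{\Delta\mathbb{N}}$ ($\supset$ associating to the right): Determinacy: $\forall m\forall m_1\forall m_2(\vdash\langle m\Downarrow m_1\rangle\supset\ \vdash\langle m\Downarrow m_2\rangle\supset m_1\equiv m_2)$; $\forall m\forall m_1\forall m_2(\vdash\langle m\leadsto m_1\rangle\supset\ \vdash\langle m\leadsto m_2\rangle\supset m_1\equiv m_2)$; $\forall m\forall v_1\forall v_2(\vdash\langle value\,v_1\rangle\supset\ \vdash\langle m\leadsto^* v_1\rangle\supset\ \vdash\langle value\,v_2\rangle\supset\ \vdash\langle m\leadsto^* v_2\rangle\supset v_1\equiv v_2)$. Equivalence: $\forall m\forall v(\vdash\langle m\Downarrow v\rangle\supset(\vdash\langle value\,v\rangle\land\ \vdash\langle m\leadsto^* v\rangle))$; $\forall m\forall v((\vdash\langle value\,v\rangle\land\ \vdash\langle m\leadsto^* v\rangle)\supset\ \vdash\langle m\Downarrow v\rangle)$. Subject reduction: for each $R\in\{\Downarrow,\leadsto,\leadsto^*\}$, $\forall m\forall n(\vdash\langle m\,R\,n\rangle\supset\forall t(\vdash\langle typeof\,m\,t\rangle\supset\ \vdash\langle typeof\,n\,t\rangle))$. Unicity of typing: $\forall m\forall t_1\forall t_2(\vdash\langle typeof\,m\,t_1\rangle\supset\ \vdash\langle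 typeof\,m\,t_2\rangle\supset t_1\equiv t_2)$.
   Context: $FO\lambda^{\Delta\mathbb{N}}$ is the following intuitionistic sequent calculus. Terms are simply typed $\lambda$-terms (up to $\alpha\beta\eta$-conversion) over a signature of typed constants; $o$ is the type of formulas, and quantifiers range only over types not containing $o$. Formulas are built from atomic formulas with $\bot,\top,\land,\lor,\supset,\forall,\exists$. There is a type $nt$ with constants $z:nt$, $s:nt\to nt$ and a predicate $nat: nt\to o$. Sequents are $\Gamma\longrightarrow B$, $\Gamma$ a finite multiset. Rules: $\bot,\Gamma\longrightarrow B$ and $\Gamma\longrightarrow\top$ are axioms; the usual intuitionistic left and right rules for $\land,\lor,\supset,\forall,\exists$ (with the usual eigenvariable conditions); initial sequents $A,\Gamma\longrightarrow A$ for atomic $A$; left contraction; cut. For $nat$: $\Gamma\longrightarrow nat\,z$; from $\Gamma\longrightarrow nat\,I$ infer $\Gamma\longrightarrow nat\,(s\,I)$; induction: for $B:nt\to o$ and eigenvariable $j$ not free in $B$, from $\longrightarrow B\,z$, $B\,j\longrightarrow B\,(s\,j)$, $B\,I,\Gamma\longrightarrow C$ infer $nat\,I,\Gamma\longrightarrow C$. Relative to a definition (set of clauses $\forall\bar x[p\,\bar t\triangleq B]$, free variables of $B$ occurring in $\bar t$, satisfying a level condition): right rule: from $\Gamma\longrightarrow B\theta$ infer $\Gamma\longrightarrow p\,\bar u$ when $p\,\bar u=(p\,\bar t)\theta$; left rule: infer $p\,\bar u,\Gamma\longrightarrow C$ from the premises $B\theta,\Gamma\theta\longrightarrow C\theta$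 for every clause (renamed apart) and every $\theta$ in a complete set of unifiers of $p\,\bar u$ and $p\,\bar t$. A formula is derivable using a definition if $\longrightarrow F$ has a derivation. $\mathcal{D}(nat)$: predicates $=,<,\le: nt\to nt\to o$, $sum: nt\to nt\to nt\to o$; clauses $I=I\triangleq\top$; $sum\,z\,J\,J\triangleq nat\,J$; $sum\,(s\,I)\,J\,(s\,K)\triangleq sum\,I\,J\,K$; $z<(s\,J)\triangleq nat\,J$; $(s\,I)<(s\,J)\triangleq I<J$; $I\le I\triangleq\top$; $I\le J\triangleq I<J$. Object logic: types $i$, $atm$, $prp$, constants $\langle\cdot\rangle: atm\to prp$, $tt: prp$, $\&: prp\to prp\to prp$ (right-associative), $\Rightarrow: atm\to prp\to prp$, $\bigwedge: (i\to prp)\to prp$. $atmlst$ is the list type over $atm$ with $nil$ and infix $::$. $\mathcal{D}_{list}(atm)$ has clauses $length\,nil\,z\triangleq\top$; $length\,(X::L)\,(s\,I)\triangleq length\,L\,I$; $list\,L\triangleq\exists i(nat\,i\land length\,L\,i)$; $element\,X\,(X::L)\triangleq\top$; $element\,X\,(Y::L)\triangleq element\,X\,L$; $split\,nil\,nil\,nil\triangleq\top$; $split\,(X::L_1)\,(X::L_2)\,L_3\triangleq split\,L_1\,L_2\,L_3$; $split\,(X::L_1)\,L_2\,(X::L_3)\triangleq split\,L_1\,L_2\,L_3$; $permute\,nil\,nil\triangleq\top$; $permute\,(X::L_1)\,L_2\triangleq\exists l_{22}(split\,L_2\,(X::nil)\,l_{22}\land permute\,L_1\,l_{22})$. With $prog: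 atm\to prp\to o$ and $seq: nt\to atmlst\to prp\to o$ (first argument as subscript), $\mathcal{D}(intuit)$ is: $seq_I\,(A'::L)\,\langle A\rangle\triangleq element\,A\,(A'::L)$; $seq_I\,L\,tt\triangleq\top$; $seq_{(s I)}\,L\,(B\,\&\,C)\triangleq seq_I\,L\,B\land seq_I\,L\,C$; $seq_{(s I)}\,L\,(A\Rightarrow B)\triangleq seq_I\,(A::L)\,B$; $seq_{(s I)}\,L\,(\bigwedge B)\triangleq\forall x\,seq_I\,L\,(B\,x)$; $seq_{(s I)}\,L\,\langle A\rangle\triangleq\exists b(prog\,A\,b\land seq_I\,L\,b)$. $\vdash B$ abbreviates $\exists i(nat\,i\land seq_i\,nil\,B)$. PCF: constants (all over type $i$) $num,bool: i$, $arr: i\to i\to i$ (types); $zero,true,false: i$, $succ,pred,is\_zero: i\to i$, $if: i\to i\to i\to i$, $abs: i\to(i\to i)\to i$, $app: i\to i\to i$, $rec: i\to(i\to i)\to i$; object predicates $typeof: i\to i\to atm$, infix $\Downarrow,\leadsto,\leadsto^*: i\to i\to atm$, $value: i\to atm$. $\mathcal{D}(\mathrm{PCF})$ consists of clauses $prog\,A\,G\triangleq\top$ (all variables universally quantified), written here as $A\leftarrow G$: Typing: $typeof\,zero\,num\leftarrow tt$; $typeof\,true\,bool\leftarrow tt$; $typeof\,false\,bool\leftarrow tt$; $typeof\,(succ\,M)\,num\leftarrow\langle typeof\,M\,num\rangle$; $typeof\,(pred\,M)\,num\leftarrow\langle typeof\,M\,num\rangle$; $typeof\,(is\_zero\,M)\,bool\leftarrow\langle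 typeof\,M\,num\rangle$; $typeof\,(if\,M\,N_1\,N_2)\,T\leftarrow\langle typeof\,M\,bool\rangle\,\&\,\langle typeof\,N_1\,T\rangle\,\&\,\langle typeof\,N_2\,T\rangle$; $typeof\,(abs\,T\,R)\,(arr\,T\,U)\leftarrow\bigwedge n(typeof\,n\,T\Rightarrow\langle typeof\,(R\,n)\,U\rangle)$; $typeof\,(app\,M\,N)\,T\leftarrow\langle typeof\,M\,(arr\,U\,T)\rangle\,\&\,\langle typeof\,N\,U\rangle$; $typeof\,(rec\,T\,R)\,T\leftarrow\bigwedge n(typeof\,n\,T\Rightarrow\langle typeof\,(R\,n)\,T\rangle)$. Natural semantics: $zero\Downarrow zero\leftarrow tt$; $true\Downarrow true\leftarrow tt$; $false\Downarrow false\leftarrow tt$; $(succ\,M)\Downarrow(succ\,V)\leftarrow\langle M\Downarrow V\rangle$; $(pred\,M)\Downarrow zero\leftarrow\langle M\Downarrow zero\rangle$; $(pred\,M)\Downarrow V\leftarrow\langle M\Downarrow(succ\,V)\rangle$; $(is\_zero\,M)\Downarrow true\leftarrow\langle M\Downarrow zero\rangle$; $(is\_zero\,M)\Downarrow false\leftarrow\langle M\Downarrow(succ\,V)\rangle$; $(if\,M\,N_1\,N_2)\Downarrow V\leftarrow\langle M\Downarrow true\rangle\,\&\,\langle N_1\Downarrow V\rangle$; $(if\,M\,N_1\,N_2)\Downarrow V\leftarrow\langle M\Downarrow false\rangle\,\&\,\langle N_2\Downarrow V\rangle$; $(abs\,T\,R)\Downarrow(abs\,T\,R)\leftarrow tt$;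 $(app\,M\,N)\Downarrow V\leftarrow\langle M\Downarrow(abs\,T\,R)\rangle\,\&\,\langle(R\,N)\Downarrow V\rangle$; $(rec\,T\,R)\Downarrow V\leftarrow\langle(R\,(rec\,T\,R))\Downarrow V\rangle$. Transition semantics: $(succ\,M)\leadsto(succ\,M')\leftarrow\langle M\leadsto M'\rangle$; $(pred\,zero)\leadsto zero\leftarrow tt$; $(pred\,(succ\,V))\leadsto V\leftarrow\langle value\,V\rangle$; $(pred\,M)\leadsto(pred\,M')\leftarrow\langle M\leadsto M'\rangle$; $(is\_zero\,zero)\leadsto true\leftarrow tt$; $(is\_zero\,(succ\,V))\leadsto false\leftarrow\langle value\,V\rangle$; $(is\_zero\,M)\leadsto(is\_zero\,M')\leftarrow\langle M\leadsto M'\rangle$; $(if\,true\,M\,N)\leadsto M\leftarrow tt$; $(if\,false\,M\,N)\leadsto N\leftarrow tt$; $(if\,M\,N_1\,N_2)\leadsto(if\,M'\,N_1\,N_2)\leftarrow\langle M\leadsto M'\rangle$; $(app\,(abs\,T\,R)\,N)\leadsto(R\,N)\leftarrow tt$; $(app\,M\,N)\leadsto(app\,M'\,N)\leftarrow\langle M\leadsto M'\rangle$; $(rec\,T\,R)\leadsto(R\,(rec\,T\,R))\leftarrow tt$; $M\leadsto^* M\leftarrow tt$; $M\leadsto^* N\leftarrow\langle M\leadsto M'\rangle\,\&\,\langle M'\leadsto^* N\rangle$; $value\,zero\leftarrow tt$; $value\,true\leftarrow tt$; $value\,false\leftarrow tt$; $value\,(succ\,V)\leftarrow\langle value\,V\rangle$;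 $value\,(abs\,T\,R)\leftarrow tt$. -}

module Defs where

open import Data.Empty using (⊥)
open import Data.Unit using (⊤)
open import Data.List using (List; []; _∷_; map; _++_)
open import Data.List.Relation.Unary.All using (All)
open import Data.List.Membership.Propositional using (_∈_)
open import Data.List.Relation.Binary.Permutation.Propositional using (_↭_)
open import Data.Product using (Σ; Σ-syntax; _×_)
open import Relation.Binary.PropositionalEquality using (_≡_)

data Base : Set where
  nt i atm prp atmlst o : Base

infixr 30 _⇒_
infix 40 `_
data Ty : Set where
  `_  : Base → Ty
  _⇒_ : Ty → Ty → Ty

NotO : Base → Set
NotO o = ⊥
NotO _ = ⊤

-- types not containing o (the only types quantifiers may range over)
data OFree : Ty → Set where
  ofb : ∀ {b} → NotO b → OFree (` b)
  of⇒ : ∀ {σ τ} → OFree σ → OFree τ → OFree (σ ⇒ τ)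

Ctx : Set
Ctx = List Ty

OFreeCtx : Ctx → Set
OFreeCtx = All OFree

data Var : Ctx → Ty → Set where
  vz : ∀ {Γ τ} → Var (τ ∷ Γ) τ
  vs : ∀ {Γ σ τ} → Var Γ τ → Var (σ ∷ Γ) τ

data Logical : Ty → Set where
  ⊥c ⊤c       : Logical (` o)
  ∧c ∨c ⊃c    : Logical (` o ⇒ ` o ⇒ ` o)
  ∀c ∃c       : (τ : Ty) → OFree τ → Logical ((τ ⇒ ` o) ⇒ ` o)

data NonLog : Ty → Set where
  z      : NonLog (` nt)
  s      : NonLog (` nt ⇒ ` nt)
  nat    : NonLog (` nt ⇒ ` o)
  eqnt   : NonLog (` nt ⇒ ` nt ⇒ ` o)
  lt     : NonLog (` nt ⇒ ` nt ⇒ ` o)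
  le     : NonLog (` nt ⇒ ` nt ⇒ ` o)
  sum    : NonLog (` nt ⇒ ` nt ⇒ ` nt ⇒ ` o)
  nil     : NonLog (` atmlst)
  cons    : NonLog (` atm ⇒ ` atmlst ⇒ ` atmlst)
  length  : NonLog (` atmlst ⇒ ` nt ⇒ ` o)
  list    : NonLog (` atmlst ⇒ ` o)
  element : NonLog (` atm ⇒ ` atmlst ⇒ ` o)
  split   : NonLog (` atmlst ⇒ ` atmlst ⇒ ` atmlst ⇒ ` o)
  permute : NonLog (` atmlst ⇒ ` atmlst ⇒ ` o)
  atom   : NonLog (` atm ⇒ ` prp)
  tt     : NonLog (` prp)
  and&   : NonLog (` prp ⇒ ` prp ⇒ ` prp)
  imp    : NonLog (` atm ⇒ ` prp ⇒ ` prp)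
  bigand : NonLog ((` i ⇒ ` prp) ⇒ ` prp)
  prog   : NonLog (` atm ⇒ ` prp ⇒ ` o)
  seq    : NonLog (` nt ⇒ ` atmlst ⇒ ` prp ⇒ ` o)
  num bool           : NonLog (` i)
  arr                : NonLog (` i ⇒ ` i ⇒ ` i)
  zero true false    : NonLog (` i)
  succ pred is-zero  : NonLog (` i ⇒ ` i)
  if                 : NonLog (` i ⇒ ` i ⇒ ` i ⇒ ` i)
  abs                : NonLog (` i ⇒ (` i ⇒ ` i) ⇒ ` i)
  app                : NonLog (` i ⇒ ` i ⇒ ` i)
  rec                : NonLog (` i ⇒ (` i ⇒ ` i) ⇒ ` i)
  typeof             : NonLog (` i ⇒ ` i ⇒ ` atm)
  eval step steps    : NonLog (` i ⇒ ` i ⇒ ` atm)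
  value              : NonLog (` i ⇒ ` atm)
  equiv              : NonLog (` i ⇒ ` i ⇒ ` o)

data Const (τ : Ty) : Set where
  lg : Logical τ → Const τ
  nl : NonLog τ → Const τ

data Defined : ∀ {τ} → NonLog τ → Set where
  d-eqnt : Defined eqnt
  d-lt : Defined lt
  d-le : Defined le
  d-sum : Defined sum
  d-length : Defined length
  d-list : Defined list
  d-element : Defined element
  d-split : Defined split
  d-permute : Defined permute
  d-prog : Defined prog
  d-seq : Defined seq
  d-equiv : Defined equiv

-- Terms up to αβη: β-normal η-long (canonical) forms, spine form

data Head (Γ : Ctx) (τ : Ty) : Set where
  var : Var Γ τ → Head Γ τ
  con : Const τ → Head Γ τ

infixr 5 _∷ₛ_
mutual
  data Nf (Γ : Ctx) : Ty → Set where
    lam : ∀ {σ τ} → Nf (σ ∷ Γ) τ → Nf Γ (σ ⇒ τ)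
    ne  : ∀ {τ b} → Head Γ τ → Sp Γ τ (` b) → Nf Γ (` b)

  data Sp (Γ : Ctx) : Ty → Ty → Set where
    ε    : ∀ {τ} → Sp Γ τ τ
    _∷ₛ_ : ∀ {σ τ ρ} → Nf Γ σ → Sp Γ τ ρ → Sp Γ (σ ⇒ τ) ρ

Ren : Ctx → Ctx → Set
Ren Γ Δ = ∀ {τ} → Var Γ τ → Var Δ τ

liftR : ∀ {Γ Δ σ} → Ren Γ Δ → Ren (σ ∷ Γ) (σ ∷ Δ)
liftR ρ vz = vz
liftR ρ (vs x) = vs (ρ x)

renH : ∀ {Γ Δ τ} → Ren Γ Δ → Head Γ τ → Head Δ τ
renH ρ (var x) = var (ρ x)
renH ρ (con c) = con c

mutual
  renNf : ∀ {Γ Δ τ} → Ren Γ Δ → Nf Γ τ → Nf Δ τ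
  renNf ρ (lam t) = lam (renNf (liftR ρ) t)
  renNf ρ (ne h sp) = ne (renH ρ h) (renSp ρ sp)

  renSp : ∀ {Γ Δ τ σ} → Ren Γ Δ → Sp Γ τ σ → Sp Δ τ σ
  renSp ρ ε = ε
  renSp ρ (t ∷ₛ sp) = renNf ρ t ∷ₛ renSp ρ sp

wk : ∀ {Γ σ τ} → Nf Γ τ → Nf (σ ∷ Γ) τ
wk = renNf vs

snoc : ∀ {Γ ρ σ τ} → Sp Γ ρ (σ ⇒ τ) → Nf Γ σ → Sp Γ ρ τ
snoc ε u = u ∷ₛ ε
snoc (t ∷ₛ sp) u = t ∷ₛ snoc sp u

eta : ∀ {Γ ρ} τ → Head Γ ρ → Sp Γ ρ τ → Nf Γ τ
eta (` b) h sp = ne h sp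
eta (σ ⇒ τ) h sp = lam (eta τ (renH vs h) (snoc (renSp vs sp) (eta σ (var vz) ε)))

nvar : ∀ {Γ τ} → Var Γ τ → Nf Γ τ
nvar x = eta _ (var x) ε

-- hereditary substitution of a single variable (Keller–Altenkirch)
_-_ : ∀ {σ} (Γ : Ctx) → Var Γ σ → Ctx
(τ ∷ Γ) - vz = Γ
(τ ∷ Γ) - vs x = τ ∷ (Γ - x)

wkv : ∀ {Γ σ τ} (x : Var Γ σ) → Var (Γ - x) τ → Var Γ τ
wkv vz y = vs y
wkv (vs x) vz = vz
wkv (vs x) (vs y) = vs (wkv x y)

data EqV {Γ σ} (x : Var Γ σ) : ∀ {τ} → Var Γ τ → Set where
  same : EqV x x
  diff : ∀ {τ} (y : Var (Γ - x) τ) → EqV x (wkv x y)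

liftEq : ∀ {Γ σ τ ρ} {x : Var Γ σ} {y : Var Γ τ} → EqV x y → EqV (vs {σ = ρ} x) (vs y)
liftEq same = same
liftEq (diff y) = diff (vs y)

eqv : ∀ {Γ σ τ} (x : Var Γ σ) (y : Var Γ τ) → EqV x y
eqv vz vz = same
eqv vz (vs y) = diff y
eqv (vs x) vz = diff vz
eqv (vs x) (vs y) = liftEq (eqv x y)

mutual
  subst1 : ∀ {Γ σ τ} → Nf Γ τ → (x : Var Γ σ) → Nf (Γ - x) σ → Nf (Γ - x) τ
  subst1 (lam t) x u = lam (subst1 t (vs x) (wk u))
  subst1 (ne (con c) sp) x u = ne (con c) (substSp sp x u)
  subst1 (ne (var y) sp) x u = hv x (eqv x y) (substSp sp x u) u

  hv : ∀ {Γ σ τ b} (x : Var Γ σ) {y : Var Γ τ} → EqV x y → Sp (Γ - x) τ (` b) →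
       Nf (Γ - x) σ → Nf (Γ - x) (` b)
  hv x same sp u = u ◇ sp
  hv x (diff y) sp u = ne (var y) sp

  substSp : ∀ {Γ σ τ ρ} → Sp Γ τ ρ → (x : Var Γ σ) → Nf (Γ - x) σ → Sp (Γ - x) τ ρ
  substSp ε x u = ε
  substSp (t ∷ₛ sp) x u = subst1 t x u ∷ₛ substSp sp x u

  _◇_ : ∀ {Γ τ ρ} → Nf Γ τ → Sp Γ τ ρ → Nf Γ ρ
  t ◇ ε = t
  lam t ◇ (u ∷ₛ sp) = subst1 t vz u ◇ sp

_·₁_ : ∀ {Γ σ τ} → Nf Γ (σ ⇒ τ) → Nf Γ σ → Nf Γ τ
t ·₁ u = t ◇ (u ∷ₛ ε)

Sub : Ctx → Ctx → Set
Sub Γ Δ = ∀ {τ} → Var Δ τ → Nf Γ τ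

liftS : ∀ {Γ Δ σ} → Sub Γ Δ → Sub (σ ∷ Γ) (σ ∷ Δ)
liftS θ vz = nvar vz
liftS θ (vs x) = wk (θ x)

mutual
  sub : ∀ {Γ Δ τ} → Sub Γ Δ → Nf Δ τ → Nf Γ τ
  sub θ (lam t) = lam (sub (liftS θ) t)
  sub θ (ne (var x) sp) = θ x ◇ subSp θ sp
  sub θ (ne (con c) sp) = ne (con c) (subSp θ sp)

  subSp : ∀ {Γ Δ τ ρ} → Sub Γ Δ → Sp Δ τ ρ → Sp Γ τ ρ
  subSp θ ε = ε
  subSp θ (t ∷ₛ sp) = sub θ t ∷ₛ subSp θ sp

_⊙_ : ∀ {Γ Δ Θ} → Sub Δ Θ → Sub Γ Δ → Sub Γ Θ
(ρ ⊙ η) x = sub η (ρ x)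

_≐_ : ∀ {Γ Δ} → Sub Γ Δ → Sub Γ Δ → Set
θ ≐ θ' = ∀ {τ} (x : Var _ τ) → θ x ≡ θ' x

Fm : Ctx → Set
Fm Γ = Nf Γ (` o)

k0 : ∀ {Γ b} → NonLog (` b) → Nf Γ (` b)
k0 c = ne (con (nl c)) ε

k1 : ∀ {Γ σ b} → NonLog (σ ⇒ ` b) → Nf Γ σ → Nf Γ (` b)
k1 c a = ne (con (nl c)) (a ∷ₛ ε)

k2 : ∀ {Γ σ₁ σ₂ b} → NonLog (σ₁ ⇒ σ₂ ⇒ ` b) → Nf Γ σ₁ → Nf Γ σ₂ → Nf Γ (` b)
k2 c a b = ne (con (nl c)) (a ∷ₛ b ∷ₛ ε)

k3 : ∀ {Γ σ₁ σ₂ σ₃ b} → NonLog (σ₁ ⇒ σ₂ ⇒ σ₃ ⇒ ` b) →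
     Nf Γ σ₁ → Nf Γ σ₂ → Nf Γ σ₃ → Nf Γ (` b)
k3 c a b d = ne (con (nl c)) (a ∷ₛ b ∷ₛ d ∷ₛ ε)

ap1 : ∀ {Γ σ b} → Var Γ (σ ⇒ ` b) → Nf Γ σ → Nf Γ (` b)
ap1 x a = ne (var x) (a ∷ₛ ε)

⊥F ⊤F : ∀ {Γ} → Fm Γ
⊥F = ne (con (lg ⊥c)) ε
⊤F = ne (con (lg ⊤c)) ε

infixr 6 _∧F_
infixr 5 _∨F_
infixr 4 _⊃F_
_∧F_ _∨F_ _⊃F_ : ∀ {Γ} → Fm Γ → Fm Γ → Fm Γ
A ∧F B = ne (con (lg ∧c)) (A ∷ₛ B ∷ₛ ε)
A ∨F B = ne (con (lg ∨c)) (A ∷ₛ B ∷ₛ ε)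
A ⊃F B = ne (con (lg ⊃c)) (A ∷ₛ B ∷ₛ ε)

∀F ∃F : ∀ {Γ} (τ : Ty) → OFree τ → Nf Γ (τ ⇒ ` o) → Fm Γ
∀F τ p B = ne (con (lg (∀c τ p))) (B ∷ₛ ε)
∃F τ p B = ne (con (lg (∃c τ p))) (B ∷ₛ ε)

natF : ∀ {Γ} → Nf Γ (` nt) → Fm Γ
natF = k1 nat

zN : ∀ {Γ} → Nf Γ (` nt)
zN = k0 z

sN : ∀ {Γ} → Nf Γ (` nt) → Nf Γ (` nt)
sN = k1 s

data Atomic {Γ} : Fm Γ → Set where
  atomic : ∀ {τ} (p : NonLog τ) (sp : Sp Γ τ (` o)) → Atomic (ne (con (nl p)) sp)

data DefAtom {Γ} : Fm Γ → Set where
  defatom : ∀ {τ} (p : NonLog τ) → Defined p → (sp : Sp Γ τ (` o)) →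
            DefAtom (ne (con (nl p)) sp)

-- Definitional clauses  ∀x̄ [ head ≜ body ],  x̄ : ctx

record Clause : Set where
  constructor clause
  field
    ctx  : Ctx
    head : Fm ctx
    body : Fm ctx
open Clause public

#0 : ∀ {Γ a} → Nf (a ∷ Γ) a
#0 = nvar vz
#1 : ∀ {Γ a b} → Nf (b ∷ a ∷ Γ) a
#1 = nvar (vs vz)
#2 : ∀ {Γ a b c} → Nf (c ∷ b ∷ a ∷ Γ) a
#2 = nvar (vs (vs vz))
#3 : ∀ {Γ a b c d} → Nf (d ∷ c ∷ b ∷ a ∷ Γ) a
#3 = nvar (vs (vs (vs vz)))

ofi : OFree (` i)
ofi = ofb _
ofnt : OFree (` nt)
ofnt = ofb _
ofprp : OFree (` prp)
ofprp = ofb _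
ofatmlst : OFree (` atmlst)
ofatmlst = ofb _

I' Nt Atm Prp AL : Ty
I' = ` i
Nt = ` nt
Atm = ` atm
Prp = ` prp
AL = ` atmlst

_::_ : ∀ {Γ} → Nf Γ Atm → Nf Γ AL → Nf Γ AL
x :: l = k2 cons x l
infixr 7 _::_

⟨_⟩ : ∀ {Γ} → Nf Γ Atm → Nf Γ Prp
⟨ a ⟩ = k1 atom a
_&_ : ∀ {Γ} → Nf Γ Prp → Nf Γ Prp → Nf Γ Prp
_&_ = k2 and&
infixr 6 _&_

_⊩_←_ : (Δ : Ctx) → Nf Δ Atm → Nf Δ Prp → Clause
Δ ⊩ A ← G = clause Δ (k2 prog A G) ⊤F

Dnat : List Clause
Dnat =
    clause (Nt ∷ []) (k2 eqnt #0 #0) ⊤F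
  ∷ clause (Nt ∷ []) (k3 sum zN #0 #0) (natF #0)
  ∷ clause (Nt ∷ Nt ∷ Nt ∷ []) (k3 sum (sN #0) #1 (sN #2)) (k3 sum #0 #1 #2)     -- I J K
  ∷ clause (Nt ∷ []) (k2 lt zN (sN #0)) (natF #0)
  ∷ clause (Nt ∷ Nt ∷ []) (k2 lt (sN #0) (sN #1)) (k2 lt #0 #1)                 -- I J
  ∷ clause (Nt ∷ []) (k2 le #0 #0) ⊤F
  ∷ clause (Nt ∷ Nt ∷ []) (k2 le #0 #1) (k2 lt #0 #1)
  ∷ []

Dlist : List Clause
Dlist =
    clause [] (k2 length (k0 nil) zN) ⊤F
  ∷ clause (Atm ∷ AL ∷ Nt ∷ []) (k2 length (#0 :: #1) (sN #2)) (k2 length #1 #2)   -- X L I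
  ∷ clause (AL ∷ []) (k1 list #0)
      (∃F Nt ofnt (lam (natF #0 ∧F k2 length #1 #0)))
  ∷ clause (Atm ∷ AL ∷ []) (k2 element #0 (#0 :: #1)) ⊤F                          -- X L
  ∷ clause (Atm ∷ Atm ∷ AL ∷ []) (k2 element #0 (#1 :: #2)) (k2 element #0 #2)    -- X Y L
  ∷ clause [] (k3 split (k0 nil) (k0 nil) (k0 nil)) ⊤F
  ∷ clause (Atm ∷ AL ∷ AL ∷ AL ∷ [])                                               -- X L1 L2 L3
      (k3 split (#0 :: #1) (#0 :: #2) #3) (k3 split #1 #2 #3)
  ∷ clause (Atm ∷ AL ∷ AL ∷ AL ∷ [])
      (k3 split (#0 :: #1) #2 (#0 :: #3)) (k3 split #1 #2 #3)
  ∷ clause [] (k2 permute (k0 nil) (k0 nil)) ⊤F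
  ∷ clause (Atm ∷ AL ∷ AL ∷ [])                                                    -- X L1 L2
      (k2 permute (#0 :: #1) #2)
      (∃F AL ofatmlst (lam (k3 split #3 (#1 :: k0 nil) #0 ∧F k2 permute #2 #0)))
  ∷ []

Dintuit : List Clause
Dintuit =
    clause (Nt ∷ Atm ∷ AL ∷ Atm ∷ [])                                  -- I A' L A
      (k3 seq #0 (#1 :: #2) ⟨ #3 ⟩) (k2 element #3 (#1 :: #2))
  ∷ clause (Nt ∷ AL ∷ []) (k3 seq #0 #1 (k0 tt)) ⊤F                    -- I L
  ∷ clause (Nt ∷ AL ∷ Prp ∷ Prp ∷ [])                                  -- I L B C
      (k3 seq (sN #0) #1 (#2 & #3)) (k3 seq #0 #1 #2 ∧F k3 seq #0 #1 #3)
  ∷ clause (Nt ∷ AL ∷ Atm ∷ Prp ∷ [])                                  -- I L A B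
      (k3 seq (sN #0) #1 (k2 imp #2 #3)) (k3 seq #0 (#2 :: #1) #3)
  ∷ clause (Nt ∷ AL ∷ (I' ⇒ Prp) ∷ [])                                 -- I L B
      (k3 seq (sN #0) #1 (k1 bigand #2))
      (∀F I' ofi (lam (k3 seq #1 #2 (ap1 (vs (vs (vs vz))) #0))))
  ∷ clause (Nt ∷ AL ∷ Atm ∷ [])                                        -- I L A
      (k3 seq (sN #0) #1 ⟨ #2 ⟩)
      (∃F Prp ofprp (lam (k2 prog #3 #0 ∧F k3 seq #1 #2 #0)))
  ∷ []

typeofA : ∀ {Γ} → Nf Γ I' → Nf Γ I' → Nf Γ Atm
typeofA = k2 typeof
_⇓_ _↝_ _↝*_ : ∀ {Γ} → Nf Γ I' → Nf Γ I' → Nf Γ Atm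
_⇓_ = k2 eval
_↝_ = k2 step
_↝*_ = k2 steps
valueA : ∀ {Γ} → Nf Γ I' → Nf Γ Atm
valueA = k1 value

DPCF : List Clause
DPCF =
    ([] ⊩ typeofA (k0 zero) (k0 num) ← k0 tt)
  ∷ ([] ⊩ typeofA (k0 true) (k0 bool) ← k0 tt)
  ∷ ([] ⊩ typeofA (k0 false) (k0 bool) ← k0 tt)
  ∷ ((I' ∷ []) ⊩ typeofA (k1 succ #0) (k0 num) ← ⟨ typeofA #0 (k0 num) ⟩)
  ∷ ((I' ∷ []) ⊩ typeofA (k1 pred #0) (k0 num) ← ⟨ typeofA #0 (k0 num) ⟩)
  ∷ ((I' ∷ []) ⊩ typeofA (k1 is-zero #0) (k0 bool) ← ⟨ typeofA #0 (k0 num) ⟩)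
  ∷ ((I' ∷ I' ∷ I' ∷ I' ∷ []) ⊩ typeofA (k3 if #0 #1 #2) #3                -- M N1 N2 T
       ← (⟨ typeofA #0 (k0 bool) ⟩ & ⟨ typeofA #1 #3 ⟩ & ⟨ typeofA #2 #3 ⟩))
  ∷ ((I' ∷ (I' ⇒ I') ∷ I' ∷ []) ⊩ typeofA (k2 abs #0 #1) (k2 arr #0 #2)    -- T R U
       ← k1 bigand (lam (k2 imp (typeofA #0 #1)
                               ⟨ typeofA (ap1 (vs (vs vz)) #0) #3 ⟩)))
  ∷ ((I' ∷ I' ∷ I' ∷ I' ∷ []) ⊩ typeofA (k2 app #0 #1) #2                  -- M N T U
       ← (⟨ typeofA #0 (k2 arr #3 #2) ⟩ & ⟨ typeofA #1 #3 ⟩))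
  ∷ ((I' ∷ (I' ⇒ I') ∷ []) ⊩ typeofA (k2 rec #0 #1) #0                     -- T R
       ← k1 bigand (lam (k2 imp (typeofA #0 #1)
                               ⟨ typeofA (ap1 (vs (vs vz)) #0) #1 ⟩)))
  ∷ ([] ⊩ (k0 zero ⇓ k0 zero) ← k0 tt)
  ∷ ([] ⊩ (k0 true ⇓ k0 true) ← k0 tt)
  ∷ ([] ⊩ (k0 false ⇓ k0 false) ← k0 tt)
  ∷ ((I' ∷ I' ∷ []) ⊩ (k1 succ #0 ⇓ k1 succ #1) ← ⟨ #0 ⇓ #1 ⟩)             -- M V
  ∷ ((I' ∷ []) ⊩ (k1 pred #0 ⇓ k0 zero) ← ⟨ #0 ⇓ k0 zero ⟩)
  ∷ ((I' ∷ I' ∷ []) ⊩ (k1 pred #0 ⇓ #1) ← ⟨ #0 ⇓ k1 succ #1 ⟩)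
  ∷ ((I' ∷ []) ⊩ (k1 is-zero #0 ⇓ k0 true) ← ⟨ #0 ⇓ k0 zero ⟩)
  ∷ ((I' ∷ I' ∷ []) ⊩ (k1 is-zero #0 ⇓ k0 false) ← ⟨ #0 ⇓ k1 succ #1 ⟩)
  ∷ ((I' ∷ I' ∷ I' ∷ I' ∷ []) ⊩ (k3 if #0 #1 #2 ⇓ #3)                     -- M N1 N2 V
       ← (⟨ #0 ⇓ k0 true ⟩ & ⟨ #1 ⇓ #3 ⟩))
  ∷ ((I' ∷ I' ∷ I' ∷ I' ∷ []) ⊩ (k3 if #0 #1 #2 ⇓ #3)
       ← (⟨ #0 ⇓ k0 false ⟩ & ⟨ #2 ⇓ #3 ⟩))
  ∷ ((I' ∷ (I' ⇒ I') ∷ []) ⊩ (k2 abs #0 #1 ⇓ k2 abs #0 #1) ← k0 tt)        -- T R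
  ∷ ((I' ∷ I' ∷ I' ∷ I' ∷ (I' ⇒ I') ∷ []) ⊩ (k2 app #0 #1 ⇓ #2)           -- M N V T R
       ← (⟨ #0 ⇓ k2 abs #3 (nvar (vs (vs (vs (vs vz))))) ⟩
          & ⟨ ap1 (vs (vs (vs (vs vz)))) #1 ⇓ #2 ⟩))
  ∷ ((I' ∷ (I' ⇒ I') ∷ I' ∷ []) ⊩ (k2 rec #0 #1 ⇓ #2)                    -- T R V
       ← ⟨ ap1 (vs vz) (k2 rec #0 #1) ⇓ #2 ⟩)
  ∷ ((I' ∷ I' ∷ []) ⊩ (k1 succ #0 ↝ k1 succ #1) ← ⟨ #0 ↝ #1 ⟩)             -- M M'
  ∷ ([] ⊩ (k1 pred (k0 zero) ↝ k0 zero) ← k0 tt)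
  ∷ ((I' ∷ []) ⊩ (k1 pred (k1 succ #0) ↝ #0) ← ⟨ valueA #0 ⟩)
  ∷ ((I' ∷ I' ∷ []) ⊩ (k1 pred #0 ↝ k1 pred #1) ← ⟨ #0 ↝ #1 ⟩)
  ∷ ([] ⊩ (k1 is-zero (k0 zero) ↝ k0 true) ← k0 tt)
  ∷ ((I' ∷ []) ⊩ (k1 is-zero (k1 succ #0) ↝ k0 false) ← ⟨ valueA #0 ⟩)
  ∷ ((I' ∷ I' ∷ []) ⊩ (k1 is-zero #0 ↝ k1 is-zero #1) ← ⟨ #0 ↝ #1 ⟩)
  ∷ ((I' ∷ I' ∷ []) ⊩ (k3 if (k0 true) #0 #1 ↝ #0) ← k0 tt)                -- M N
  ∷ ((I' ∷ I' ∷ []) ⊩ (k3 if (k0 false) #0 #1 ↝ #1) ← k0 tt)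
  ∷ ((I' ∷ I' ∷ I' ∷ I' ∷ []) ⊩ (k3 if #0 #2 #3 ↝ k3 if #1 #2 #3)         -- M M' N1 N2
       ← ⟨ #0 ↝ #1 ⟩)
  ∷ ((I' ∷ (I' ⇒ I') ∷ I' ∷ []) ⊩ (k2 app (k2 abs #0 #1) #2 ↝ ap1 (vs vz) #2)  -- T R N
       ← k0 tt)
  ∷ ((I' ∷ I' ∷ I' ∷ []) ⊩ (k2 app #0 #2 ↝ k2 app #1 #2) ← ⟨ #0 ↝ #1 ⟩)  -- M M' N
  ∷ ((I' ∷ (I' ⇒ I') ∷ []) ⊩ (k2 rec #0 #1 ↝ ap1 (vs vz) (k2 rec #0 #1)) ← k0 tt)
  ∷ ((I' ∷ []) ⊩ (#0 ↝* #0) ← k0 tt)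
  ∷ ((I' ∷ I' ∷ I' ∷ []) ⊩ (#0 ↝* #1) ← (⟨ #0 ↝ #2 ⟩ & ⟨ #2 ↝* #1 ⟩))    -- M N M'
  ∷ ([] ⊩ valueA (k0 zero) ← k0 tt)
  ∷ ([] ⊩ valueA (k0 true) ← k0 tt)
  ∷ ([] ⊩ valueA (k0 false) ← k0 tt)
  ∷ ((I' ∷ []) ⊩ valueA (k1 succ #0) ← ⟨ valueA #0 ⟩)
  ∷ ((I' ∷ (I' ⇒ I') ∷ []) ⊩ valueA (k2 abs #0 #1) ← k0 tt)
  ∷ []

definition : List Clause
definition = Dnat ++ Dlist ++ Dintuit ++ DPCF ++
             (clause (I' ∷ []) (k2 equiv #0 #0) ⊤F ∷ [])

-- Unifiers and complete sets of unifiers for  A (over eigenvariables Ψ)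
-- and the head of a clause (variables renamed apart: ctx cl).
-- A unifier is (Ψ', ρ, σ) with Aρ = head σ, Ψ' its new eigenvariables.

Unifier : ∀ {Ψ} → Fm Ψ → (cl : Clause) → (Ψ' : Ctx) → Sub Ψ' Ψ → Sub Ψ' (ctx cl) → Set
Unifier A cl Ψ' ρ σ = sub ρ A ≡ sub σ (head cl)

UnifSet : Ctx → Clause → Set₁
UnifSet Ψ cl = (Ψ' : Ctx) → Sub Ψ' Ψ → Sub Ψ' (ctx cl) → Set

record CSU {Ψ} (A : Fm Ψ) (cl : Clause) (S : UnifSet Ψ cl) : Set where
  field
    sound    : ∀ Ψ' (ρ : Sub Ψ' Ψ) (σ : Sub Ψ' (ctx cl)) → S Ψ' ρ σ → OFreeCtx Ψ' × Unifier A cl Ψ' ρ σ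
    complete : ∀ Ψ'' → OFreeCtx Ψ'' → ∀ (ρ' : Sub Ψ'' Ψ) (σ' : Sub Ψ'' (ctx cl)) →
               Unifier A cl Ψ'' ρ' σ' →
               Σ[ Ψ' ∈ Ctx ] Σ[ ρ ∈ Sub Ψ' Ψ ] Σ[ σ ∈ Sub Ψ' (ctx cl) ]
               (S Ψ' ρ σ × Σ[ η ∈ Sub Ψ'' Ψ' ] ((ρ' ≐ (ρ ⊙ η)) × (σ' ≐ (σ ⊙ η))))

-- The sequent calculus FOλ^{ΔN} relative to `definition`.
-- Ψ ; Γ ⟶ C : eigenvariables Ψ, hypotheses Γ (a multiset: exchange rule).

infix 2 _⨾_⟶_
data _⨾_⟶_ : (Ψ : Ctx) → List (Fm Ψ) → Fm Ψ → Set₁ where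
  exch  : ∀ {Ψ Γ Γ' C} → Γ ↭ Γ' → Ψ ⨾ Γ ⟶ C → Ψ ⨾ Γ' ⟶ C
  ⊥L    : ∀ {Ψ Γ C} → Ψ ⨾ ⊥F ∷ Γ ⟶ C
  ⊤R    : ∀ {Ψ Γ} → Ψ ⨾ Γ ⟶ ⊤F
  ∧L₁   : ∀ {Ψ Γ B C D} → Ψ ⨾ B ∷ Γ ⟶ D → Ψ ⨾ (B ∧F C) ∷ Γ ⟶ D
  ∧L₂   : ∀ {Ψ Γ B C D} → Ψ ⨾ C ∷ Γ ⟶ D → Ψ ⨾ (B ∧F C) ∷ Γ ⟶ D
  ∧R    : ∀ {Ψ Γ B C} → Ψ ⨾ Γ ⟶ B → Ψ ⨾ Γ ⟶ C → Ψ ⨾ Γ ⟶ B ∧F C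
  ∨L    : ∀ {Ψ Γ B C D} → Ψ ⨾ B ∷ Γ ⟶ D → Ψ ⨾ C ∷ Γ ⟶ D → Ψ ⨾ (B ∨F C) ∷ Γ ⟶ D
  ∨R₁   : ∀ {Ψ Γ B C} → Ψ ⨾ Γ ⟶ B → Ψ ⨾ Γ ⟶ B ∨F C
  ∨R₂   : ∀ {Ψ Γ B C} → Ψ ⨾ Γ ⟶ C → Ψ ⨾ Γ ⟶ B ∨F C
  ⊃L    : ∀ {Ψ Δ₁ Δ₂ B C D} → Ψ ⨾ Δ₁ ⟶ B → Ψ ⨾ C ∷ Δ₂ ⟶ D →
          Ψ ⨾ (B ⊃F C) ∷ (Δ₁ ++ Δ₂) ⟶ D
  ⊃R    : ∀ {Ψ Γ B C} → Ψ ⨾ B ∷ Γ ⟶ C → Ψ ⨾ Γ ⟶ B ⊃F C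
  ∀L    : ∀ {Ψ Γ τ p B C} (t : Nf Ψ τ) → Ψ ⨾ (B ·₁ t) ∷ Γ ⟶ C → Ψ ⨾ ∀F τ p B ∷ Γ ⟶ C
  ∀R    : ∀ {Ψ Γ τ p B} → (τ ∷ Ψ) ⨾ map wk Γ ⟶ (wk B ·₁ nvar vz) → Ψ ⨾ Γ ⟶ ∀F τ p B
  ∃L    : ∀ {Ψ Γ τ p B C} → (τ ∷ Ψ) ⨾ (wk B ·₁ nvar vz) ∷ map wk Γ ⟶ wk C →
          Ψ ⨾ ∃F τ p B ∷ Γ ⟶ C
  ∃R    : ∀ {Ψ Γ τ p B} (t : Nf Ψ τ) → Ψ ⨾ Γ ⟶ (B ·₁ t) → Ψ ⨾ Γ ⟶ ∃F τ p B
  init  : ∀ {Ψ Γ A} → Atomic A → Ψ ⨾ A ∷ Γ ⟶ A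
  cL    : ∀ {Ψ Γ B C} → Ψ ⨾ B ∷ B ∷ Γ ⟶ C → Ψ ⨾ B ∷ Γ ⟶ C
  cut   : ∀ {Ψ Δ₁ Δ₂ B C} → Ψ ⨾ Δ₁ ⟶ B → Ψ ⨾ B ∷ Δ₂ ⟶ C → Ψ ⨾ Δ₁ ++ Δ₂ ⟶ C
  natz  : ∀ {Ψ Γ} → Ψ ⨾ Γ ⟶ natF zN
  nats  : ∀ {Ψ Γ I} → Ψ ⨾ Γ ⟶ natF I → Ψ ⨾ Γ ⟶ natF (sN I)
  natL  : ∀ {Ψ Γ C I} (B : Nf Ψ (Nt ⇒ ` o)) →
          Ψ ⨾ [] ⟶ (B ·₁ zN) →
          (Nt ∷ Ψ) ⨾ (wk B ·₁ nvar vz) ∷ [] ⟶ (wk B ·₁ sN (nvar vz)) →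
          Ψ ⨾ (B ·₁ I) ∷ Γ ⟶ C →
          Ψ ⨾ natF I ∷ Γ ⟶ C
  defR  : ∀ {Ψ Γ A} (cl : Clause) → cl ∈ definition → (θ : Sub Ψ (ctx cl)) →
          A ≡ sub θ (head cl) → Ψ ⨾ Γ ⟶ sub θ (body cl) → Ψ ⨾ Γ ⟶ A
  defL  : ∀ {Ψ Γ A C} → DefAtom A →
          (∀ cl → cl ∈ definition →
             Σ[ S ∈ UnifSet Ψ cl ] (CSU A cl S ×
               (∀ Ψ' (ρ : Sub Ψ' Ψ) (σ : Sub Ψ' (ctx cl)) → S Ψ' ρ σ →
                  Ψ' ⨾ sub σ (body cl) ∷ map (sub ρ) Γ ⟶ sub ρ C))) →
          Ψ ⨾ A ∷ Γ ⟶ C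

Derivable : Fm [] → Set₁
Derivable F = [] ⨾ [] ⟶ F

⊢F : ∀ {Γ} → Nf Γ Prp → Fm Γ
⊢F B = ∃F Nt ofnt (lam (natF #0 ∧F k3 seq #0 (k0 nil) (wk B)))

∀i : ∀ {Γ} → Fm (I' ∷ Γ) → Fm Γ
∀i B = ∀F I' ofi (lam B)

_≡F_ : ∀ {Γ} → Nf Γ I' → Nf Γ I' → Fm Γ
_≡F_ = k2 equiv

det-eval det-step det-steps : Fm []
det-eval = ∀i (∀i (∀i (⊢F ⟨ #2 ⇓ #1 ⟩ ⊃F ⊢F ⟨ #2 ⇓ #0 ⟩ ⊃F (#1 ≡F #0))))
det-step = ∀i (∀i (∀i (⊢F ⟨ #2 ↝ #1 ⟩ ⊃F ⊢F ⟨ #2 ↝ #0 ⟩ ⊃F (#1 ≡F #0))))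
det-steps = ∀i (∀i (∀i (⊢F ⟨ valueA #1 ⟩ ⊃F ⊢F ⟨ #2 ↝* #1 ⟩ ⊃F
                        ⊢F ⟨ valueA #0 ⟩ ⊃F ⊢F ⟨ #2 ↝* #0 ⟩ ⊃F (#1 ≡F #0))))

equiv₁ equiv₂ : Fm []
equiv₁ = ∀i (∀i (⊢F ⟨ #1 ⇓ #0 ⟩ ⊃F (⊢F ⟨ valueA #0 ⟩ ∧F ⊢F ⟨ #1 ↝* #0 ⟩)))
equiv₂ = ∀i (∀i ((⊢F ⟨ valueA #0 ⟩ ∧F ⊢F ⟨ #1 ↝* #0 ⟩) ⊃F ⊢F ⟨ #1 ⇓ #0 ⟩))

subject-reduction : (∀ {Γ} → Nf Γ I' → Nf Γ I' → Nf Γ Atm) → Fm []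
subject-reduction R =
  ∀i (∀i (⊢F ⟨ R #1 #0 ⟩ ⊃F ∀i (⊢F ⟨ typeofA #2 #0 ⟩ ⊃F ⊢F ⟨ typeofA #1 #0 ⟩)))

unicity : Fm []
unicity = ∀i (∀i (∀i (⊢F ⟨ typeofA #2 #1 ⟩ ⊃F ⊢F ⟨ typeofA #2 #0 ⟩ ⊃F (#1 ≡F #0))))

{-# OPTIONS --safe #-}
-- Since any complete set of unifiers may be used in defL, we take the set of all unifiers; then
-- weakening and substitution are admissible, and provability becomes a Kripke model whose worlds
-- are pairs (eigenvariables; hypotheses), with substitution instances as extensions.  Formulas
-- built from ∀ and ⊃ are equivalent to their reading in this model, so induction with such a
-- formula as invariant is ordinary reasoning about worlds.
-- In the object logic, seq is monotone in its index, which makes plain induction on the index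
-- suffice everywhere.  Cut is proved for simultaneous substitution of derivations for hypotheses,
-- with a bound on the index that is uniform in the sequent.  Since ⋀ is read as ∀, it has no fresh
-- variables; in unicity of typing it is instantiated with rec T (λx. x), a term of unique type T.
module Submission where

open import Defs
open import Data.Product using (Σ-syntax; _×_; _,_; proj₁; proj₂)
open import Data.Fin using (Fin; #_)
open import Data.List using (List; []; _∷_; map; _++_; lookup)
open import Data.List.Properties using (map-++; map-∘; map-cong; ++-identityʳ)
open import Data.List.Membership.Propositional using (_∈_)
open import Data.List.Membership.Propositional.Properties using (∈-lookup)
open import Data.List.Relation.Binary.Permutation.Propositional using (_↭_; ↭-refl; ↭-sym; ↭-trans; prep; swap)
open import Data.List.Relation.Binary.Permutation.Propositional.Properties using (map⁺; shift; ++⁺ˡ)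
open import Data.List.Relation.Unary.All as All using (All; []; _∷_)
open import Data.Nat using (ℕ; zero; suc; _+_; _≤_)
open import Data.Nat.Properties using (≤-refl; ≤-trans; ≤-pred; m≤m+n; m≤n+m; +-comm; +-suc; +-monoʳ-≤)
open import Data.Sum using (_⊎_; inj₁; inj₂)
open import Data.Unit using (⊤; tt)
open import Relation.Binary.PropositionalEquality using (_≡_; refl; sym; trans; cong; cong₂; subst; subst₂; module ≡-Reasoning)

-- Two features of the calculus shape the proof. The base and step premises of its induction rule
-- carry no side hypotheses, so whatever is assumed about other parameters has to be part of the
-- invariant; every invariant here is closed apart from the index. And only ∀ and ⊃ are read
-- faithfully in the model: an existential or a definitional case can be opened only while a sequent
-- is being proved, whence the eliminations by continuation and the Church-encoded bounds. The
-- syntactic preliminaries are the price of canonical forms. Moving between worlds is substitution,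
-- and its composition law must be proved for hereditary substitution, where contracting one redex
-- creates others at smaller types.

private variable
  Γ Δ Θ Ψ Ψ' : Ctx
  σ τ υ : Ty

-- Renamings

renH-cong : {ρ ρ' : Ren Γ Δ} → (∀ {τ} (x : Var Γ τ) → ρ x ≡ ρ' x) → (h : Head Γ τ) → renH ρ h ≡ renH ρ' h
renH-cong e (var x) = cong var (e x)
renH-cong e (con c) = refl

liftR-cong : {ρ ρ' : Ren Γ Δ} → (∀ {τ} (x : Var Γ τ) → ρ x ≡ ρ' x) → (x : Var (σ ∷ Γ) τ) → liftR ρ x ≡ liftR ρ' x
liftR-cong e vz = refl
liftR-cong e (vs x) = cong vs (e x)

mutual
  ren-cong : {ρ ρ' : Ren Γ Δ} → (∀ {τ} (x : Var Γ τ) → ρ x ≡ ρ' x) → (t : Nf Γ τ) → renNf ρ t ≡ renNf ρ' t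
  ren-cong e (lam t) = cong lam (ren-cong (liftR-cong e) t)
  ren-cong e (ne h sp) = cong₂ ne (renH-cong e h) (renSp-cong e sp)

  renSp-cong : {ρ ρ' : Ren Γ Δ} → (∀ {τ} (x : Var Γ τ) → ρ x ≡ ρ' x) → (sp : Sp Γ τ υ) → renSp ρ sp ≡ renSp ρ' sp
  renSp-cong e ε = refl
  renSp-cong e (t ∷ₛ sp) = cong₂ _∷ₛ_ (ren-cong e t) (renSp-cong e sp)

renH-∘ : (ρ : Ren Γ Δ) (ρ' : Ren Δ Θ) (h : Head Γ τ) → renH ρ' (renH ρ h) ≡ renH (λ x → ρ' (ρ x)) h
renH-∘ ρ ρ' (var x) = refl
renH-∘ ρ ρ' (con c) = refl

liftR-∘ : (ρ : Ren Γ Δ) (ρ' : Ren Δ Θ) (x : Var (σ ∷ Γ) τ) → liftR ρ' (liftR ρ x) ≡ liftR (λ y → ρ' (ρ y)) x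
liftR-∘ ρ ρ' vz = refl
liftR-∘ ρ ρ' (vs x) = refl

mutual
  ren-∘ : (ρ : Ren Γ Δ) (ρ' : Ren Δ Θ) (t : Nf Γ τ) → renNf ρ' (renNf ρ t) ≡ renNf (λ x → ρ' (ρ x)) t
  ren-∘ ρ ρ' (lam t) = cong lam (trans (ren-∘ (liftR ρ) (liftR ρ') t) (ren-cong (liftR-∘ ρ ρ') t))
  ren-∘ ρ ρ' (ne h sp) = cong₂ ne (renH-∘ ρ ρ' h) (renSp-∘ ρ ρ' sp)

  renSp-∘ : (ρ : Ren Γ Δ) (ρ' : Ren Δ Θ) (sp : Sp Γ τ υ) → renSp ρ' (renSp ρ sp) ≡ renSp (λ x → ρ' (ρ x)) sp
  renSp-∘ ρ ρ' ε = refl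
  renSp-∘ ρ ρ' (t ∷ₛ sp) = cong₂ _∷ₛ_ (ren-∘ ρ ρ' t) (renSp-∘ ρ ρ' sp)

ren-wk : (ρ : Ren Γ Δ) (t : Nf Γ τ) → renNf (liftR {σ = σ} ρ) (wk t) ≡ wk (renNf ρ t)
ren-wk ρ t = trans (ren-∘ vs (liftR ρ) t) (sym (ren-∘ ρ vs t))

renSp-wk : (ρ : Ren Γ Δ) (sp : Sp Γ τ υ) → renSp (liftR {σ = σ} ρ) (renSp vs sp) ≡ renSp vs (renSp ρ sp)
renSp-wk ρ sp = trans (renSp-∘ vs (liftR ρ) sp) (sym (renSp-∘ ρ vs sp))

renSp-snoc : (ρ : Ren Γ Δ) (sp : Sp Γ υ (σ ⇒ τ)) (u : Nf Γ σ) → renSp ρ (snoc sp u) ≡ snoc (renSp ρ sp) (renNf ρ u)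
renSp-snoc ρ ε u = refl
renSp-snoc ρ (t ∷ₛ sp) u = cong (_ ∷ₛ_) (renSp-snoc ρ sp u)

ren-eta : (ρ : Ren Γ Δ) (τ : Ty) (h : Head Γ υ) (sp : Sp Γ υ τ) → renNf ρ (eta τ h sp) ≡ eta τ (renH ρ h) (renSp ρ sp)
ren-eta ρ (` b) h sp = refl
ren-eta ρ (σ ⇒ τ) h sp = cong lam (begin
  renNf (liftR ρ) (eta τ (renH vs h) (snoc (renSp vs sp) (nvar vz)))
    ≡⟨ ren-eta (liftR ρ) τ _ _ ⟩
  eta τ (renH (liftR ρ) (renH vs h)) (renSp (liftR ρ) (snoc (renSp vs sp) (nvar vz)))
    ≡⟨ cong₂ (eta τ) (trans (renH-∘ vs (liftR ρ) h) (sym (renH-∘ ρ vs h)))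
         (trans (renSp-snoc (liftR ρ) (renSp vs sp) _)
            (cong₂ snoc (renSp-wk ρ sp) (ren-eta (liftR ρ) σ (var vz) ε))) ⟩
  eta τ (renH vs (renH ρ h)) (snoc (renSp vs (renSp ρ sp)) (nvar vz)) ∎)
  where open ≡-Reasoning

ren-nvar : (ρ : Ren Γ Δ) (x : Var Γ τ) → renNf ρ (nvar x) ≡ nvar (ρ x)
ren-nvar ρ x = ren-eta ρ _ (var x) ε

-- Single substitution against renaming

eqv-same : (x : Var Γ σ) → eqv x x ≡ same
eqv-same vz = refl
eqv-same (vs x) = cong liftEq (eqv-same x)

eqv-diff : (x : Var Γ σ) (y : Var (Γ - x) τ) → eqv x (wkv x y) ≡ diff y
eqv-diff vz y = refl
eqv-diff (vs x) vz = refl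
eqv-diff (vs x) (vs y) = cong liftEq (eqv-diff x y)

-- The condition for renaming to commute with a substitution for `x`. The position of `x` is
-- arbitrary because each binder shifts it.
record RenAt (x : Var Γ σ) (x' : Var Δ σ) (ρ : Ren Γ Δ) (ρ' : Ren (Γ - x) (Δ - x')) : Set where
  field
    on-same : ρ x ≡ x'
    on-diff : ∀ {τ} (y : Var (Γ - x) τ) → ρ (wkv x y) ≡ wkv x' (ρ' y)
open RenAt

RenAt-lift : {x : Var Γ σ} {x' : Var Δ σ} {ρ : Ren Γ Δ} {ρ' : Ren (Γ - x) (Δ - x')} →
             RenAt x x' ρ ρ' → RenAt (vs {σ = τ} x) (vs x') (liftR ρ) (liftR ρ')
on-same (RenAt-lift r) = cong vs (on-same r)
on-diff (RenAt-lift r) vz = refl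
on-diff (RenAt-lift r) (vs y) = cong vs (on-diff r y)

RenAt-vz : (ρ : Ren Γ Δ) → RenAt (vz {τ = σ}) vz (liftR ρ) ρ
on-same (RenAt-vz ρ) = refl
on-diff (RenAt-vz ρ) y = refl

mutual
  ren-subst1 : {x : Var Γ σ} {x' : Var Δ σ} {ρ : Ren Γ Δ} {ρ' : Ren (Γ - x) (Δ - x')} → RenAt x x' ρ ρ' →
               (t : Nf Γ τ) (u : Nf (Γ - x) σ) → renNf ρ' (subst1 t x u) ≡ subst1 (renNf ρ t) x' (renNf ρ' u)
  ren-subst1 {x' = x'} {ρ} {ρ'} r (lam t) u =
    cong lam (trans (ren-subst1 (RenAt-lift r) t (wk u)) (cong (subst1 (renNf (liftR ρ) t) (vs x')) (ren-wk ρ' u)))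
  ren-subst1 r (ne (con c) sp) u = cong (ne (con c)) (renSp-subst1 r sp u)
  ren-subst1 {x = x} {x'} {ρ} {ρ'} r (ne (var y) sp) u =
    trans (ren-hv r (eqv x y) (substSp sp x u) u)
      (cong (λ sp' → hv x' (eqv x' (ρ y)) sp' (renNf ρ' u)) (renSp-subst1 r sp u))

  ren-hv : {x : Var Γ σ} {x' : Var Δ σ} {ρ : Ren Γ Δ} {ρ' : Ren (Γ - x) (Δ - x')} → RenAt x x' ρ ρ' →
           ∀ {b} {y : Var Γ τ} (e : EqV x y) (sp : Sp (Γ - x) τ (` b)) (u : Nf (Γ - x) σ) →
           renNf ρ' (hv x e sp u) ≡ hv x' (eqv x' (ρ y)) (renSp ρ' sp) (renNf ρ' u)
  ren-hv {x' = x'} {ρ} r same sp u rewrite on-same r | eqv-same x' = ren-◇ _ u sp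
  ren-hv {x' = x'} {ρ} {ρ'} r (diff y) sp u rewrite on-diff r y | eqv-diff x' (ρ' y) = refl

  renSp-subst1 : {x : Var Γ σ} {x' : Var Δ σ} {ρ : Ren Γ Δ} {ρ' : Ren (Γ - x) (Δ - x')} → RenAt x x' ρ ρ' →
                 (sp : Sp Γ τ υ) (u : Nf (Γ - x) σ) → renSp ρ' (substSp sp x u) ≡ substSp (renSp ρ sp) x' (renNf ρ' u)
  renSp-subst1 r ε u = refl
  renSp-subst1 r (t ∷ₛ sp) u = cong₂ _∷ₛ_ (ren-subst1 r t u) (renSp-subst1 r sp u)

  ren-◇ : (ρ : Ren Γ Δ) (t : Nf Γ τ) (sp : Sp Γ τ υ) → renNf ρ (t ◇ sp) ≡ renNf ρ t ◇ renSp ρ sp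
  ren-◇ ρ t ε = refl
  ren-◇ ρ (lam t) (u ∷ₛ sp) =
    trans (ren-◇ ρ (subst1 t vz u) sp) (cong (_◇ renSp ρ sp) (ren-subst1 (RenAt-vz ρ) t u))

liftR-wkv : (x : Var Γ σ) (y : Var (υ ∷ (Γ - x)) τ) → liftR (wkv x) y ≡ wkv (vs x) y
liftR-wkv x vz = refl
liftR-wkv x (vs y) = refl

mutual
  subst1-wkv : (x : Var Γ σ) (t : Nf (Γ - x) τ) (u : Nf (Γ - x) σ) → subst1 (renNf (wkv x) t) x u ≡ t
  subst1-wkv x (lam t) u =
    cong lam (trans (cong (λ r → subst1 r (vs x) (wk u)) (ren-cong (liftR-wkv x) t)) (subst1-wkv (vs x) t (wk u)))
  subst1-wkv x (ne (var y) sp) u rewrite eqv-diff x y = cong (ne (var y)) (substSp-wkv x sp u)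
  subst1-wkv x (ne (con c) sp) u = cong (ne (con c)) (substSp-wkv x sp u)

  substSp-wkv : (x : Var Γ σ) (sp : Sp (Γ - x) τ υ) (u : Nf (Γ - x) σ) → substSp (renSp (wkv x) sp) x u ≡ sp
  substSp-wkv x ε u = refl
  substSp-wkv x (t ∷ₛ sp) u = cong₂ _∷ₛ_ (subst1-wkv x t u) (substSp-wkv x sp u)

substSp-snoc : (sp : Sp Γ υ (σ ⇒ τ)) (t : Nf Γ σ) {υ' : Ty} (x : Var Γ υ') (u : Nf (Γ - x) υ') →
               substSp (snoc sp t) x u ≡ snoc (substSp sp x u) (subst1 t x u)
substSp-snoc ε t x u = refl
substSp-snoc (r ∷ₛ sp) t x u = cong (_ ∷ₛ_) (substSp-snoc sp t x u)

substSp-renvs : {x : Var Γ σ} (sp : Sp Γ τ υ) (u : Nf (Γ - x) σ) {τ' : Ty} →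
                substSp (renSp (vs {σ = τ'}) sp) (vs x) (wk u) ≡ renSp vs (substSp sp x u)
substSp-renvs sp u = sym (renSp-subst1 (record { on-same = refl ; on-diff = λ y → refl }) sp u)

-- η-expansion

renH-wkv : (x : Var Γ σ) (h : Head (Γ - x) τ) → renH (vs {σ = υ}) (renH (wkv x) h) ≡ renH (wkv (vs x)) (renH vs h)
renH-wkv x (var y) = refl
renH-wkv x (con c) = refl

-- Writing the head as `renH (wkv x) h` says that it is not `x`: no redex arises and only the spine
-- changes. `subst1-eta-var` treats the head `x`.
subst1-eta : (τ : Ty) (x : Var Γ σ) (h : Head (Γ - x) υ) (sp : Sp Γ υ τ) (u : Nf (Γ - x) σ) →
             subst1 (eta τ (renH (wkv x) h) sp) x u ≡ eta τ h (substSp sp x u)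
subst1-eta (` b) x (var y) sp u rewrite eqv-diff x y = refl
subst1-eta (` b) x (con c) sp u = refl
subst1-eta (σ ⇒ τ) x h sp u = cong lam (begin
  subst1 (eta τ (renH vs (renH (wkv x) h)) sp⁺) (vs x) (wk u)
    ≡⟨ cong (λ k → subst1 (eta τ k sp⁺) (vs x) (wk u)) (renH-wkv x h) ⟩
  subst1 (eta τ (renH (wkv (vs x)) (renH vs h)) sp⁺) (vs x) (wk u)
    ≡⟨ subst1-eta τ (vs x) (renH vs h) sp⁺ (wk u) ⟩
  eta τ (renH vs h) (substSp sp⁺ (vs x) (wk u))
    ≡⟨ cong (eta τ (renH vs h)) (trans (substSp-snoc (renSp vs sp) (nvar vz) (vs x) (wk u))
         (cong₂ snoc (substSp-renvs sp u) (subst1-eta σ (vs x) (var vz) ε (wk u)))) ⟩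
  eta τ (renH vs h) (snoc (renSp vs (substSp sp x u)) (nvar vz)) ∎)
  where
    open ≡-Reasoning
    sp⁺ = snoc (renSp vs sp) (nvar vz)

◇-snoc : (t : Nf Γ υ) (sp : Sp Γ υ (σ ⇒ τ)) (u : Nf Γ σ) → t ◇ snoc sp u ≡ (t ◇ sp) ·₁ u
◇-snoc t ε u = refl
◇-snoc (lam t) (r ∷ₛ sp) u = ◇-snoc (subst1 t vz r) sp u

_+++_ : Sp Γ υ σ → Sp Γ σ τ → Sp Γ υ τ
ε +++ sp' = sp'
(t ∷ₛ sp) +++ sp' = t ∷ₛ (sp +++ sp')

snoc-+++ : (sp : Sp Γ υ (σ ⇒ τ)) {τ' : Ty} (u : Nf Γ σ) (sp' : Sp Γ τ τ') → snoc sp u +++ sp' ≡ sp +++ (u ∷ₛ sp')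
snoc-+++ ε u sp' = refl
snoc-+++ (t ∷ₛ sp) u sp' = cong (t ∷ₛ_) (snoc-+++ sp u sp')

+++-ε : (sp : Sp Γ υ τ) → sp +++ ε ≡ sp
+++-ε ε = refl
+++-ε (t ∷ₛ sp) = cong (t ∷ₛ_) (+++-ε sp)

-- A predicate on types, so that `subst1-var` and `eta-expand` can assume it at the type of the
-- variable concerned. `neutral-app` and `subst1-eta-var` then establish it together, calling each
-- other only at smaller types.
NeutralApp : Ty → Set
NeutralApp τ = ∀ {Γ υ b} (h : Head Γ υ) (sp : Sp Γ υ τ) (sp' : Sp Γ τ (` b)) → eta τ h sp ◇ sp' ≡ ne h (sp +++ sp')

mutual
  -- The inserted variable is η-long, so in head position it forms a redex; `N` contracts it back to
  -- a neutral term.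
  subst1-var : NeutralApp σ → (x : Var Γ σ) (y : Var (Γ - x) σ) (ρ : Ren Γ (Γ - x)) → ρ x ≡ y →
               (∀ {τ} (y' : Var (Γ - x) τ) → ρ (wkv x y') ≡ y') →
               (t : Nf Γ τ) → subst1 t x (nvar y) ≡ renNf ρ t
  subst1-var N x y ρ e d (lam t) = cong lam (trans (cong (subst1 t (vs x)) (ren-nvar vs y))
    (subst1-var N (vs x) (vs y) (liftR ρ) (cong vs e) (λ { vz → refl ; (vs y') → cong vs (d y') }) t))
  subst1-var N x y ρ e d (ne (con c) sp) = cong (ne (con c)) (substSp-var N x y ρ e d sp)
  subst1-var N x y ρ e d (ne (var v) sp) =
    trans (cong (λ r → hv x (eqv x v) r (nvar y)) (substSp-var N x y ρ e d sp)) (case (eqv x v))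
    where
      case : (q : EqV x v) → hv x q (renSp ρ sp) (nvar y) ≡ ne (var (ρ v)) (renSp ρ sp)
      case same = trans (N (var y) ε (renSp ρ sp)) (cong (λ w → ne (var w) (renSp ρ sp)) (sym e))
      case (diff y') = cong (λ w → ne (var w) (renSp ρ sp)) (sym (d y'))

  substSp-var : NeutralApp σ → (x : Var Γ σ) (y : Var (Γ - x) σ) (ρ : Ren Γ (Γ - x)) → ρ x ≡ y →
                (∀ {τ} (y' : Var (Γ - x) τ) → ρ (wkv x y') ≡ y') →
                (sp : Sp Γ τ υ) → substSp sp x (nvar y) ≡ renSp ρ sp
  substSp-var N x y ρ e d ε = refl
  substSp-var N x y ρ e d (t ∷ₛ sp) = cong₂ _∷ₛ_ (subst1-var N x y ρ e d t) (substSp-var N x y ρ e d sp)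

mutual
  ren-id : (t : Nf Γ τ) {ρ : Ren Γ Γ} → (∀ {τ} (x : Var Γ τ) → ρ x ≡ x) → renNf ρ t ≡ t
  ren-id (lam t) e = cong lam (ren-id t (λ { vz → refl ; (vs x) → cong vs (e x) }))
  ren-id (ne (var x) sp) e = cong₂ (λ y → ne (var y)) (e x) (renSp-id sp e)
  ren-id (ne (con c) sp) e = cong (ne (con c)) (renSp-id sp e)

  renSp-id : (sp : Sp Γ τ υ) {ρ : Ren Γ Γ} → (∀ {τ} (x : Var Γ τ) → ρ x ≡ x) → renSp ρ sp ≡ sp
  renSp-id ε e = refl
  renSp-id (t ∷ₛ sp) e = cong₂ _∷ₛ_ (ren-id t e) (renSp-id sp e)

eta-expand : NeutralApp σ → (t : Nf Γ (σ ⇒ τ)) → lam (wk t ·₁ nvar vz) ≡ t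
eta-expand {σ = σ} {Γ = Γ} N (lam t) = cong lam (begin
  subst1 (renNf (liftR vs) t) vz (nvar vz)
    ≡⟨ subst1-var N vz vz back refl (λ y → refl) (renNf (liftR vs) t) ⟩
  renNf back (renNf (liftR vs) t)
    ≡⟨ ren-∘ (liftR vs) back t ⟩
  renNf (λ x → back (liftR vs x)) t
    ≡⟨ ren-id t (λ { vz → refl ; (vs x) → refl }) ⟩
  t ∎)
  where
    open ≡-Reasoning
    back : Ren (σ ∷ σ ∷ Γ) (σ ∷ Γ)
    back vz = vz
    back (vs x) = x

mutual
  neutral-app : (τ : Ty) → NeutralApp τ
  neutral-app (` b) h sp ε = cong (ne h) (sym (+++-ε sp))
  neutral-app (σ ⇒ τ) h sp (u ∷ₛ sp') = begin
    subst1 (eta τ (renH vs h) sp⁺) vz u ◇ sp'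
      ≡⟨ cong (_◇ sp') (trans (subst1-eta τ vz h sp⁺ u) (cong (eta τ h)
           (trans (substSp-snoc (renSp vs sp) (nvar vz) vz u)
             (cong₂ snoc (substSp-wkv vz sp u) (subst1-eta-var σ vz ε u))))) ⟩
    eta τ h (snoc sp u) ◇ sp'
      ≡⟨ neutral-app τ h (snoc sp u) sp' ⟩
    ne h (snoc sp u +++ sp')
      ≡⟨ cong (ne h) (snoc-+++ sp u sp') ⟩
    ne h (sp +++ (u ∷ₛ sp')) ∎
    where
      open ≡-Reasoning
      sp⁺ = snoc (renSp vs sp) (nvar vz)

  subst1-eta-var : (τ : Ty) (x : Var Γ σ) (sp : Sp Γ σ τ) (u : Nf (Γ - x) σ) →
                   subst1 (eta τ (var x) sp) x u ≡ u ◇ substSp sp x u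
  subst1-eta-var (` b) x sp u rewrite eqv-same x = refl
  subst1-eta-var (σ ⇒ τ) x sp u = begin
    lam (subst1 (eta τ (var (vs x)) sp⁺) (vs x) (wk u))
      ≡⟨ cong lam (subst1-eta-var τ (vs x) sp⁺ (wk u)) ⟩
    lam (wk u ◇ substSp sp⁺ (vs x) (wk u))
      ≡⟨ cong (λ r → lam (wk u ◇ r)) (trans (substSp-snoc (renSp vs sp) (nvar vz) (vs x) (wk u))
           (cong₂ snoc (substSp-renvs sp u) (subst1-eta σ (vs x) (var vz) ε (wk u)))) ⟩
    lam (wk u ◇ snoc (renSp vs (substSp sp x u)) (nvar vz))
      ≡⟨ cong lam (trans (◇-snoc (wk u) (renSp vs (substSp sp x u)) (nvar vz)) (cong (_·₁ nvar vz) (sym (ren-◇ vs u (substSp sp x u))))) ⟩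
    lam (wk (u ◇ substSp sp x u) ·₁ nvar vz)
      ≡⟨ eta-expand (neutral-app σ) _ ⟩
    u ◇ substSp sp x u ∎
    where
      open ≡-Reasoning
      sp⁺ = snoc (renSp vs sp) (nvar vz)

nvar-◇ : ∀ {b} (x : Var Γ τ) (sp : Sp Γ τ (` b)) → nvar x ◇ sp ≡ ne (var x) sp
nvar-◇ x sp = neutral-app _ (var x) ε sp

-- The premises of `∀R`, `∃L` and of the induction step have the shape on the left.
η-lam : (t : Nf (σ ∷ Γ) τ) → wk (lam t) ·₁ nvar vz ≡ t
η-lam {σ = σ} t = lam-inj (eta-expand (neutral-app σ) (lam t))
  where
    lam-inj : {t t' : Nf (σ ∷ Γ) τ} → lam t ≡ lam t' → t ≡ t'
    lam-inj refl = refl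

-- Parallel substitution

liftS-cong : {θ θ' : Sub Γ Δ} → θ ≐ θ' → liftS {σ = σ} θ ≐ liftS θ'
liftS-cong e vz = refl
liftS-cong e (vs x) = cong wk (e x)

mutual
  sub-cong : {θ θ' : Sub Γ Δ} → θ ≐ θ' → (t : Nf Δ τ) → sub θ t ≡ sub θ' t
  sub-cong e (lam t) = cong lam (sub-cong (liftS-cong e) t)
  sub-cong e (ne (var x) sp) = cong₂ _◇_ (e x) (subSp-cong e sp)
  sub-cong e (ne (con c) sp) = cong (ne (con c)) (subSp-cong e sp)

  subSp-cong : {θ θ' : Sub Γ Δ} → θ ≐ θ' → (sp : Sp Δ τ υ) → subSp θ sp ≡ subSp θ' sp
  subSp-cong e ε = refl
  subSp-cong e (t ∷ₛ sp) = cong₂ _∷ₛ_ (sub-cong e t) (subSp-cong e sp)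

single : (x : Var Γ σ) → Nf (Γ - x) σ → Sub (Γ - x) Γ
single {Γ = Γ} {σ = σ} x u y = pick (eqv x y)
  where
    pick : ∀ {τ} {y : Var Γ τ} → EqV x y → Nf (Γ - x) τ
    pick same = u
    pick (diff y') = nvar y'

single-lift : (x : Var Γ σ) (u : Nf (Γ - x) σ) → single (vs {σ = τ} x) (wk u) ≐ liftS (single x u)
single-lift x u vz = refl
single-lift x u (vs y) with eqv x y
... | same = refl
... | diff y' = sym (ren-nvar vs y')

mutual
  -- Brings β-contraction, which is defined by `subst1`, under the laws of parallel substitution.
  subst1-sub : (x : Var Γ σ) (u : Nf (Γ - x) σ) (t : Nf Γ τ) → subst1 t x u ≡ sub (single x u) t
  subst1-sub x u (lam t) = cong lam (trans (subst1-sub (vs x) (wk u) t) (sub-cong (single-lift x u) t))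
  subst1-sub x u (ne (con c) sp) = cong (ne (con c)) (substSp-sub x u sp)
  subst1-sub x u (ne (var y) sp) with eqv x y
  ... | same = cong (u ◇_) (substSp-sub x u sp)
  ... | diff y' = trans (cong (ne (var y')) (substSp-sub x u sp)) (sym (nvar-◇ y' _))

  substSp-sub : (x : Var Γ σ) (u : Nf (Γ - x) σ) (sp : Sp Γ τ υ) → substSp sp x u ≡ subSp (single x u) sp
  substSp-sub x u ε = refl
  substSp-sub x u (t ∷ₛ sp) = cong₂ _∷ₛ_ (subst1-sub x u t) (substSp-sub x u sp)

mutual
  sub-ren : (θ : Sub Γ Δ) (ρ : Ren Θ Δ) (t : Nf Θ τ) → sub θ (renNf ρ t) ≡ sub (λ x → θ (ρ x)) t
  sub-ren θ ρ (lam t) = cong lam (trans (sub-ren (liftS θ) (liftR ρ) t)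
    (sub-cong (λ { vz → refl ; (vs x) → refl }) t))
  sub-ren θ ρ (ne (var x) sp) = cong (θ (ρ x) ◇_) (subSp-ren θ ρ sp)
  sub-ren θ ρ (ne (con c) sp) = cong (ne (con c)) (subSp-ren θ ρ sp)

  subSp-ren : (θ : Sub Γ Δ) (ρ : Ren Θ Δ) (sp : Sp Θ τ υ) → subSp θ (renSp ρ sp) ≡ subSp (λ x → θ (ρ x)) sp
  subSp-ren θ ρ ε = refl
  subSp-ren θ ρ (t ∷ₛ sp) = cong₂ _∷ₛ_ (sub-ren θ ρ t) (subSp-ren θ ρ sp)

mutual
  ren-sub : (ρ : Ren Γ Θ) (θ : Sub Γ Δ) (t : Nf Δ τ) → renNf ρ (sub θ t) ≡ sub (λ x → renNf ρ (θ x)) t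
  ren-sub ρ θ (lam t) = cong lam (trans (ren-sub (liftR ρ) (liftS θ) t)
    (sub-cong (λ { vz → ren-nvar (liftR ρ) vz ; (vs x) → ren-wk ρ (θ x) }) t))
  ren-sub ρ θ (ne (var x) sp) = trans (ren-◇ ρ (θ x) (subSp θ sp)) (cong (renNf ρ (θ x) ◇_) (renSp-sub ρ θ sp))
  ren-sub ρ θ (ne (con c) sp) = cong (ne (con c)) (renSp-sub ρ θ sp)

  renSp-sub : (ρ : Ren Γ Θ) (θ : Sub Γ Δ) (sp : Sp Δ τ υ) → renSp ρ (subSp θ sp) ≡ subSp (λ x → renNf ρ (θ x)) sp
  renSp-sub ρ θ ε = refl
  renSp-sub ρ θ (t ∷ₛ sp) = cong₂ _∷ₛ_ (ren-sub ρ θ t) (renSp-sub ρ θ sp)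

sub-wk : (θ : Sub Γ Δ) (t : Nf Δ τ) → sub (liftS {σ = σ} θ) (wk t) ≡ wk (sub θ t)
sub-wk θ t = trans (sub-ren (liftS θ) vs t) (sym (ren-sub vs θ t))

subSp-wk : (θ : Sub Γ Δ) (sp : Sp Δ τ υ) → subSp (liftS {σ = σ} θ) (renSp vs sp) ≡ renSp vs (subSp θ sp)
subSp-wk θ sp = trans (subSp-ren (liftS θ) vs sp) (sym (renSp-sub vs θ sp))

subSp-snoc : (θ : Sub Γ Δ) (sp : Sp Δ υ (σ ⇒ τ)) (u : Nf Δ σ) → subSp θ (snoc sp u) ≡ snoc (subSp θ sp) (sub θ u)
subSp-snoc θ ε u = refl
subSp-snoc θ (t ∷ₛ sp) u = cong (_ ∷ₛ_) (subSp-snoc θ sp u)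

sub-eta : (τ : Ty) (θ : Sub Γ Δ) (x : Var Δ σ) (sp : Sp Δ σ τ) → sub θ (eta τ (var x) sp) ≡ θ x ◇ subSp θ sp
sub-eta (` b) θ x sp = refl
sub-eta (σ ⇒ τ) θ x sp = begin
  lam (sub (liftS θ) (eta τ (var (vs x)) sp⁺))
    ≡⟨ cong lam (sub-eta τ (liftS θ) (vs x) sp⁺) ⟩
  lam (wk (θ x) ◇ subSp (liftS θ) sp⁺)
    ≡⟨ cong (λ r → lam (wk (θ x) ◇ r)) (trans (subSp-snoc (liftS θ) (renSp vs sp) (nvar vz))
         (cong₂ snoc (subSp-wk θ sp) (sub-eta σ (liftS θ) vz ε))) ⟩
  lam (wk (θ x) ◇ snoc (renSp vs (subSp θ sp)) (nvar vz))
    ≡⟨ cong lam (trans (◇-snoc (wk (θ x)) (renSp vs (subSp θ sp)) (nvar vz)) (cong (_·₁ nvar vz) (sym (ren-◇ vs (θ x) (subSp θ sp))))) ⟩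
  lam (wk (θ x ◇ subSp θ sp) ·₁ nvar vz)
    ≡⟨ eta-expand (neutral-app σ) _ ⟩
  θ x ◇ subSp θ sp ∎
  where
    open ≡-Reasoning
    sp⁺ = snoc (renSp vs sp) (nvar vz)

sub-nvar : (θ : Sub Γ Δ) (x : Var Δ τ) → sub θ (nvar x) ≡ θ x
sub-nvar θ x = sub-eta _ θ x ε

mutual
  ren-as-sub : (ρ : Ren Δ Γ) (t : Nf Δ τ) → renNf ρ t ≡ sub (λ x → nvar (ρ x)) t
  ren-as-sub ρ (lam t) = cong lam (trans (ren-as-sub (liftR ρ) t)
    (sub-cong (λ { vz → refl ; (vs x) → sym (ren-nvar vs (ρ x)) }) t))
  ren-as-sub ρ (ne (var x) sp) = trans (cong (ne (var (ρ x))) (renSp-as-sub ρ sp)) (sym (nvar-◇ (ρ x) _))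
  ren-as-sub ρ (ne (con c) sp) = cong (ne (con c)) (renSp-as-sub ρ sp)

  renSp-as-sub : (ρ : Ren Δ Γ) (sp : Sp Δ τ υ) → renSp ρ sp ≡ subSp (λ x → nvar (ρ x)) sp
  renSp-as-sub ρ ε = refl
  renSp-as-sub ρ (t ∷ₛ sp) = cong₂ _∷ₛ_ (ren-as-sub ρ t) (renSp-as-sub ρ sp)

sub-id : (t : Nf Γ τ) → sub nvar t ≡ t
sub-id t = trans (sym (ren-as-sub (λ x → x) t)) (ren-id t (λ x → refl))

-- Composition of substitutions

-- `T` bounds the types at which `θ` can create redexes; at all others it only renames. These types
-- measure the termination of composition.
Moves : (Ty → Set) → Sub Γ Δ → Set
Moves {Γ} {Δ} T θ = ∀ {τ} (x : Var Δ τ) → (Σ[ y ∈ Var Γ τ ] θ x ≡ nvar y) ⊎ T τ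

Moves-lift : {T : Ty → Set} {θ : Sub Γ Δ} → Moves T θ → Moves T (liftS {σ = σ} θ)
Moves-lift m vz = inj₁ (vz , refl)
Moves-lift m (vs x) with m x
... | inj₁ (y , e) = inj₁ (vs y , trans (cong wk e) (ren-nvar vs y))
... | inj₂ p = inj₂ p

Moves-single : {T : Ty → Set} → T σ → (u : Nf Γ σ) → Moves T (single vz u)
Moves-single p u vz = inj₂ p
Moves-single p u (vs x) = inj₁ (x , refl)

SubApp : (Ty → Set) → Ty → Set
SubApp T τ = ∀ {Γ Δ υ} (η : Sub Γ Δ) → Moves T η → (t : Nf Δ τ) (sp : Sp Δ τ υ) → sub η (t ◇ sp) ≡ sub η t ◇ subSp η sp

⊙-lift : (ρ : Sub Δ Θ) (η : Sub Γ Δ) → (liftS {σ = σ} ρ ⊙ liftS η) ≐ liftS (ρ ⊙ η)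
⊙-lift ρ η vz = sub-nvar (liftS η) vz
⊙-lift ρ η (vs x) = sub-wk η (ρ x)

-- Applying `ρ` creates redexes only at types in `U`, so only there does `η` have to commute with
-- application.
module _ {T U : Ty → Set} (P : ∀ {τ} → U τ → SubApp T τ) where
  mutual
    compose : (ρ : Sub Δ Θ) (η : Sub Γ Δ) → Moves U ρ → Moves T η → (t : Nf Θ τ) → sub η (sub ρ t) ≡ sub (ρ ⊙ η) t
    compose ρ η mρ mη (lam t) = cong lam (trans (compose (liftS ρ) (liftS η) (Moves-lift {θ = ρ} mρ) (Moves-lift {θ = η} mη) t)
      (sub-cong (⊙-lift ρ η) t))
    compose ρ η mρ mη (ne (con c) sp) = cong (ne (con c)) (composeSp ρ η mρ mη sp)
    compose ρ η mρ mη (ne {b = b} (var x) sp) with mρ x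
    ... | inj₁ (y , e) = trans (cong (sub η) (trans (cong (_◇ subSp ρ sp) e) (nvar-◇ y (subSp ρ sp))))
            (cong₂ _◇_ (trans (sym (sub-nvar η y)) (cong (sub η) (sym e))) (composeSp ρ η mρ mη sp))
    ... | inj₂ p = trans (P p η mη (ρ x) (subSp ρ sp)) (cong (sub η (ρ x) ◇_) (composeSp ρ η mρ mη sp))

    composeSp : (ρ : Sub Δ Θ) (η : Sub Γ Δ) → Moves U ρ → Moves T η → (sp : Sp Θ τ υ) →
                subSp η (subSp ρ sp) ≡ subSp (ρ ⊙ η) sp
    composeSp ρ η mρ mη ε = refl
    composeSp ρ η mρ mη (t ∷ₛ sp) = cong₂ _∷ₛ_ (compose ρ η mρ mη t) (composeSp ρ η mρ mη sp)

sub-single-wk : (t : Nf Γ τ) (u : Nf Γ σ) → sub (single vz u) (wk t) ≡ t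
sub-single-wk t u = trans (sub-ren (single vz u) vs t) (sub-id t)

single-⊙ : (η : Sub Γ Δ) (u : Nf Δ σ) → (single vz u ⊙ η) ≐ (liftS η ⊙ single vz (sub η u))
single-⊙ η u vz = sym (sub-nvar (single vz (sub η u)) vz)
single-⊙ η u (vs x) = trans (sub-nvar η x) (sym (sub-single-wk (η x) (sub η u)))

-- Contracting a redex substitutes at `σ` only. Moving `η` across it composes twice: the contraction
-- followed by `η`, justified by `Pσ`, and the lifted `η` followed by the new contraction, where the
-- roles are exchanged and `Q` is needed.
SubApp-⇒ : {T S : Ty → Set} → S σ → SubApp T σ → (∀ {υ} → T υ → SubApp S υ) → SubApp T τ → SubApp T (σ ⇒ τ)
SubApp-⇒ p Pσ Q Pτ η m t ε = refl
SubApp-⇒ {σ = σ} {T = T} p Pσ Q Pτ η m (lam t) (u ∷ₛ sp) = begin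
  sub η (subst1 t vz u ◇ sp)
    ≡⟨ Pτ η m (subst1 t vz u) sp ⟩
  sub η (subst1 t vz u) ◇ subSp η sp
    ≡⟨ cong (_◇ subSp η sp) (begin
        sub η (subst1 t vz u)
          ≡⟨ cong (sub η) (subst1-sub vz u t) ⟩
        sub η (sub (single vz u) t)
          ≡⟨ compose {T = T} {U = _≡ σ} (λ { refl → Pσ }) (single vz u) η (Moves-single {T = _≡ σ} refl u) m t ⟩
        sub (single vz u ⊙ η) t
          ≡⟨ sub-cong (single-⊙ η u) t ⟩
        sub (liftS η ⊙ single vz (sub η u)) t
          ≡⟨ compose Q (liftS η) (single vz (sub η u)) (Moves-lift {θ = η} m) (Moves-single p (sub η u)) t ⟨
        sub (single vz (sub η u)) (sub (liftS η) t)
          ≡⟨ subst1-sub vz (sub η u) (sub (liftS η) t) ⟨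
        subst1 (sub (liftS η) t) vz (sub η u) ∎) ⟩
  (subst1 (sub (liftS η) t) vz (sub η u)) ◇ subSp η sp ∎
  where open ≡-Reasoning

size : Ty → ℕ
size (` b) = 0
size (σ ⇒ τ) = suc (size σ + size τ)

SubApp-base : {T : Ty → Set} {b : Base} → SubApp T (` b)
SubApp-base η m t ε = refl

-- Commuting a substitution at types of size ≤ n past an application at a type of size ≤ m
-- needs the same fact for (n , m') and (m' , n) with m' < m, so the sum n + m decreases.
SubApp-size : (k n : ℕ) (τ : Ty) → n + size τ ≤ k → SubApp (λ υ → size υ ≤ n) τ
SubApp-size k n (` b) q = SubApp-base
SubApp-size zero n (σ ⇒ τ) q with () ← subst (_≤ 0) (+-suc n (size σ + size τ)) q
SubApp-size (suc k) n (σ ⇒ τ) q = SubApp-⇒ {S = λ υ → size υ ≤ size σ} ≤-refl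
    (SubApp-size k n σ qσ)
    (λ {υ} p → SubApp-size k (size σ) υ (≤-trans (+-monoʳ-≤ (size σ) p) (subst (_≤ k) (+-comm n (size σ)) qσ)))
    (SubApp-size k n τ (≤-trans (+-monoʳ-≤ n (m≤n+m (size τ) (size σ))) q'))
  where
    q' : n + (size σ + size τ) ≤ k
    q' = ≤-pred (subst (_≤ suc k) (+-suc n (size σ + size τ)) q)

    qσ : n + size σ ≤ k
    qσ = ≤-trans (+-monoʳ-≤ n (m≤m+n (size σ) (size τ))) q'

-- No bound on `η` is required: with the roles exchanged, the second substitution moves only `σ`,
-- and `SubApp-size` covers that case.
SubApp-any : (τ : Ty) → SubApp (λ _ → ⊤) τ
SubApp-any (` b) = SubApp-base
SubApp-any (σ ⇒ τ) = SubApp-⇒ {S = λ υ → size υ ≤ size σ} ≤-refl (SubApp-any σ)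
  (λ {υ} _ → SubApp-size _ (size σ) υ ≤-refl) (SubApp-any τ)

sub-◇ : (η : Sub Γ Δ) (t : Nf Δ τ) (sp : Sp Δ τ υ) → sub η (t ◇ sp) ≡ sub η t ◇ subSp η sp
sub-◇ η = SubApp-any _ η (λ _ → inj₂ tt)

sub-∘ : (ρ : Sub Δ Θ) (η : Sub Γ Δ) (t : Nf Θ τ) → sub η (sub ρ t) ≡ sub (ρ ⊙ η) t
sub-∘ ρ η = compose {T = λ _ → ⊤} {U = λ _ → ⊤} (λ _ → SubApp-any _) ρ η (λ _ → inj₂ tt) (λ _ → inj₂ tt)

-- Structural rules

exch₂ : ∀ {Γ : List (Fm Ψ)} {A B C} → Ψ ⨾ A ∷ B ∷ Γ ⟶ C → Ψ ⨾ B ∷ A ∷ Γ ⟶ C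
exch₂ = exch (swap _ _ ↭-refl)

weaken : ∀ {Γ : List (Fm Ψ)} {C} (D : Fm Ψ) → Ψ ⨾ Γ ⟶ C → Ψ ⨾ D ∷ Γ ⟶ C
weaken D (exch p d) = exch (prep D p) (weaken D d)
weaken D ⊥L = exch₂ ⊥L
weaken D ⊤R = ⊤R
weaken D (∧L₁ d) = exch₂ (∧L₁ (exch₂ (weaken D d)))
weaken D (∧L₂ d) = exch₂ (∧L₂ (exch₂ (weaken D d)))
weaken D (∧R d e) = ∧R (weaken D d) (weaken D e)
weaken D (∨L d e) = exch₂ (∨L (exch₂ (weaken D d)) (exch₂ (weaken D e)))
weaken D (∨R₁ d) = ∨R₁ (weaken D d)
weaken D (∨R₂ d) = ∨R₂ (weaken D d)
weaken D (⊃L d e) = exch₂ (⊃L (weaken D d) e)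
weaken D (⊃R d) = ⊃R (exch₂ (weaken D d))
weaken D (∀L t d) = exch₂ (∀L t (exch₂ (weaken D d)))
weaken D (∀R d) = ∀R (weaken (wk D) d)
weaken D (∃L d) = exch₂ (∃L (exch₂ (weaken (wk D) d)))
weaken D (∃R t d) = ∃R t (weaken D d)
weaken D (init a) = exch₂ (init a)
weaken D (cL d) = exch₂ (cL (exch (prep _ (swap _ _ ↭-refl)) (exch₂ (weaken D d))))
weaken D (cut d e) = cut (weaken D d) e
weaken D natz = natz
weaken D (nats d) = nats (weaken D d)
weaken D (natL B d e f) = exch₂ (natL B d e (exch₂ (weaken D f)))
weaken D (defR cl m θ q d) = defR cl m θ q (weaken D d)
weaken D (defL a f) = exch₂ (defL a λ cl m → proj₁ (f cl m) , proj₁ (proj₂ (f cl m)) ,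
  λ Ψ' ρ σ u → exch₂ (weaken (sub ρ D) (proj₂ (proj₂ (f cl m)) Ψ' ρ σ u)))

conv : ∀ {Γ Γ' : List (Fm Ψ)} {C C'} → Γ ≡ Γ' → C ≡ C' → Ψ ⨾ Γ ⟶ C → Ψ ⨾ Γ' ⟶ C'
conv refl refl d = d

Unifiers : (A : Fm Ψ) (cl : Clause) → UnifSet Ψ cl
Unifiers A cl Ψ' ρ σ = OFreeCtx Ψ' × Unifier A cl Ψ' ρ σ

Unifiers-CSU : (A : Fm Ψ) (cl : Clause) → CSU A cl (Unifiers A cl)
Unifiers-CSU A cl = record
  { sound = λ Ψ' ρ σ u → u
  ; complete = λ Ψ' p ρ σ u → Ψ' , ρ , σ , (p , u) , nvar , (λ x → sym (sub-id (ρ x))) , (λ x → sym (sub-id (σ x)))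
  }

map-sub-wk : (θ : Sub Ψ' Ψ) (Γ : List (Fm Ψ)) → map (sub (liftS {σ = τ} θ)) (map wk Γ) ≡ map wk (map (sub θ) Γ)
map-sub-wk θ [] = refl
map-sub-wk θ (A ∷ Γ) = cong₂ _∷_ (sub-wk θ A) (map-sub-wk θ Γ)

sub-·₁ : (θ : Sub Γ Δ) (t : Nf Δ (σ ⇒ τ)) (u : Nf Δ σ) → sub θ (t ·₁ u) ≡ sub θ t ·₁ sub θ u
sub-·₁ θ t u = sub-◇ θ t (u ∷ₛ ε)

sub-wk·₁ : (θ : Sub Γ Δ) (t : Nf Δ (σ ⇒ τ)) (u : Nf (σ ∷ Δ) σ) →
           sub (liftS θ) (wk t ·₁ u) ≡ wk (sub θ t) ·₁ sub (liftS θ) u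
sub-wk·₁ θ t u = trans (sub-·₁ (liftS θ) (wk t) u) (cong (_·₁ sub (liftS θ) u) (sub-wk θ t))

sub-wk·₁-nvar : (θ : Sub Γ Δ) (t : Nf Δ (σ ⇒ τ)) → sub (liftS θ) (wk t ·₁ nvar vz) ≡ wk (sub θ t) ·₁ nvar vz
sub-wk·₁-nvar θ t = trans (sub-wk·₁ θ t (nvar vz)) (cong (wk (sub θ t) ·₁_) (sub-nvar (liftS θ) vz))

Atomic-sub : (θ : Sub Ψ' Ψ) {A : Fm Ψ} → Atomic A → Atomic (sub θ A)
Atomic-sub θ (atomic p sp) = atomic p (subSp θ sp)

DefAtom-sub : (θ : Sub Ψ' Ψ) {A : Fm Ψ} → DefAtom A → DefAtom (sub θ A)
DefAtom-sub θ (defatom p d sp) = defatom p d (subSp θ sp)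

-- For defL: a unifier of A θ and a clause head composes with θ to a unifier of A, which
-- factors through the given complete set.
substitute : ∀ {Γ : List (Fm Ψ)} {C} → OFreeCtx Ψ' → (θ : Sub Ψ' Ψ) → Ψ ⨾ Γ ⟶ C → Ψ' ⨾ map (sub θ) Γ ⟶ sub θ C
substitute p θ (exch q d) = exch (map⁺ (sub θ) q) (substitute p θ d)
substitute p θ ⊥L = ⊥L
substitute p θ ⊤R = ⊤R
substitute p θ (∧L₁ d) = ∧L₁ (substitute p θ d)
substitute p θ (∧L₂ d) = ∧L₂ (substitute p θ d)
substitute p θ (∧R d e) = ∧R (substitute p θ d) (substitute p θ e)
substitute p θ (∨L d e) = ∨L (substitute p θ d) (substitute p θ e)
substitute p θ (∨R₁ d) = ∨R₁ (substitute p θ d)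
substitute p θ (∨R₂ d) = ∨R₂ (substitute p θ d)
substitute p θ (⊃L {Δ₁ = Δ₁} {Δ₂} d e) =
  conv (cong (_ ∷_) (sym (map-++ (sub θ) Δ₁ Δ₂))) refl (⊃L (substitute p θ d) (substitute p θ e))
substitute p θ (⊃R d) = ⊃R (substitute p θ d)
substitute p θ (∀L {B = B} t d) = ∀L (sub θ t) (conv (cong (_∷ _) (sub-·₁ θ B t)) refl (substitute p θ d))
substitute p θ (∀R {Γ = Γ} {p = q} {B = B} d) =
  ∀R (conv (map-sub-wk θ Γ) (sub-wk·₁-nvar θ B)
    (substitute (q ∷ p) (liftS θ) d))
substitute p θ (∃L {Γ = Γ} {p = q} {B = B} {C} d) =
  ∃L (conv (cong₂ _∷_ (sub-wk·₁-nvar θ B) (map-sub-wk θ Γ)) (sub-wk θ C)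
    (substitute (q ∷ p) (liftS θ) d))
substitute p θ (∃R {B = B} t d) = ∃R (sub θ t) (conv refl (sub-·₁ θ B t) (substitute p θ d))
substitute p θ (init a) = init (Atomic-sub θ a)
substitute p θ (cL d) = cL (substitute p θ d)
substitute p θ (cut {Δ₁ = Δ₁} {Δ₂} d e) =
  conv (sym (map-++ (sub θ) Δ₁ Δ₂)) refl (cut (substitute p θ d) (substitute p θ e))
substitute p θ natz = natz
substitute p θ (nats d) = nats (substitute p θ d)
substitute p θ (natL {I = I} B d e f) = natL (sub θ B)
  (conv refl (sub-·₁ θ B zN) (substitute p θ d))
  (conv (cong (_∷ []) (sub-wk·₁-nvar θ B))
    (sub-wk·₁ θ B (sN (nvar vz))) (substitute (ofnt ∷ p) (liftS θ) e))
  (conv (cong (_∷ _) (sub-·₁ θ B I)) refl (substitute p θ f))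
substitute p θ (defR cl m η refl d) = defR cl m (η ⊙ θ) (sub-∘ η θ (head cl)) (conv refl (sub-∘ η θ (body cl)) (substitute p θ d))
substitute {Γ = A ∷ Γ} {C} p θ (defL a f) = defL (DefAtom-sub θ a) λ cl m → Unifiers (sub θ A) cl , Unifiers-CSU (sub θ A) cl ,
  λ Ψ' ρ σ (q , u) →
    let (Ψ₁ , ρ₁ , σ₁ , v , η , eρ , eσ) = CSU.complete (proj₁ (proj₂ (f cl m))) Ψ' q (θ ⊙ ρ) σ (trans (sym (sub-∘ θ ρ A)) u)
        factor : (D : Fm _) → sub η (sub ρ₁ D) ≡ sub ρ (sub θ D)
        factor D = trans (sub-∘ ρ₁ η D) (trans (sub-cong (λ x → sym (eρ x)) D) (sym (sub-∘ θ ρ D)))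
    in conv (cong₂ _∷_ (trans (sub-∘ σ₁ η (body cl)) (sub-cong (λ x → sym (eσ x)) (body cl)))
                       (trans (sym (map-∘ Γ)) (trans (map-cong factor Γ) (map-∘ Γ))))
            (factor C) (substitute q η (proj₂ (proj₂ (f cl m)) Ψ₁ ρ₁ σ₁ v))

-- The type of an eigenvariable does not contain `o`, so an eigenvariable heads no formula.
OFree-target : {A : Set₁} → OFree υ → Sp Ψ υ (` o) → A
OFree-target (ofb ()) ε
OFree-target (of⇒ a b) (t ∷ₛ sp) = OFree-target b sp

OFree-lookup : OFreeCtx Ψ → Var Ψ υ → OFree υ
OFree-lookup (q ∷ p) vz = q
OFree-lookup (q ∷ p) (vs x) = OFree-lookup p x

-- Needed because `init` is atomic. The quantifier cases recurse on the body itself, which by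
-- `η-lam` is its own instance at the fresh variable.
identity : ∀ {Γ : List (Fm Ψ)} → OFreeCtx Ψ → (A : Fm Ψ) → Ψ ⨾ A ∷ Γ ⟶ A
identity p (ne (var x) sp) = OFree-target (OFree-lookup p x) sp
identity p (ne (con (nl c)) sp) = init (atomic c sp)
identity p (ne (con (lg ⊥c)) ε) = ⊥L
identity p (ne (con (lg ⊤c)) ε) = ⊤R
identity p (ne (con (lg ∧c)) (A ∷ₛ B ∷ₛ ε)) = ∧R (∧L₁ (identity p A)) (∧L₂ (identity p B))
identity p (ne (con (lg ∨c)) (A ∷ₛ B ∷ₛ ε)) = ∨L (∨R₁ (identity p A)) (∨R₂ (identity p B))
identity {Γ = Γ} p (ne (con (lg ⊃c)) (A ∷ₛ B ∷ₛ ε)) =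
  ⊃R (exch₂ (⊃L {Δ₁ = A ∷ []} {Γ} (identity p A) (identity p B)))
identity p (ne (con (lg (∀c τ q))) (lam B ∷ₛ ε)) =
  ∀R (∀L (nvar vz) (conv (cong (_∷ _) (sym (η-lam B))) (sym (η-lam B)) (identity (q ∷ p) B)))
identity p (ne (con (lg (∃c τ q))) (lam B ∷ₛ ε)) =
  ∃L (∃R (nvar vz) (conv (cong (_∷ _) (sym (η-lam B))) (sym (η-lam B)) (identity (q ∷ p) B)))

contract : ∀ (Γ : List (Fm Ψ)) {Γ' C} → Ψ ⨾ Γ ++ Γ ++ Γ' ⟶ C → Ψ ⨾ Γ ++ Γ' ⟶ C
contract [] d = d
contract (B ∷ Γ) {Γ'} d = cL (exch (↭-trans (shift B Γ (B ∷ Γ')) (prep B (shift B Γ Γ'))) (contract Γ (exch shuffle d)))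
  where
    shuffle : B ∷ Γ ++ B ∷ Γ ++ Γ' ↭ Γ ++ Γ ++ B ∷ B ∷ Γ'
    shuffle = ↭-trans (↭-sym (shift B Γ (B ∷ Γ ++ Γ')))
      (++⁺ˡ Γ (↭-sym (↭-trans (shift B Γ (B ∷ Γ')) (prep B (shift B Γ Γ')))))

-- The rule `cut` splits the hypotheses; contracting the duplicate makes it additive.
cut′ : ∀ {Γ : List (Fm Ψ)} {A C} → Ψ ⨾ Γ ⟶ A → Ψ ⨾ A ∷ Γ ⟶ C → Ψ ⨾ Γ ⟶ C
cut′ {Γ = Γ} d e = conv (++-identityʳ Γ) refl
  (contract Γ (conv (cong (Γ ++_) (sym (++-identityʳ Γ))) refl (cut d e)))

-- Worlds

record World : Set where
  constructor world
  field
    cx    : Ctx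
    ofree : OFreeCtx cx
    hyps  : List (Fm cx)
open World public

infix 3 _⊩_
_⊩_ : (w : World) → Fm (cx w) → Set₁
w ⊩ C = cx w ⨾ hyps w ⟶ C

private variable
  w w' w'' : World

infix 3 _⊑_
-- Only the effect on derivations is recorded, not how the hypotheses are related, so extensions
-- compose without any bookkeeping of lists.
record _⊑_ (w w' : World) : Set₁ where
  field
    inst      : Sub (cx w') (cx w)
    transport : ∀ {C} → w ⊩ C → w' ⊩ sub inst C
open _⊑_ public

⊑-refl : w ⊑ w
inst ⊑-refl = nvar
transport ⊑-refl {C} d = conv refl (sym (sub-id C)) d

⊑-trans : w ⊑ w' → w' ⊑ w'' → w ⊑ w''
inst (⊑-trans r r') = inst r ⊙ inst r'
transport (⊑-trans r r') {C} d = conv refl (sub-∘ (inst r) (inst r') C) (transport r' (transport r d))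

infixl 5 _▹_ _▹ᵛ_
_▹_ : (w : World) → Fm (cx w) → World
world Ψ p Γ ▹ A = world Ψ p (A ∷ Γ)

_▹ᵛ_ : (w : World) {τ : Ty} → OFree τ → World
world Ψ p Γ ▹ᵛ q = world (_ ∷ Ψ) (q ∷ p) (map wk Γ)

⊑-hyp : {A : Fm (cx w)} → w ⊑ w ▹ A
inst ⊑-hyp = nvar
transport ⊑-hyp {C} d = conv refl (sym (sub-id C)) (weaken _ d)

⊑-var : {q : OFree τ} → w ⊑ w ▹ᵛ q
inst ⊑-var x = nvar (vs x)
transport (⊑-var {w = w} {q = q}) {C} d =
  conv (map-cong (λ A → sym (ren-as-sub vs A)) (hyps w)) refl (substitute (q ∷ ofree w) (λ x → nvar (vs x)) d)

hyp : {A : Fm (cx w)} → w ▹ A ⊩ A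
hyp {w = w} {A} = identity (ofree w) A

infixr 5 _▸_
_▸_ : Nf Ψ τ → Sub Ψ Δ → Sub Ψ (τ ∷ Δ)
(t ▸ θ) vz = t
(t ▸ θ) (vs x) = θ x

∅ : Sub Ψ []
∅ ()

lam-·₁ : (t : Nf (σ ∷ Γ) τ) (u : Nf Γ σ) → lam t ·₁ u ≡ sub (u ▸ nvar) t
lam-·₁ t u = trans (subst1-sub vz u t) (sub-cong (λ { vz → refl ; (vs x) → refl }) t)

wk-lam-·₁ : (t : Nf (σ ∷ Γ) τ) (u : Nf (υ ∷ Γ) σ) → wk (lam t) ·₁ u ≡ sub (u ▸ (λ x → nvar (vs x))) t
wk-lam-·₁ t u = trans (lam-·₁ (renNf (liftR vs) t) u)
  (trans (sub-ren (u ▸ nvar) (liftR vs) t) (sub-cong (λ { vz → refl ; (vs x) → refl }) t))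

sub-▸-nvar : (u : Nf Γ σ) (θ : Sub Γ Δ) (t : Nf (σ ∷ Δ) τ) → sub (u ▸ nvar) (sub (liftS θ) t) ≡ sub (u ▸ θ) t
sub-▸-nvar u θ t = trans (sub-∘ (liftS θ) (u ▸ nvar) t)
  (sub-cong (λ { vz → sub-nvar (u ▸ nvar) vz ; (vs x) → trans (sub-ren (u ▸ nvar) vs (θ x)) (sub-id (θ x)) }) t)

sub-▸-wk : (u : Nf Γ σ) (θ : Sub Γ Δ) (t : Nf Δ τ) → sub (u ▸ θ) (wk t) ≡ sub θ t
sub-▸-wk u θ t = sub-ren (u ▸ θ) vs t

-- Natural deduction

∧E₁ : {A B : Fm (cx w)} → w ⊩ A ∧F B → w ⊩ A
∧E₁ {w} {A} d = cut′ d (∧L₁ (identity (ofree w) A))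

∧E₂ : {A B : Fm (cx w)} → w ⊩ A ∧F B → w ⊩ B
∧E₂ {w} {B = B} d = cut′ d (∧L₂ (identity (ofree w) B))

⊃E : {A B : Fm (cx w)} → w ⊩ A ⊃F B → w ⊩ A → w ⊩ B
⊃E {w} {B = B} d e = cut′ d (conv (cong (_ ∷_) (++-identityʳ (hyps w))) refl (⊃L e (identity (ofree w) B)))

∀E : {p : OFree τ} {B : Fm (τ ∷ cx w)} → w ⊩ ∀F τ p (lam B) → (t : Nf (cx w) τ) → w ⊩ sub (t ▸ nvar) B
∀E {w = w} {B = B} d t = cut′ d (∀L t (conv refl (lam-·₁ B t) (identity (ofree w) (lam B ·₁ t))))

∃I : {p : OFree τ} {B : Fm (τ ∷ cx w)} (t : Nf (cx w) τ) → w ⊩ sub (t ▸ nvar) B → w ⊩ ∃F τ p (lam B)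
∃I {B = B} t d = ∃R t (conv refl (sym (lam-·₁ B t)) d)

∃E : {p : OFree τ} {B : Fm (τ ∷ cx w)} {C : Fm (cx w)} → w ⊩ ∃F τ p (lam B) →
     (∀ {w'} (r : w ⊑ w') (t : Nf (cx w') τ) → w' ⊩ sub (t ▸ inst r) B → w' ⊩ sub (inst r) C) → w ⊩ C
∃E {w = w} {p = p} {B} {C} d k = cut′ d (∃L (conv refl (sym (ren-as-sub vs C))
  (k {w ▹ᵛ p ▹ (wk (lam B) ·₁ nvar vz)} r (nvar vz) (conv refl e (hyp {w = w ▹ᵛ p})))))
  where
    r : w ⊑ w ▹ᵛ p ▹ (wk (lam B) ·₁ nvar vz)
    inst r x = nvar (vs x)
    transport r d = weaken _ (transport (⊑-var {w = w} {q = p}) d)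

    e : wk (lam B) ·₁ nvar vz ≡ sub (nvar vz ▸ inst r) B
    e = wk-lam-·₁ B (nvar vz)

-- Each premise of `defL` is a world extending `w` along `ρ`. The unifier's equation goes to the
-- continuation, which may solve it or refute it.
defE : {A C : Fm (cx w)} → DefAtom A → w ⊩ A →
       (∀ {w'} (r : w ⊑ w') (cl : Clause) → cl ∈ definition → (θ : Sub (cx w') (ctx cl)) →
          sub (inst r) A ≡ sub θ (head cl) → w' ⊩ sub θ (body cl) → w' ⊩ sub (inst r) C) →
       w ⊩ C
defE {w} {A} a d k = cut′ d (defL a λ cl m → Unifiers A cl , Unifiers-CSU A cl , λ Ψ' ρ θ (p , u) →
  k {world Ψ' p (sub θ (body cl) ∷ map (sub ρ) (hyps w))}
    (record { inst = ρ ; transport = λ e → weaken _ (substitute p ρ e) }) cl m θ u (identity p _))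

-- Semantics

-- `hold B` is separate from `fm (⊢F B)` so that substitution acts on `B` directly instead of under
-- the quantifier inside `⊢F`.
data Goal (Δ : Ctx) : Set where
  fm   : Fm Δ → Goal Δ
  hold : Nf Δ Prp → Goal Δ

⌊_⌋ᵍ : Goal Δ → Fm Δ
⌊ fm A ⌋ᵍ = A
⌊ hold B ⌋ᵍ = ⊢F B

subG : Sub Γ Δ → Goal Δ → Goal Γ
subG θ (fm A) = fm (sub θ A)
subG θ (hold B) = hold (sub θ B)

sub-⌊⌋ᵍ : (θ : Sub Γ Δ) (G : Goal Δ) → sub θ ⌊ G ⌋ᵍ ≡ ⌊ subG θ G ⌋ᵍ
sub-⌊⌋ᵍ θ (fm A) = refl
sub-⌊⌋ᵍ θ (hold B) = cong (λ X → ∃F Nt ofnt (lam (natF #0 ∧F k3 seq #0 (k0 nil) X))) (sub-wk θ B)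

subG-cong : {θ θ' : Sub Γ Δ} → θ ≐ θ' → (G : Goal Δ) → subG θ G ≡ subG θ' G
subG-cong e (fm A) = cong fm (sub-cong e A)
subG-cong e (hold B) = cong hold (sub-cong e B)

subG-∘ : (ρ : Sub Δ Θ) (η : Sub Γ Δ) (G : Goal Θ) → subG η (subG ρ G) ≡ subG (ρ ⊙ η) G
subG-∘ ρ η (fm A) = cong fm (sub-∘ ρ η A)
subG-∘ ρ η (hold B) = cong hold (sub-∘ ρ η B)

infix 3 _⊨_
record _⊨_ (w : World) (G : Goal (cx w)) : Set₁ where
  constructor ⊢⌊_⌋
  field der : w ⊩ ⌊ G ⌋ᵍ
open _⊨_ public

tr : (r : w ⊑ w') {G : Goal (cx w)} → w ⊨ G → w' ⊨ subG (inst r) G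
tr r {G} ⊢⌊ d ⌋ = ⊢⌊ conv refl (sub-⌊⌋ᵍ (inst r) G) (transport r d) ⌋

-- The unboxed reading ⟦ B ⟧ fixes the world; □ closes it under all extensions.
infixr 4 _⊃ᶜ_ _⊃□_
data Code (Δ : Ctx) : Set where
  at   : Goal Δ → Code Δ
  _⊃ᶜ_ : Goal Δ → Code Δ → Code Δ
  _⊃□_ : Code Δ → Code Δ → Code Δ
  all  : {τ : Ty} → OFree τ → Code (τ ∷ Δ) → Code Δ

⌊_⌋ : Code Δ → Fm Δ
⌊ at G ⌋ = ⌊ G ⌋ᵍ
⌊ G ⊃ᶜ B ⌋ = ⌊ G ⌋ᵍ ⊃F ⌊ B ⌋
⌊ A ⊃□ B ⌋ = ⌊ A ⌋ ⊃F ⌊ B ⌋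
⌊ all p B ⌋ = ∀F _ p (lam ⌊ B ⌋)

mutual
  -- A goal as antecedent needs no box, being preserved by extensions through `tr`; an antecedent
  -- that is a code does, since its unboxed reading is not assumed to be preserved.
  ⟦_⟧ : Code Δ → (w : World) → Sub (cx w) Δ → Set₁
  ⟦ at G ⟧ w θ = w ⊨ subG θ G
  ⟦ G ⊃ᶜ B ⟧ w θ = w ⊨ subG θ G → ⟦ B ⟧ w θ
  ⟦ A ⊃□ B ⟧ w θ = □ A w θ → ⟦ B ⟧ w θ
  ⟦ all p B ⟧ w θ = ∀ t → ⟦ B ⟧ w (t ▸ θ)

  □ : Code Δ → (w : World) → Sub (cx w) Δ → Set₁
  □ B w θ = ∀ {w'} (r : w ⊑ w') → ⟦ B ⟧ w' (θ ⊙ inst r)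

⟦⟧-cong : (B : Code Δ) {θ θ' : Sub (cx w) Δ} → θ ≐ θ' → ⟦ B ⟧ w θ → ⟦ B ⟧ w θ'
⟦⟧-cong (at G) e d = subst (_ ⊨_) (subG-cong e G) d
⟦⟧-cong (G ⊃ᶜ B) e f g = ⟦⟧-cong B e (f (subst (_ ⊨_) (subG-cong (λ x → sym (e x)) G) g))
⟦⟧-cong (A ⊃□ B) e f a = ⟦⟧-cong B e (f (λ r → ⟦⟧-cong A (λ x → cong (sub (inst r)) (sym (e x))) (a r)))
⟦⟧-cong (all p B) e f t = ⟦⟧-cong B (λ { vz → refl ; (vs x) → e x }) (f t)

⊑-hyp-inst : {A : Fm (cx w)} (r : w ▹ A ⊑ w') (t : Nf (cx w) τ) → sub (inst (⊑-trans ⊑-hyp r)) t ≡ sub (inst r) t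
⊑-hyp-inst r t = sub-cong (λ y → sub-nvar (inst r) y) t

mutual
  -- As in normalisation by evaluation: an implication is tried at the world enlarged by its
  -- antecedent, a universal at the world with a fresh eigenvariable. Both leave `w`, hence the
  -- boxed premise, while `reflect` can stay at `w`.
  reify : (B : Code Δ) {θ : Sub (cx w) Δ} → □ B w θ → w ⊩ sub θ ⌊ B ⌋
  reify (at G) {θ} f = conv refl (sym (sub-⌊⌋ᵍ θ G))
    (der (subst (_ ⊨_) (subG-cong (λ x → sub-id (θ x)) G) (f ⊑-refl)))
  reify {w = w} (G ⊃ᶜ B) {θ} f = ⊃R (reify B λ r → ⟦⟧-cong B (λ x → ⊑-hyp-inst r (θ x))
    (f (⊑-trans ⊑-hyp r) (subst (_ ⊨_) (trans (subG-∘ θ (inst r) G) (subG-cong (λ x → sym (⊑-hyp-inst r (θ x))) G))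
      (tr r ⊢⌊ conv refl (sub-⌊⌋ᵍ θ G) (hyp {w = w}) ⌋))))
  reify {w = w} (A ⊃□ B) {θ} f = ⊃R (reify B λ r → ⟦⟧-cong B (λ x → ⊑-hyp-inst r (θ x))
    (f (⊑-trans ⊑-hyp r) λ r' → ⟦⟧-cong A (λ x → trans (sym (sub-∘ (inst r) (inst r') (θ x)))
         (cong (sub (inst r')) (sym (⊑-hyp-inst r (θ x)))))
      (reflect A (conv refl (sub-∘ θ (inst (⊑-trans r r')) ⌊ A ⌋) (transport (⊑-trans r r') (hyp {w = w} {A = sub θ ⌊ A ⌋}))))))
  reify (all p B) {θ} f = ∀R (conv refl (sym (η-lam (sub (liftS θ) ⌊ B ⌋))) (reify B λ r →
    ⟦⟧-cong B (λ { vz → sym (sub-nvar (inst r) vz)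
                 ; (vs x) → trans (sub-cong (λ y → sub-nvar (inst r) (vs y)) (θ x)) (sym (sub-ren (inst r) vs (θ x))) })
      (f (⊑-trans (⊑-var {q = p}) r) (inst r vz))))

  reflect : (B : Code Δ) {θ : Sub (cx w) Δ} → w ⊩ sub θ ⌊ B ⌋ → ⟦ B ⟧ w θ
  reflect (at G) {θ} d = ⊢⌊ conv refl (sub-⌊⌋ᵍ θ G) d ⌋
  reflect {w = w} (G ⊃ᶜ B) {θ} d g = reflect B (⊃E {w = w} d (conv refl (sym (sub-⌊⌋ᵍ θ G)) (der g)))
  reflect {w = w} (A ⊃□ B) d a = reflect B (⊃E {w = w} d (reify A a))
  reflect {w = w} (all p B) {θ} d t = reflect B (conv refl (sub-▸-nvar t θ ⌊ B ⌋) (∀E {w = w} d t))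

reflect□ : (B : Code Δ) {θ : Sub (cx w) Δ} → w ⊩ sub θ ⌊ B ⌋ → □ B w θ
reflect□ B {θ} d r = reflect B (conv refl (sub-∘ θ (inst r) ⌊ B ⌋) (transport r d))

□-here : (B : Code Δ) {θ : Sub (cx w) Δ} → □ B w θ → ⟦ B ⟧ w θ
□-here B {θ} f = ⟦⟧-cong B (λ x → sub-id (θ x)) (f ⊑-refl)

□-tr : (B : Code Δ) {θ : Sub (cx w) Δ} (r : w ⊑ w') → □ B w θ → □ B w' (θ ⊙ inst r)
□-tr B {θ} r f r' = ⟦⟧-cong B (λ x → sym (sub-∘ (inst r) (inst r') (θ x))) (f (⊑-trans r r'))

-- `base` and `ind` must hold at every world because the premises of `natL` forget the hypotheses of
-- `w`. The rule is applied to `B` conjoined with `nat`, which gives `ind` the typing of the index.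
nat-induction : (B : Code (Nt ∷ [])) →
  (∀ {w} → ⟦ B ⟧ w (zN ▸ ∅)) →
  (∀ {w n} → w ⊨ fm (natF n) → □ B w (n ▸ ∅) → ⟦ B ⟧ w (sN n ▸ ∅)) →
  ∀ {w n} → w ⊨ fm (natF n) → ⟦ B ⟧ w (n ▸ ∅)
nat-induction B base ind {w} {n} ⊢⌊ d ⌋ = reflect B (cut′ d (natL (lam (M #0))
    (conv refl (sym (M-sub zN)) (∧R natz (reify {w = world (cx w) (ofree w) []} B λ r → ⟦⟧-cong B (λ { vz → refl }) base)))
    (conv (cong (_∷ []) (sym (η-lam (M #0)))) (sym (trans (wk-lam-·₁ (M #0) (sN #0)) (M-▸ (sN #0) _)))
      (∧R (nats (∧E₁ {w⁺} hyp⁺)) (reify {w = w⁺} B λ r → ⟦⟧-cong B (λ { vz → refl })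
        (ind (tr r ⊢⌊ ∧E₁ {w⁺} hyp⁺ ⌋) (λ r' → ⟦⟧-cong B (λ { vz → sym (sub-∘ (inst r) (inst r') #0) })
          (reflect□ B {nvar vz ▸ ∅} (∧E₂ {w⁺} hyp⁺) (⊑-trans r r')))))))
    (conv (cong (_∷ hyps w) (sym (M-sub n))) refl (∧L₂ (identity (ofree w) _)))))
  where
    M : ∀ {Ψ} → Nf Ψ Nt → Fm Ψ
    M t = natF t ∧F sub (t ▸ ∅) ⌊ B ⌋

    M-▸ : ∀ {Ψ Ψ'} (t : Nf Ψ Nt) (θ : Sub Ψ Ψ') → sub (t ▸ θ) (M #0) ≡ M t
    M-▸ t θ = cong (natF t ∧F_) (trans (sub-∘ (#0 ▸ ∅) (t ▸ θ) ⌊ B ⌋) (sub-cong (λ { vz → refl }) ⌊ B ⌋))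

    M-sub : ∀ {Ψ} (t : Nf Ψ Nt) → lam (M #0) ·₁ t ≡ M t
    M-sub t = trans (lam-·₁ (M #0) t) (M-▸ t nvar)

    w⁺ : World
    w⁺ = world (Nt ∷ cx w) (ofnt ∷ ofree w) (M #0 ∷ [])

    hyp⁺ : w⁺ ⊩ M #0
    hyp⁺ = identity (ofree w⁺) _

-- The definition as rules

typeof-body : (T : Nf Ψ I') (R : Nf Ψ (I' ⇒ I')) (U : Nf Ψ I') → Nf Ψ Prp
typeof-body T R U = k1 bigand (lam (k2 imp (typeofA #0 (wk T)) ⟨ typeofA (wk R ·₁ #0) (wk U) ⟩))

defI : (k : Fin _) (θ : Sub (cx w) (ctx (lookup definition k))) {A : Fm (cx w)} → A ≡ sub θ (head (lookup definition k)) →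
       w ⊨ fm (sub θ (body (lookup definition k))) → w ⊨ fm A
defI k θ e ⊢⌊ d ⌋ = ⊢⌊ defR (lookup definition k) (∈-lookup {xs = definition} k) θ e d ⌋

⊤I : w ⊨ fm ⊤F
⊤I = ⊢⌊ ⊤R ⌋

-- The instances of the `prog` clauses as an inductive family, so that inverting a rule is pattern
-- matching. A second-order variable applied in a clause becomes hereditary application.
data Rule {Ψ : Ctx} : Nf Ψ Atm → Nf Ψ Prp → Set where
  ty-zero : Rule (typeofA (k0 zero) (k0 num)) (k0 tt)
  ty-true : Rule (typeofA (k0 true) (k0 bool)) (k0 tt)
  ty-false : Rule (typeofA (k0 false) (k0 bool)) (k0 tt)
  ty-succ : ∀ {M} → Rule (typeofA (k1 succ M) (k0 num)) (⟨ typeofA M (k0 num) ⟩)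
  ty-pred : ∀ {M} → Rule (typeofA (k1 pred M) (k0 num)) (⟨ typeofA M (k0 num) ⟩)
  ty-is-zero : ∀ {M} → Rule (typeofA (k1 is-zero M) (k0 bool)) (⟨ typeofA M (k0 num) ⟩)
  ty-if : ∀ {M N₁ N₂ T} → Rule (typeofA (k3 if M N₁ N₂) T) (⟨ typeofA M (k0 bool) ⟩ & ⟨ typeofA N₁ T ⟩ & ⟨ typeofA N₂ T ⟩)
  ty-abs : ∀ {T R U} → Rule (typeofA (k2 abs T R) (k2 arr T U)) (typeof-body T R U)
  ty-app : ∀ {M N T U} → Rule (typeofA (k2 app M N) T) (⟨ typeofA M (k2 arr U T) ⟩ & ⟨ typeofA N U ⟩)
  ty-rec : ∀ {T R} → Rule (typeofA (k2 rec T R) T) (typeof-body T R T)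
  ev-zero : Rule (k0 zero ⇓ k0 zero) (k0 tt)
  ev-true : Rule (k0 true ⇓ k0 true) (k0 tt)
  ev-false : Rule (k0 false ⇓ k0 false) (k0 tt)
  ev-succ : ∀ {M V} → Rule (k1 succ M ⇓ k1 succ V) (⟨ M ⇓ V ⟩)
  ev-pred-zero : ∀ {M} → Rule (k1 pred M ⇓ k0 zero) (⟨ M ⇓ k0 zero ⟩)
  ev-pred-succ : ∀ {M V} → Rule (k1 pred M ⇓ V) (⟨ M ⇓ k1 succ V ⟩)
  ev-is-zero-true : ∀ {M} → Rule (k1 is-zero M ⇓ k0 true) (⟨ M ⇓ k0 zero ⟩)
  ev-is-zero-false : ∀ {M V} → Rule (k1 is-zero M ⇓ k0 false) (⟨ M ⇓ k1 succ V ⟩)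
  ev-if-true : ∀ {M N₁ N₂ V} → Rule (k3 if M N₁ N₂ ⇓ V) (⟨ M ⇓ k0 true ⟩ & ⟨ N₁ ⇓ V ⟩)
  ev-if-false : ∀ {M N₁ N₂ V} → Rule (k3 if M N₁ N₂ ⇓ V) (⟨ M ⇓ k0 false ⟩ & ⟨ N₂ ⇓ V ⟩)
  ev-abs : ∀ {T R} → Rule (k2 abs T R ⇓ k2 abs T R) (k0 tt)
  ev-app : ∀ {M N V T R} → Rule (k2 app M N ⇓ V) (⟨ M ⇓ k2 abs T R ⟩ & ⟨ (R ·₁ N) ⇓ V ⟩)
  ev-rec : ∀ {T R V} → Rule (k2 rec T R ⇓ V) (⟨ (R ·₁ k2 rec T R) ⇓ V ⟩)
  st-succ : ∀ {M M'} → Rule (k1 succ M ↝ k1 succ M') (⟨ M ↝ M' ⟩)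
  st-pred-zero : Rule (k1 pred (k0 zero) ↝ k0 zero) (k0 tt)
  st-pred-succ : ∀ {V} → Rule (k1 pred (k1 succ V) ↝ V) (⟨ valueA V ⟩)
  st-pred : ∀ {M M'} → Rule (k1 pred M ↝ k1 pred M') (⟨ M ↝ M' ⟩)
  st-is-zero-zero : Rule (k1 is-zero (k0 zero) ↝ k0 true) (k0 tt)
  st-is-zero-succ : ∀ {V} → Rule (k1 is-zero (k1 succ V) ↝ k0 false) (⟨ valueA V ⟩)
  st-is-zero : ∀ {M M'} → Rule (k1 is-zero M ↝ k1 is-zero M') (⟨ M ↝ M' ⟩)
  st-if-true : ∀ {M N} → Rule (k3 if (k0 true) M N ↝ M) (k0 tt)
  st-if-false : ∀ {M N} → Rule (k3 if (k0 false) M N ↝ N) (k0 tt)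
  st-if : ∀ {M M' N₁ N₂} → Rule (k3 if M N₁ N₂ ↝ k3 if M' N₁ N₂) (⟨ M ↝ M' ⟩)
  st-beta : ∀ {T R N} → Rule (k2 app (k2 abs T R) N ↝ (R ·₁ N)) (k0 tt)
  st-app : ∀ {M M' N} → Rule (k2 app M N ↝ k2 app M' N) (⟨ M ↝ M' ⟩)
  st-rec : ∀ {T R} → Rule (k2 rec T R ↝ (R ·₁ k2 rec T R)) (k0 tt)
  sts-refl : ∀ {M} → Rule (M ↝* M) (k0 tt)
  sts-step : ∀ {M N M'} → Rule (M ↝* N) (⟨ M ↝ M' ⟩ & ⟨ M' ↝* N ⟩)
  val-zero : Rule (valueA (k0 zero)) (k0 tt)
  val-true : Rule (valueA (k0 true)) (k0 tt)
  val-false : Rule (valueA (k0 false)) (k0 tt)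
  val-succ : ∀ {V} → Rule (valueA (k1 succ V)) (⟨ valueA V ⟩)
  val-abs : ∀ {T R} → Rule (valueA (k2 abs T R)) (k0 tt)

Rule⇒prog : ∀ {A G} → Rule A G → w ⊨ fm (k2 prog A G)
-- Positions in `definition`: the `prog` clauses come after 7 clauses for `nt`, 10 for lists and 6
-- for `seq`.
Rule⇒prog ty-zero = defI (# 23) ∅ refl ⊤I
Rule⇒prog ty-true = defI (# 24) ∅ refl ⊤I
Rule⇒prog ty-false = defI (# 25) ∅ refl ⊤I
Rule⇒prog (ty-succ {M}) = defI (# 26) (M ▸ ∅) refl ⊤I
Rule⇒prog (ty-pred {M}) = defI (# 27) (M ▸ ∅) refl ⊤I
Rule⇒prog (ty-is-zero {M}) = defI (# 28) (M ▸ ∅) refl ⊤I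
Rule⇒prog (ty-if {M} {N₁} {N₂} {T}) = defI (# 29) (M ▸ N₁ ▸ N₂ ▸ T ▸ ∅) refl ⊤I
-- A variable of type `i ⇒ i` standing alone in a head is η-expanded, so its instance equals `R`
-- only through `sub-nvar`; at base types this holds by computation.
Rule⇒prog (ty-abs {T} {R} {U}) = defI (# 30) (T ▸ R ▸ U ▸ ∅)
  (cong (λ X → k2 prog (typeofA (k2 abs T X) (k2 arr T U)) (typeof-body T R U)) (sym (sub-nvar (T ▸ R ▸ U ▸ ∅) (vs vz)))) ⊤I
Rule⇒prog (ty-app {M} {N} {T} {U}) = defI (# 31) (M ▸ N ▸ T ▸ U ▸ ∅) refl ⊤I
Rule⇒prog (ty-rec {T} {R}) = defI (# 32) (T ▸ R ▸ ∅)
  (cong (λ X → k2 prog (typeofA (k2 rec T X) T) (typeof-body T R T)) (sym (sub-nvar (T ▸ R ▸ ∅) (vs vz)))) ⊤I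
Rule⇒prog ev-zero = defI (# 33) ∅ refl ⊤I
Rule⇒prog ev-true = defI (# 34) ∅ refl ⊤I
Rule⇒prog ev-false = defI (# 35) ∅ refl ⊤I
Rule⇒prog (ev-succ {M} {V}) = defI (# 36) (M ▸ V ▸ ∅) refl ⊤I
Rule⇒prog (ev-pred-zero {M}) = defI (# 37) (M ▸ ∅) refl ⊤I
Rule⇒prog (ev-pred-succ {M} {V}) = defI (# 38) (M ▸ V ▸ ∅) refl ⊤I
Rule⇒prog (ev-is-zero-true {M}) = defI (# 39) (M ▸ ∅) refl ⊤I
Rule⇒prog (ev-is-zero-false {M} {V}) = defI (# 40) (M ▸ V ▸ ∅) refl ⊤I
Rule⇒prog (ev-if-true {M} {N₁} {N₂} {V}) = defI (# 41) (M ▸ N₁ ▸ N₂ ▸ V ▸ ∅) refl ⊤I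
Rule⇒prog (ev-if-false {M} {N₁} {N₂} {V}) = defI (# 42) (M ▸ N₁ ▸ N₂ ▸ V ▸ ∅) refl ⊤I
Rule⇒prog (ev-abs {T} {R}) = defI (# 43) (T ▸ R ▸ ∅)
  (cong (λ X → k2 prog (k2 abs T X ⇓ k2 abs T X) (k0 tt)) (sym (sub-nvar (T ▸ R ▸ ∅) (vs vz)))) ⊤I
Rule⇒prog (ev-app {M} {N} {V} {T} {R}) = defI (# 44) (M ▸ N ▸ V ▸ T ▸ R ▸ ∅)
  (cong (λ X → k2 prog (k2 app M N ⇓ V) (⟨ M ⇓ k2 abs T X ⟩ & ⟨ (R ·₁ N) ⇓ V ⟩)) (sym (sub-nvar (M ▸ N ▸ V ▸ T ▸ R ▸ ∅) (vs (vs (vs (vs vz))))))) ⊤I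
Rule⇒prog (ev-rec {T} {R} {V}) = defI (# 45) (T ▸ R ▸ V ▸ ∅)
  (cong (λ X → k2 prog (k2 rec T X ⇓ V) (⟨ (R ·₁ k2 rec T X) ⇓ V ⟩)) (sym (sub-nvar (T ▸ R ▸ V ▸ ∅) (vs vz)))) ⊤I
Rule⇒prog (st-succ {M} {M'}) = defI (# 46) (M ▸ M' ▸ ∅) refl ⊤I
Rule⇒prog st-pred-zero = defI (# 47) ∅ refl ⊤I
Rule⇒prog (st-pred-succ {V}) = defI (# 48) (V ▸ ∅) refl ⊤I
Rule⇒prog (st-pred {M} {M'}) = defI (# 49) (M ▸ M' ▸ ∅) refl ⊤I
Rule⇒prog st-is-zero-zero = defI (# 50) ∅ refl ⊤I
Rule⇒prog (st-is-zero-succ {V}) = defI (# 51) (V ▸ ∅) refl ⊤I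
Rule⇒prog (st-is-zero {M} {M'}) = defI (# 52) (M ▸ M' ▸ ∅) refl ⊤I
Rule⇒prog (st-if-true {M} {N}) = defI (# 53) (M ▸ N ▸ ∅) refl ⊤I
Rule⇒prog (st-if-false {M} {N}) = defI (# 54) (M ▸ N ▸ ∅) refl ⊤I
Rule⇒prog (st-if {M} {M'} {N₁} {N₂}) = defI (# 55) (M ▸ M' ▸ N₁ ▸ N₂ ▸ ∅) refl ⊤I
Rule⇒prog (st-beta {T} {R} {N}) = defI (# 56) (T ▸ R ▸ N ▸ ∅)
  (cong (λ X → k2 prog (k2 app (k2 abs T X) N ↝ (R ·₁ N)) (k0 tt)) (sym (sub-nvar (T ▸ R ▸ N ▸ ∅) (vs vz)))) ⊤I
Rule⇒prog (st-app {M} {M'} {N}) = defI (# 57) (M ▸ M' ▸ N ▸ ∅) refl ⊤I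
Rule⇒prog (st-rec {T} {R}) = defI (# 58) (T ▸ R ▸ ∅)
  (cong (λ X → k2 prog (k2 rec T X ↝ (R ·₁ k2 rec T X)) (k0 tt)) (sym (sub-nvar (T ▸ R ▸ ∅) (vs vz)))) ⊤I
Rule⇒prog (sts-refl {M}) = defI (# 59) (M ▸ ∅) refl ⊤I
Rule⇒prog (sts-step {M} {N} {M'}) = defI (# 60) (M ▸ N ▸ M' ▸ ∅) refl ⊤I
Rule⇒prog val-zero = defI (# 61) ∅ refl ⊤I
Rule⇒prog val-true = defI (# 62) ∅ refl ⊤I
Rule⇒prog val-false = defI (# 63) ∅ refl ⊤I
Rule⇒prog (val-succ {V}) = defI (# 64) (V ▸ ∅) refl ⊤I
Rule⇒prog (val-abs {T} {R}) = defI (# 65) (T ▸ R ▸ ∅)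
  (cong (λ X → k2 prog (valueA (k2 abs T X)) (k0 tt)) (sym (sub-nvar (T ▸ R ▸ ∅) (vs vz)))) ⊤I

data Unused : NonLog τ → Set where
  u-lt      : Unused lt
  u-le      : Unused le
  u-sum     : Unused sum
  u-length  : Unused length
  u-list    : Unused list
  u-split   : Unused split
  u-permute : Unused permute

data Unfold {Ψ : Ctx} : Fm Ψ → Fm Ψ → Set where
  unused        : {p : NonLog τ} {sp : Sp Ψ τ (` o)} {F : Fm Ψ} → Unused p → Unfold (ne (con (nl p)) sp) F
  eqnt-refl     : ∀ {n} → Unfold (k2 eqnt n n) ⊤F
  equiv-refl    : ∀ {M} → Unfold (k2 equiv M M) ⊤F
  element-here  : ∀ {X L} → Unfold (k2 element X (X :: L)) ⊤F
  element-there : ∀ {X Y L} → Unfold (k2 element X (Y :: L)) (k2 element X L)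
  seq-ax        : ∀ {n A' L A} → Unfold (k3 seq n (A' :: L) ⟨ A ⟩) (k2 element A (A' :: L))
  seq-tt        : ∀ {n L} → Unfold (k3 seq n L (k0 tt)) ⊤F
  seq-and       : ∀ {n L B C} → Unfold (k3 seq (sN n) L (B & C)) (k3 seq n L B ∧F k3 seq n L C)
  seq-imp       : ∀ {n L A B} → Unfold (k3 seq (sN n) L (k2 imp A B)) (k3 seq n (A :: L) B)
  seq-big       : ∀ {n L R} → Unfold (k3 seq (sN n) L (k1 bigand R))
                    (∀F I' ofi (lam (k3 seq (wk n) (wk L) (wk R ·₁ #0))))
  seq-bc        : ∀ {n L A} → Unfold (k3 seq (sN n) L ⟨ A ⟩)
                    (∃F Prp ofprp (lam (k2 prog (wk A) #0 ∧F k3 seq (wk n) (wk L) #0)))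
  prog-rule     : ∀ {A G} → Rule A G → Unfold (k2 prog A G) ⊤F

unfold : All (λ cl → ∀ {Ψ} (θ : Sub Ψ (ctx cl)) → Unfold (sub θ (head cl)) (sub θ (body cl))) definition
unfold =
    (λ θ → eqnt-refl)
  ∷ (λ θ → unused u-sum) ∷ (λ θ → unused u-sum)
  ∷ (λ θ → unused u-lt) ∷ (λ θ → unused u-lt)
  ∷ (λ θ → unused u-le) ∷ (λ θ → unused u-le)
  ∷ (λ θ → unused u-length) ∷ (λ θ → unused u-length)
  ∷ (λ θ → unused u-list)
  ∷ (λ θ → element-here) ∷ (λ θ → element-there)
  ∷ (λ θ → unused u-split) ∷ (λ θ → unused u-split) ∷ (λ θ → unused u-split)
  ∷ (λ θ → unused u-permute) ∷ (λ θ → unused u-permute)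
  ∷ (λ θ → seq-ax) ∷ (λ θ → seq-tt) ∷ (λ θ → seq-and) ∷ (λ θ → seq-imp)
  ∷ (λ θ → subst (λ R → Unfold (k3 seq (sN (θ vz)) (θ (vs vz)) (k1 bigand R))
        (∀F I' ofi (lam (k3 seq (wk (θ vz)) (wk (θ (vs vz))) (wk (θ (vs (vs vz))) ·₁ #0)))))
      (sym (sub-nvar θ (vs (vs vz)))) seq-big)
  ∷ (λ θ → seq-bc)
  ∷ (λ θ → prog-rule ty-zero)
  ∷ (λ θ → prog-rule ty-true)
  ∷ (λ θ → prog-rule ty-false)
  ∷ (λ θ → prog-rule ty-succ)
  ∷ (λ θ → prog-rule ty-pred)
  ∷ (λ θ → prog-rule ty-is-zero)
  ∷ (λ θ → prog-rule ty-if)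
  ∷ (λ θ → subst (λ X → Unfold (k2 prog (typeofA (k2 abs (θ vz) X) (k2 arr (θ vz) (θ (vs (vs vz))))) (typeof-body (θ vz) (θ (vs vz)) (θ (vs (vs vz))))) ⊤F) (sym (sub-nvar θ (vs vz))) (prog-rule ty-abs))
  ∷ (λ θ → prog-rule ty-app)
  ∷ (λ θ → subst (λ X → Unfold (k2 prog (typeofA (k2 rec (θ vz) X) (θ vz)) (typeof-body (θ vz) (θ (vs vz)) (θ vz))) ⊤F) (sym (sub-nvar θ (vs vz))) (prog-rule ty-rec))
  ∷ (λ θ → prog-rule ev-zero)
  ∷ (λ θ → prog-rule ev-true)
  ∷ (λ θ → prog-rule ev-false)
  ∷ (λ θ → prog-rule ev-succ)
  ∷ (λ θ → prog-rule ev-pred-zero)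
  ∷ (λ θ → prog-rule ev-pred-succ)
  ∷ (λ θ → prog-rule ev-is-zero-true)
  ∷ (λ θ → prog-rule ev-is-zero-false)
  ∷ (λ θ → prog-rule ev-if-true)
  ∷ (λ θ → prog-rule ev-if-false)
  ∷ (λ θ → subst (λ X → Unfold (k2 prog (k2 abs (θ vz) X ⇓ k2 abs (θ vz) X) (k0 tt)) ⊤F) (sym (sub-nvar θ (vs vz))) (prog-rule ev-abs))
  ∷ (λ θ → subst (λ X → Unfold (k2 prog (k2 app (θ vz) (θ (vs vz)) ⇓ (θ (vs (vs vz)))) (⟨ (θ vz) ⇓ k2 abs (θ (vs (vs (vs vz)))) X ⟩ & ⟨ ((θ (vs (vs (vs (vs vz))))) ·₁ (θ (vs vz))) ⇓ (θ (vs (vs vz))) ⟩)) ⊤F) (sym (sub-nvar θ (vs (vs (vs (vs vz)))))) (prog-rule ev-app))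
  ∷ (λ θ → subst (λ X → Unfold (k2 prog (k2 rec (θ vz) X ⇓ (θ (vs (vs vz)))) (⟨ ((θ (vs vz)) ·₁ k2 rec (θ vz) X) ⇓ (θ (vs (vs vz))) ⟩)) ⊤F) (sym (sub-nvar θ (vs vz))) (prog-rule ev-rec))
  ∷ (λ θ → prog-rule st-succ)
  ∷ (λ θ → prog-rule st-pred-zero)
  ∷ (λ θ → prog-rule st-pred-succ)
  ∷ (λ θ → prog-rule st-pred)
  ∷ (λ θ → prog-rule st-is-zero-zero)
  ∷ (λ θ → prog-rule st-is-zero-succ)
  ∷ (λ θ → prog-rule st-is-zero)
  ∷ (λ θ → prog-rule st-if-true)
  ∷ (λ θ → prog-rule st-if-false)
  ∷ (λ θ → prog-rule st-if)
  ∷ (λ θ → subst (λ X → Unfold (k2 prog (k2 app (k2 abs (θ vz) X) (θ (vs (vs vz))) ↝ ((θ (vs vz)) ·₁ (θ (vs (vs vz))))) (k0 tt)) ⊤F) (sym (sub-nvar θ (vs vz))) (prog-rule st-beta))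
  ∷ (λ θ → prog-rule st-app)
  ∷ (λ θ → subst (λ X → Unfold (k2 prog (k2 rec (θ vz) X ↝ ((θ (vs vz)) ·₁ k2 rec (θ vz) X)) (k0 tt)) ⊤F) (sym (sub-nvar θ (vs vz))) (prog-rule st-rec))
  ∷ (λ θ → prog-rule sts-refl)
  ∷ (λ θ → prog-rule sts-step)
  ∷ (λ θ → prog-rule val-zero)
  ∷ (λ θ → prog-rule val-true)
  ∷ (λ θ → prog-rule val-false)
  ∷ (λ θ → prog-rule val-succ)
  ∷ (λ θ → subst (λ X → Unfold (k2 prog (valueA (k2 abs (θ vz) X)) (k0 tt)) ⊤F) (sym (sub-nvar θ (vs vz))) (prog-rule val-abs))
  ∷ (λ θ → equiv-refl)
  ∷ []

-- Elimination in continuation-passing style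

-- What an elimination yields exists only at further worlds and only in the course of proving a
-- goal; so it is passed to a continuation. `Cont-code` widens the answers from goals to codes.
Cont : (w : World) → (∀ {w'} → w ⊑ w' → Set₁) → Set₁
Cont w X = ∀ {G} → (∀ {w'} (r : w ⊑ w') → X r → w' ⊨ subG (inst r) G) → w ⊨ G

infixl 1 _>>=_
_>>=_ : {X Y : ∀ {w'} → w ⊑ w' → Set₁} → Cont w X →
        (∀ {w'} (r : w ⊑ w') → X r → Cont w' (λ r' → Y (⊑-trans r r'))) → Cont w Y
_>>=_ c f {G} k = c λ r x → f r x λ r' y → subst (_ ⊨_) (sym (subG-∘ (inst r) (inst r') G)) (k (⊑-trans r r') y)

-- Keeping `A'` apart from the instance of `A`, linked by an equation, leaves the unification with a
-- clause to each use.
data UnfoldAt {w w'} (r : w ⊑ w') (A : Fm (cx w)) : Set₁ where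
  unfoldAt : ∀ {A' F} → A' ≡ sub (inst r) A → Unfold A' F → w' ⊨ fm F → UnfoldAt r A

defC : {A : Fm (cx w)} → DefAtom A → w ⊨ fm A → Cont w (λ r → UnfoldAt r A)
defC a ⊢⌊ d ⌋ {G} k = ⊢⌊ defE a d (λ r cl m θ e b →
  conv refl (sym (sub-⌊⌋ᵍ (inst r) G)) (der (k r (unfoldAt (sym e) (All.lookup unfold m θ) ⊢⌊ b ⌋)))) ⌋

∃C : {p : OFree τ} {B : Fm (τ ∷ cx w)} → w ⊨ fm (∃F τ p (lam B)) →
     Cont w (λ {w'} r → Σ[ t ∈ Nf (cx w') τ ] w' ⊨ fm (sub (t ▸ inst r) B))
∃C ⊢⌊ d ⌋ {G} k = ⊢⌊ ∃E d (λ r t b → conv refl (sym (sub-⌊⌋ᵍ (inst r) G)) (der (k r (t , ⊢⌊ b ⌋)))) ⌋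

-- Inversion and introduction for the defined predicates

private variable
  n k j : Nf Ψ Nt
  L L' : Nf Ψ AL
  A X Y : Nf Ψ Atm
  B C : Nf Ψ Prp
  M M' N N' V T U m v : Nf Ψ I'
  R : Nf Ψ (I' ⇒ I')

seqG : Nf Ψ Nt → Nf Ψ AL → Nf Ψ Prp → Goal Ψ
seqG n L B = fm (k3 seq n L B)

natG : Nf Ψ Nt → Goal Ψ
natG n = fm (natF n)

nilL : Nf Ψ AL
nilL = k0 nil

∧I : {F F' : Fm (cx w)} → w ⊨ fm F → w ⊨ fm F' → w ⊨ fm (F ∧F F')
∧I ⊢⌊ d ⌋ ⊢⌊ e ⌋ = ⊢⌊ ∧R d e ⌋

∧fst : {F F' : Fm (cx w)} → w ⊨ fm (F ∧F F') → w ⊨ fm F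
∧fst {w} ⊢⌊ d ⌋ = ⊢⌊ ∧E₁ {w} d ⌋

∧snd : {F F' : Fm (cx w)} → w ⊨ fm (F ∧F F') → w ⊨ fm F'
∧snd {w} ⊢⌊ d ⌋ = ⊢⌊ ∧E₂ {w} d ⌋

holdC : w ⊨ hold B → Cont w (λ {w'} r → Σ[ n ∈ Nf (cx w') Nt ] (w' ⊨ natG n × w' ⊨ seqG n nilL (sub (inst r) B)))
holdC {w} {B} ⊢⌊ d ⌋ kk = ∃C {w = w} ⊢⌊ d ⌋ λ r (n , b) → kk r (n , ∧fst b ,
  subst (λ D → _ ⊨ seqG n nilL D) (sub-▸-wk n (inst r) B) (∧snd b))

holdI : w ⊨ natG n → w ⊨ seqG n nilL B → w ⊨ hold B
holdI {w} {n} {B} ⊢⌊ d ⌋ ⊢⌊ e ⌋ = ⊢⌊ ∃I {w = w} n (∧R d (conv refl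
  (cong (k3 seq n nilL) (sym (trans (sub-▸-wk n nvar B) (sub-id B)))) e)) ⌋

data SeqView (w : World) : Nf (cx w) Nt → Nf (cx w) AL → Nf (cx w) Prp → Set₁ where
  v-ax  : w ⊨ fm (k2 element A (X :: L)) → SeqView w n (X :: L) ⟨ A ⟩
  v-tt  : SeqView w n L (k0 tt)
  v-and : w ⊨ seqG n L B → w ⊨ seqG n L C → SeqView w (sN n) L (B & C)
  v-imp : w ⊨ seqG n (A :: L) B → SeqView w (sN n) L (k2 imp A B)
  v-big : ∀ {R} → (∀ {w'} (r : w ⊑ w') N → w' ⊨ seqG (sub (inst r) n) (sub (inst r) L) (sub (inst r) R ·₁ N)) →
          SeqView w (sN n) L (k1 bigand R)
  v-bc  : Rule A B → w ⊨ seqG n L B → SeqView w (sN n) L ⟨ A ⟩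

data SeqAt {w w'} (r : w ⊑ w') (n : Nf (cx w) Nt) (L : Nf (cx w) AL) (B : Nf (cx w) Prp) : Set₁ where
  seqAt : ∀ {n' L' B'} → n' ≡ sub (inst r) n → L' ≡ sub (inst r) L → B' ≡ sub (inst r) B → SeqView w' n' L' B' → SeqAt r n L B

data RuleAt {w w'} (r : w ⊑ w') (A : Nf (cx w) Atm) (B : Nf (cx w) Prp) : Set₁ where
  ruleAt : Rule (sub (inst r) A) (sub (inst r) B) → RuleAt r A B

progC : w ⊨ fm (k2 prog A B) → Cont w (λ r → RuleAt r A B)
progC d k = defC (defatom prog d-prog _) d λ where
  r (unfoldAt refl (prog-rule q) _) → k r (ruleAt q)

bigE : ∀ {R} → w ⊨ fm (∀F I' ofi (lam (k3 seq (wk n) (wk L) (wk R ·₁ #0)))) → (N : Nf (cx w) I') → w ⊨ seqG n L (R ·₁ N)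
bigE {w} {n} {L} {R} ⊢⌊ d ⌋ N = ⊢⌊ conv refl e (∀E {w = w} d N) ⌋
  where
    back : ∀ {τ} (t : Nf (cx w) τ) → sub (N ▸ nvar) (wk t) ≡ t
    back t = trans (sub-▸-wk N nvar t) (sub-id t)

    e : sub (N ▸ nvar) (k3 seq (wk n) (wk L) (wk R ·₁ #0)) ≡ k3 seq n L (R ·₁ N)
    e rewrite back n | back L | sub-·₁ (N ▸ nvar) (wk R) #0 | back R = refl

sub-∀seq : (θ : Sub Γ Δ) (n : Nf Δ Nt) (L : Nf Δ AL) (R : Nf Δ (I' ⇒ Prp)) →
           sub θ (∀F I' ofi (lam (k3 seq (wk n) (wk L) (wk R ·₁ #0)))) ≡
           ∀F I' ofi (lam (k3 seq (wk (sub θ n)) (wk (sub θ L)) (wk (sub θ R) ·₁ #0)))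
sub-∀seq θ n L R rewrite sub-wk {σ = I'} θ n | sub-wk {σ = I'} θ L | sub-wk·₁-nvar θ R = refl

seqC : w ⊨ seqG n L B → Cont w (λ r → SeqAt r n L B)
seqC {w} {n} {L} {B} d {G} k = defC (defatom seq d-seq _) d λ where
    r (unfoldAt refl u b) → view r refl refl refl u b
  where
    next : ∀ {τ w' w₁ w₂} {t' : Nf (cx w') τ} (r : w ⊑ w') (r₁ : w' ⊑ w₁) (r₂ : w₁ ⊑ w₂) (D : Nf (cx w₁) Prp)
           (t : Nf (cx w) τ) → t' ≡ sub (inst r) t →
           sub (inst r₂) (sub (D ▸ inst r₁) (wk t')) ≡ sub (inst (⊑-trans r (⊑-trans r₁ r₂))) t
    next r r₁ r₂ D t refl = trans (cong (sub (inst r₂)) (sub-▸-wk D (inst r₁) (sub (inst r) t)))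
      (trans (sub-∘ (inst r₁) (inst r₂) (sub (inst r) t)) (sub-∘ (inst r) (inst (⊑-trans r₁ r₂)) t))

    view : ∀ {w' n' L' B' F} (r : w ⊑ w') → n' ≡ sub (inst r) n → L' ≡ sub (inst r) L → B' ≡ sub (inst r) B →
           Unfold (k3 seq n' L' B') F → w' ⊨ fm F → w' ⊨ subG (inst r) G
    view r e₁ e₂ e₃ (unused ()) b
    view r e₁ e₂ e₃ seq-ax b = k r (seqAt e₁ e₂ e₃ (v-ax b))
    view r e₁ e₂ e₃ seq-tt b = k r (seqAt e₁ e₂ e₃ v-tt)
    view r e₁ e₂ e₃ seq-and b = k r (seqAt e₁ e₂ e₃ (v-and (∧fst b) (∧snd b)))
    view r e₁ e₂ e₃ seq-imp b = k r (seqAt e₁ e₂ e₃ (v-imp b))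
    view r e₁ e₂ e₃ (seq-big {n₁} {L₁} {R}) b = k r (seqAt e₁ e₂ e₃ (v-big λ {w'} r' →
      bigE {R = sub (inst r') R} (subst (λ F → w' ⊨ fm F) (sub-∀seq (inst r') n₁ L₁ R) (tr r' b))))
    -- The rule used in backchaining is known only after opening the existential and inverting
    -- `prog`, so this view lives two extensions further on.
    view r e₁ e₂ e₃ (seq-bc {n₁} {L₁} {A}) b = ∃C b λ r₁ (D , c) → progC (∧fst c) λ where
      r₂ (ruleAt q) → subst (_ ⊨_)
        (sym (trans (subG-∘ (inst r₁) (inst r₂) (subG (inst r) G)) (subG-∘ (inst r) (inst (⊑-trans r₁ r₂)) G)))
        (k (⊑-trans r (⊑-trans r₁ r₂)) (seqAt (next r r₁ r₂ D n e₁) (next r r₁ r₂ D L e₂) (next r r₁ r₂ D B e₃)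
          (v-bc q (tr r₂ (∧snd c)))))

ax : w ⊨ fm (k2 element A (X :: L)) → w ⊨ seqG n (X :: L) ⟨ A ⟩
ax {A = A} {X} {L} {n} = defI (# 17) (n ▸ X ▸ L ▸ A ▸ ∅) refl

ttI : w ⊨ seqG n L (k0 tt)
ttI {n = n} {L} = defI (# 18) (n ▸ L ▸ ∅) refl ⊤I

andI : w ⊨ seqG n L B → w ⊨ seqG n L C → w ⊨ seqG (sN n) L (B & C)
andI {n = n} {L} {B} {C} d e = defI (# 19) (n ▸ L ▸ B ▸ C ▸ ∅) refl (∧I d e)

impI : w ⊨ seqG n (A :: L) B → w ⊨ seqG (sN n) L (k2 imp A B)
impI {n = n} {A} {L} {B} d = defI (# 20) (n ▸ L ▸ A ▸ B ▸ ∅) refl d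

bigI : ∀ {R} → (∀ {w'} (r : w ⊑ w') N → w' ⊨ seqG (sub (inst r) n) (sub (inst r) L) (sub (inst r) R ·₁ N)) →
       w ⊨ seqG (sN n) L (k1 bigand R)
bigI {w} {n} {L} {R} f = defI (# 21) θ (cong (λ R → k3 seq (sN n) L (k1 bigand R)) (sym (sub-nvar θ (vs (vs vz)))))
    ⊢⌊ ∀R (conv refl (sym (η-lam _)) (der (subst (λ F → w ▹ᵛ ofi ⊨ fm F) e (f (⊑-var {q = ofi}) #0)))) ⌋
  where
    θ : Sub (cx w) (Nt ∷ AL ∷ (I' ⇒ Prp) ∷ [])
    θ = n ▸ L ▸ R ▸ ∅

    wk′ : ∀ {τ} (t : Nf (cx w) τ) → sub (λ x → nvar (vs {σ = I'} x)) t ≡ wk t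
    wk′ t = sym (ren-as-sub vs t)

    e : k3 seq (sub (λ x → nvar (vs x)) n) (sub (λ x → nvar (vs x)) L) (sub (λ x → nvar (vs x)) R ·₁ #0) ≡
        k3 seq (wk n) (wk L) (wk R ·₁ #0)
    e rewrite wk′ n | wk′ L | wk′ R = refl

seq-prog : w ⊨ fm (k2 prog A B) → w ⊨ seqG n L B → w ⊨ seqG (sN n) L ⟨ A ⟩
seq-prog {w = w} {A = A} {B = B} {n = n} {L = L} c d = defI (# 22) (n ▸ L ▸ A ▸ ∅) refl
    ⊢⌊ ∃I {w = w} B (der (subst (λ F → w ⊨ fm F) e (∧I c d))) ⌋
  where
    back : ∀ {τ} (t : Nf (cx w) τ) → sub (B ▸ nvar) (wk t) ≡ t
    back t = trans (sub-▸-wk B nvar t) (sub-id t)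

    e : (k2 prog A B ∧F k3 seq n L B) ≡ sub (B ▸ nvar) (k2 prog (wk A) #0 ∧F k3 seq (wk n) (wk L) #0)
    e rewrite back A | back n | back L = refl

bcI : Rule A B → w ⊨ seqG n L B → w ⊨ seqG (sN n) L ⟨ A ⟩
bcI q = seq-prog (Rule⇒prog q)

hereI : w ⊨ fm (k2 element X (X :: L))
hereI {X = X} {L} = defI (# 10) (X ▸ L ▸ ∅) refl ⊤I

thereI : w ⊨ fm (k2 element X L) → w ⊨ fm (k2 element X (Y :: L))
thereI {X = X} {L} {Y} d = defI (# 11) (X ▸ Y ▸ L ▸ ∅) refl d

≡I : M ≡ N → w ⊨ fm (M ≡F N)
≡I {M = M} refl = defI (# 66) (M ▸ ∅) refl ⊤I

data EqAt {w w'} (r : w ⊑ w') (M N : Nf (cx w) I') : Set₁ where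
  eqAt : sub (inst r) M ≡ sub (inst r) N → EqAt r M N

≡C : w ⊨ fm (M ≡F N) → Cont w (λ r → EqAt r M N)
≡C {w} {M} {N} d k = defC (defatom equiv d-equiv _) d λ where
    r (unfoldAt e u b) → k r (eqAt (view e u))
  where
    view : ∀ {Ψ} {A' F : Fm Ψ} {M N} → A' ≡ k2 equiv M N → Unfold A' F → M ≡ N
    view refl (unused ())
    view refl equiv-refl = refl

data ElementView (w : World) : Nf (cx w) Atm → Nf (cx w) AL → Set₁ where
  v-here  : ElementView w X (X :: L)
  v-there : w ⊨ fm (k2 element X L) → ElementView w X (Y :: L)

data ElementAt {w w'} (r : w ⊑ w') (X : Nf (cx w) Atm) (L : Nf (cx w) AL) : Set₁ where
  elementAt : ∀ {X' L'} → X' ≡ sub (inst r) X → L' ≡ sub (inst r) L → ElementView w' X' L' → ElementAt r X L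

elementC : w ⊨ fm (k2 element X L) → Cont w (λ r → ElementAt r X L)
elementC {w} {X} {L} d k = defC (defatom element d-element _) d λ where
    r (unfoldAt refl u b) → k r (elementAt refl refl (view u b))
  where
    view : ∀ {w X L F} → Unfold (k2 element X L) F → w ⊨ fm F → ElementView w X L
    view (unused ()) b
    view element-here b = v-here
    view element-there b = v-there b

nat-s : w ⊨ natG n → w ⊨ natG (sN n)
nat-s ⊢⌊ d ⌋ = ⊢⌊ nats d ⌋

nat-z : w ⊨ natG zN
nat-z = ⊢⌊ natz ⌋

-- The calculus inverts `nat` only by induction. The invariant is ∀j (n = s j ⊃ nat j), with the
-- defined equality on `nt`; its step uses the typing of the index and not the induction hypothesis.
nat-pred : w ⊨ natG (sN n) → w ⊨ natG n
nat-pred {w} {n} d = nat-induction (all ofnt (fm (k2 eqnt #1 (sN #0)) ⊃ᶜ at (natG #0)))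
    (λ j e → defC (defatom eqnt d-eqnt _) e λ { r (unfoldAt refl (unused ()) b) })
    (λ {w} {n} dn ih j e → defC (defatom eqnt d-eqnt _) e λ { r (unfoldAt q u b) → subst (λ m → _ ⊨ natG m) (view q u) (tr r dn) })
    d n (defI (# 0) (sN n ▸ ∅) refl ⊤I)
  where
    view : ∀ {Ψ} {A' F : Fm Ψ} {m m'} → A' ≡ k2 eqnt (sN m) (sN m') → Unfold A' F → m ≡ m'
    view refl (unused ())
    view refl eqnt-refl = refl

ofatm : OFree Atm
ofatm = ofb _

-- Comparing seq at two indices

-- Indices are compared by what they derive and not by their numerical order, which avoids all
-- arithmetic.
SeqLe : (w : World) → Nf (cx w) Nt → Nf (cx w) Nt → Set₁
SeqLe w n k = ∀ {w'} (r : w ⊑ w') L B → w' ⊨ seqG (sub (inst r) n) L B → w' ⊨ seqG (sub (inst r) k) L B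

leᶜ : Nf Δ Nt → Nf Δ Nt → Code Δ
leᶜ n k = all ofatmlst (all ofprp (seqG (wk (wk n)) #1 #0 ⊃ᶜ at (seqG (wk (wk k)) #1 #0)))

SeqLe-tr : (r : w ⊑ w') → SeqLe w n k → SeqLe w' (sub (inst r) n) (sub (inst r) k)
SeqLe-tr {n = n} {k} r f r' L B = subst₂ (λ a b → _ ⊨ seqG a L B → _ ⊨ seqG b L B)
  (sym (sub-∘ (inst r) (inst r') n)) (sym (sub-∘ (inst r) (inst r') k)) (f (⊑-trans r r') L B)

SeqLe-at : SeqLe w n k → w ⊨ seqG n L B → w ⊨ seqG k L B
SeqLe-at {n = n} {k} {L = L} {B} f = subst₂ (λ a b → _ ⊨ seqG a L B → _ ⊨ seqG b L B) (sub-id n) (sub-id k) (f ⊑-refl L B)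

SeqLe-trans : SeqLe w n k → SeqLe w k j → SeqLe w n j
SeqLe-trans f g r L B d = g r L B (f r L B d)

-- A clause with `seq` in its body lowers the index by exactly one, and the axiom and `tt` clauses
-- accept any index.
SeqLe-suc : SeqLe w n k → SeqLe w (sN n) (sN k)
SeqLe-suc {n = n} {k} f r L B d = seqC d λ where
    r' (seqAt e refl refl v) → view (SeqLe-tr {n = sub (inst r) n} {sub (inst r) k} r' (SeqLe-tr {n = n} {k} r f)) e v
  where
    view : ∀ {w n' n k L B} → SeqLe w n k → n' ≡ sN n → SeqView w n' L B → w ⊨ seqG (sN k) L B
    view f e (v-ax x) = ax x
    view f e v-tt = ttI
    view f refl (v-and x y) = andI (SeqLe-at f x) (SeqLe-at f y)
    view f refl (v-imp x) = impI (SeqLe-at f x)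
    view f refl (v-big g) = bigI λ r N → f r _ _ (g r N)
    view f refl (v-bc q x) = bcI q (SeqLe-at f x)

seq-mono : w ⊨ natG n → SeqLe w n (sN n)
seq-mono d r = nat-induction (leᶜ #0 (sN #0))
  (λ L B d → seqC d λ { r (seqAt e refl refl v) → base e v })
  (λ {w} {n} dn ih L B → SeqLe-at {k = sN (sN n)} (SeqLe-suc {n = n} {sN n} ih))
  (tr r d)
  where
    base : ∀ {w n L B} → n ≡ zN → SeqView w n L B → w ⊨ seqG (sN zN) L B
    base e (v-ax x) = ax x
    base e v-tt = ttI
    base () (v-and x y)
    base () (v-imp x)
    base () (v-big g)
    base () (v-bc q x)

seq-zero : w ⊨ natG k → SeqLe w zN k
seq-zero d r = nat-induction (leᶜ zN #0)
  (λ L B d → d)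
  (λ {w} {n} dn ih L B d → SeqLe-at (seq-mono dn) (SeqLe-at {n = zN} {n} ih d))
  (tr r d)

seq-up : w ⊨ natG (sN n) → w ⊨ seqG n L B → w ⊨ seqG (sN n) L B
seq-up d = SeqLe-at (seq-mono (nat-pred d))

-- Inversion lands at the predecessor; raising the result back to `n` keeps all components at one
-- index, where an induction hypothesis for `n` applies to each.
seq-andE₁ : w ⊨ natG n → w ⊨ seqG n L (B & C) → w ⊨ seqG n L B
seq-andE₁ {w} {n} {L} {B} {C} dn d = seqC d λ { r (seqAt e refl e' v) → view (subst (λ m → _ ⊨ natG m) (sym e) (tr r dn)) e e' v }
  where
    view : ∀ {w n n' L B B' C'} → w ⊨ natG n → n ≡ n' → B ≡ (B' & C') → SeqView w n L B → w ⊨ seqG n' L B'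
    view dn refl refl (v-and x y) = seq-up dn x

seq-andE₂ : w ⊨ natG n → w ⊨ seqG n L (B & C) → w ⊨ seqG n L C
seq-andE₂ {w} {n} {L} {B} {C} dn d = seqC d λ { r (seqAt e refl e' v) → view (subst (λ m → _ ⊨ natG m) (sym e) (tr r dn)) e e' v }
  where
    view : ∀ {w n n' L B B' C'} → w ⊨ natG n → n ≡ n' → B ≡ (B' & C') → SeqView w n L B → w ⊨ seqG n' L C'
    view dn refl refl (v-and x y) = seq-up dn y

seq-impE : w ⊨ natG n → w ⊨ seqG n L (k2 imp A B) → w ⊨ seqG n (A :: L) B
seq-impE {w} {n} {L} {A} {B} dn d = seqC d λ { r (seqAt e refl e' v) → view (subst (λ m → _ ⊨ natG m) (sym e) (tr r dn)) e e' v }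
  where
    view : ∀ {w n n' L B A' B'} → w ⊨ natG n → n ≡ n' → B ≡ k2 imp A' B' → SeqView w n L B → w ⊨ seqG n' (A' :: L) B'
    view dn refl refl (v-imp x) = seq-up dn x

seq-bigE : ∀ {R} → w ⊨ natG n → w ⊨ seqG n L (k1 bigand R) → (N : Nf (cx w) I') → w ⊨ seqG n L (R ·₁ N)
seq-bigE {w} {n} {L} {R} dn d N = seqC d λ { r (seqAt e refl e' v) → subst (λ D → _ ⊨ seqG _ _ D) (sym (sub-·₁ (inst r) R N))
      (view (subst (λ m → _ ⊨ natG m) (sym e) (tr r dn)) e e' v (sub (inst r) N)) }
  where
    view : ∀ {w n n' L B R'} → w ⊨ natG n → n ≡ n' → B ≡ k1 bigand R' → SeqView w n L B → ∀ N → w ⊨ seqG n' L (R' ·₁ N)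
    view {w} {L = L} {R' = R'} dn refl refl (v-big {n = n} g) N = seq-up dn
      (subst (λ R → w ⊨ seqG n L (R ·₁ N)) (sub-id R')
        (subst₂ (λ a b → w ⊨ seqG a b (sub nvar R' ·₁ N)) (sub-id n) (sub-id L) (g ⊑-refl N)))

-- Upper bounds of indices, with the existential quantifier Church-encoded over the goals ⊢ P

upper-kᶜ : Code (Prp ∷ Nt ∷ Nt ∷ [])
upper-kᶜ = all ofnt (natG #0 ⊃ᶜ leᶜ #3 #0 ⊃□ leᶜ #2 #0 ⊃□ at (hold #1))

upperᶜ : Code (Nt ∷ [])
upperᶜ = all ofnt (natG #0 ⊃ᶜ all ofprp (upper-kᶜ ⊃□ at (hold #0)))

-- The bound is in effect n + k: it starts at `k` and grows by one with each successor of `n`. It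
-- serves `hold-and`, since the clause for `&` wants both conjuncts at one index.
upper : w ⊨ natG n → ⟦ upperᶜ ⟧ w (n ▸ ∅)
upper = nat-induction upperᶜ
  (λ k dk P c → □-here upper-kᶜ {P ▸ k ▸ zN ▸ ∅} c k dk (seq-zero dk) (λ r L B d → d))
  (λ {w} {n} dn ih k dk P c → □-here upperᶜ {n ▸ ∅} ih k dk P λ r j dj f g →
    c r (sN j) (nat-s dj) (SeqLe-suc {n = sub (inst r) n} {j} f) (SeqLe-trans {n = sub (inst r) k} {j} {sN j} g (seq-mono dj)))

hold-and : w ⊨ hold B → w ⊨ hold C → w ⊨ hold (B & C)
hold-and {B = B} {C} d e = holdC d λ r (n , dn , x) → holdC (tr r e) λ r' (k , dk , y) →
  upper (tr r' dn) k dk _ λ r'' j dj f g →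
    holdI (nat-s dj) (andI (SeqLe-at f (tr r'' (tr r' x))) (SeqLe-at g (tr r'' y)))

-- Weakening and cut for the object logic

-- The axiom clause asks for a list of the form `A' :: L`; inverting the membership exposes one.
ax-element : w ⊨ fm (k2 element A L) → w ⊨ seqG n L ⟨ A ⟩
ax-element {w} {A} {L} {n} d = elementC d λ { r (elementAt refl refl v) → view refl refl v }
  where
    view : ∀ {w X X' L L' n} → X ≡ X' → L ≡ L' → ElementView w X L → w ⊨ seqG n L' ⟨ X' ⟩
    view refl refl v-here = ax hereI
    view refl refl (v-there x) = ax (thereI x)

Incl : (w : World) → Nf (cx w) AL → Nf (cx w) AL → Set₁
Incl w L L' = ∀ {w'} (r : w ⊑ w') X → w' ⊨ fm (k2 element X (sub (inst r) L)) → w' ⊨ fm (k2 element X (sub (inst r) L'))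

inclᶜ : Nf Δ AL → Nf Δ AL → Code Δ
inclᶜ L L' = all ofatm (fm (k2 element #0 (wk L)) ⊃ᶜ at (fm (k2 element #0 (wk L'))))

Incl-tr : (r : w ⊑ w') → Incl w L L' → Incl w' (sub (inst r) L) (sub (inst r) L')
Incl-tr {L = L} {L'} r f r' X = subst₂ (λ a b → _ ⊨ fm (k2 element X a) → _ ⊨ fm (k2 element X b))
  (sym (sub-∘ (inst r) (inst r') L)) (sym (sub-∘ (inst r) (inst r') L')) (f (⊑-trans r r') X)

Incl-at : Incl w L L' → w ⊨ fm (k2 element X L) → w ⊨ fm (k2 element X L')
Incl-at {L = L} {L'} {X = X} f = subst₂ (λ a b → _ ⊨ fm (k2 element X a) → _ ⊨ fm (k2 element X b)) (sub-id L) (sub-id L') (f ⊑-refl X)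

Incl-cons : Incl w L L' → Incl w (A :: L) (A :: L')
Incl-cons {L = L} {L'} {A} f r X d = elementC d λ { r' (elementAt e e' v) → view
    (Incl-tr {L = sub (inst r) L} {sub (inst r) L'} r' (Incl-tr {L = L} {L'} r f)) e e' v }
  where
    view : ∀ {w X X' L₀ A L L'} → Incl w L L' → X ≡ X' → L₀ ≡ A :: L → ElementView w X L₀ → w ⊨ fm (k2 element X' (A :: L'))
    view f refl refl v-here = hereI
    view {L = L} {L'} f refl refl (v-there x) = thereI (Incl-at {L = L} {L'} f x)

weakᶜ : Code (Nt ∷ [])
weakᶜ = all ofatmlst (all ofatmlst (inclᶜ #1 #0 ⊃□ all ofprp (seqG #3 #2 #0 ⊃ᶜ at (seqG #3 #1 #0))))

-- Stated for arbitrary inclusions so that the case of ⇒, which extends both lists by the same atom,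
-- is again an instance.
seq-weaken : w ⊨ natG n → ⟦ weakᶜ ⟧ w (n ▸ ∅)
seq-weaken = nat-induction weakᶜ
  (λ L L' f B d → seqC d λ { r (seqAt e refl refl v) → base (Incl-tr {L = L} {L'} r f) e v })
  (λ {w} {n} dn ih L L' f B d → seqC d λ { r (seqAt e refl refl v) → view {n = sub (inst r) n} (□-tr weakᶜ {n ▸ ∅} r ih) (Incl-tr {L = L} {L'} r f) e v })
  where
    base : ∀ {w n' L L' B} → Incl w L L' → n' ≡ zN → SeqView w n' L B → w ⊨ seqG zN L' B
    base {L' = L'} f e (v-ax x) = ax-element (Incl-at {L' = L'} f x)
    base f e v-tt = ttI
    base f () (v-and x y)
    base f () (v-imp x)
    base f () (v-big g)
    base f () (v-bc q x)

    view : ∀ {w n' n L L' B} → □ weakᶜ w (n ▸ ∅) → Incl w L L' → n' ≡ sN n → SeqView w n' L B → w ⊨ seqG (sN n) L' B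
    view {L' = L'} ih f e (v-ax x) = ax-element (Incl-at {L' = L'} f x)
    view ih f e v-tt = ttI
    view {n = n} {L} {L'} ih f refl (v-and x y) =
      andI (□-here weakᶜ {n ▸ ∅} ih L L' f _ x) (□-here weakᶜ {n ▸ ∅} ih L L' f _ y)
    view {n = n} {L} {L'} ih f refl (v-imp {A = A} x) =
      impI (□-here weakᶜ {n ▸ ∅} ih _ _ (Incl-cons {L = L} {L'} {A} f) _ x)
    view {n = n} {L} {L'} ih f refl (v-big g) = bigI λ r N → ih r _ _ (Incl-tr {L = L} {L'} r f) _ (g r N)
    view {n = n} {L} {L'} ih f refl (v-bc q x) = bcI q (□-here weakᶜ {n ▸ ∅} ih L L' f _ x)

seq-cons : w ⊨ natG n → w ⊨ seqG n L B → w ⊨ seqG n (A :: L) B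
seq-cons {L = L} {A = A} dn d = seq-weaken dn L (A :: L) (λ r X x → thereI x) _ d

Derives : (w : World) → Nf (cx w) Nt → Nf (cx w) AL → Nf (cx w) AL → Set₁
Derives w j L L' = ∀ {w'} (r : w ⊑ w') X → w' ⊨ fm (k2 element X (sub (inst r) L)) → w' ⊨ seqG (sub (inst r) j) (sub (inst r) L') ⟨ X ⟩

derivesᶜ : Nf Δ Nt → Nf Δ AL → Nf Δ AL → Code Δ
derivesᶜ j L L' = all ofatm (fm (k2 element #0 (wk L)) ⊃ᶜ at (seqG (wk j) (wk L') ⟨ #0 ⟩))

cut-bodyᶜ : Nf Δ Nt → Nf Δ Nt → Nf Δ Nt → Code Δ
cut-bodyᶜ n j k = all ofatmlst (all ofatmlst (derivesᶜ (wk (wk j)) #1 #0 ⊃□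
  all ofprp (seqG (wk (wk (wk n))) #2 #0 ⊃ᶜ at (seqG (wk (wk (wk k))) #1 #0))))

CutBody : (w : World) → Nf (cx w) Nt → Nf (cx w) Nt → Nf (cx w) Nt → Set₁
CutBody w n j k = ∀ {w'} (r : w ⊑ w') L L' → Derives w' (sub (inst r) j) L L' → ∀ B →
  w' ⊨ seqG (sub (inst r) n) L B → w' ⊨ seqG (sub (inst r) k) L' B

CutBody-here : CutBody w n j k → Derives w j L L' → w ⊨ seqG n L B → w ⊨ seqG k L' B
CutBody-here {n = n} {j} {k} {L} {L'} {B} f g d = □-here (cut-bodyᶜ #0 #1 #2) {n ▸ j ▸ k ▸ ∅} f L L' g B d

CutBody-tr : (r : w ⊑ w') → CutBody w n j k → CutBody w' (sub (inst r) n) (sub (inst r) j) (sub (inst r) k)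
CutBody-tr {n = n} {j} {k} r f = □-tr (cut-bodyᶜ #0 #1 #2) {n ▸ j ▸ k ▸ ∅} r f

Derives-here : Derives w j L L' → w ⊨ fm (k2 element X L) → w ⊨ seqG j L' ⟨ X ⟩
Derives-here {j = j} {L} {L'} {X} f d = □-here (derivesᶜ #0 #1 #2) {j ▸ L ▸ L' ▸ ∅} f X d

Derives-tr : (r : w ⊑ w') → Derives w j L L' → Derives w' (sub (inst r) j) (sub (inst r) L) (sub (inst r) L')
Derives-tr {j = j} {L} {L'} r f = □-tr (derivesᶜ #0 #1 #2) {j ▸ L ▸ L' ▸ ∅} r f

Derives-cons : w ⊨ natG j → Derives w j L L' → Derives w j (A :: L) (A :: L')
Derives-cons {j = j} {L} {L'} {A} dj f r X d = elementC d λ { r' (elementAt e e' v) → view (tr r' (tr r dj))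
    (Derives-tr {j = sub (inst r) j} {sub (inst r) L} {sub (inst r) L'} r' (Derives-tr {j = j} {L} {L'} r f)) e e' v }
  where
    view : ∀ {w j X X' L₀ A L L'} → w ⊨ natG j → Derives w j L L' → X ≡ X' → L₀ ≡ A :: L → ElementView w X L₀ →
           w ⊨ seqG j (A :: L') ⟨ X' ⟩
    view dj f refl refl v-here = ax hereI
    view {j = j} {L = L} {L'} dj f refl refl (v-there x) = seq-cons dj (Derives-here {j = j} {L} {L'} f x)

cut-kᶜ : Code (Prp ∷ Nt ∷ Nt ∷ [])
cut-kᶜ = all ofnt (natG #0 ⊃ᶜ leᶜ #2 #0 ⊃□ cut-bodyᶜ #3 #2 #0 ⊃□ at (hold #1))

cutᶜ : Code (Nt ∷ [])
cutᶜ = all ofnt (natG #0 ⊃ᶜ all ofprp (cut-kᶜ ⊃□ at (hold #0)))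

-- The bound k is chosen before the sequent, so that it is uniform in the instances of ⋀.
seq-cut : w ⊨ natG n → ⟦ cutᶜ ⟧ w (n ▸ ∅)
seq-cut = nat-induction cutᶜ
  -- At index zero only axioms and `tt` remain; an axiom becomes its substituted derivation of index
  -- `j`, so `j` is a bound.
  (λ j dj P c → □-here cut-kᶜ {P ▸ j ▸ zN ▸ ∅} c j dj (λ r L B d → d)
    λ r L L' f B d → seqC d λ { r' (seqAt e refl refl v) →
      base (Derives-tr {j = sub (inst r) j} {L} {L'} r' f) e v })
  (λ {w} {n} dn ih j dj P c → □-here cutᶜ {n ▸ ∅} ih j dj P λ r k dk g h →
    -- The bound grows by one. That `j` stays below it is part of what is proved, because the axiom
    -- case must raise a derivation of index `j` to the bound.
    c r (sN k) (nat-s dk) (SeqLe-trans {n = sub (inst r) j} {k} {sN k} g (seq-mono dk))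
      λ r₁ L L' f B d → seqC d λ { r₂ (seqAt e refl refl v) →
        view (tr r₂ (tr r₁ (tr r dj))) (tr r₂ (tr r₁ dk))
          (SeqLe-tr {n = sub (inst r₁) (sub (inst r) j)} {sub (inst r₁) k} r₂ (SeqLe-tr {n = sub (inst r) j} {k} r₁ g))
          (CutBody-tr {n = sub (inst r₁) (sub (inst r) n)} {sub (inst r₁) (sub (inst r) j)} {sub (inst r₁) k} r₂
            (CutBody-tr {n = sub (inst r) n} {sub (inst r) j} {k} r₁ h))
          (Derives-tr {j = sub (inst r₁) (sub (inst r) j)} {L} {L'} r₂ f) e v })
  where
    base : ∀ {w n' j L L' B} → Derives w j L L' → n' ≡ zN → SeqView w n' L B → w ⊨ seqG j L' B
    base {j = j} {L} {L'} f e (v-ax x) = Derives-here {j = j} {L} {L'} f x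
    base f e v-tt = ttI
    base f () (v-and x y)
    base f () (v-imp x)
    base f () (v-big g)
    base f () (v-bc q x)

    view : ∀ {w n n' j k L L' B} → w ⊨ natG j → w ⊨ natG k → SeqLe w j k → CutBody w n j k → Derives w j L L' →
           n' ≡ sN n → SeqView w n' L B → w ⊨ seqG (sN k) L' B
    view {j = j} {k} {L} {L'} dj dk g h f e (v-ax x) =
      SeqLe-at (seq-mono dk) (SeqLe-at {n = j} {k} g (Derives-here {j = j} {L} {L'} f x))
    view dj dk g h f e v-tt = ttI
    view {n = n} {j = j} {k} {L} {L'} dj dk g h f refl (v-and x y) =
      andI (CutBody-here {n = n} {j} {k} {L} {L'} h f x) (CutBody-here {n = n} {j} {k} {L} {L'} h f y)
    view {n = n} {j = j} {k} {L} {L'} dj dk g h f refl (v-imp {A = A} x) =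
      impI (CutBody-here {n = n} {j} {k} {A :: L} {A :: L'} h (Derives-cons {j = j} {L} {L'} {A} dj f) x)
    view {j = j} {L = L} {L'} dj dk g h f refl (v-big l) =
      bigI λ r N → h r _ _ (Derives-tr {j = j} {L} {L'} r f) _ (l r N)
    view {n = n} {j = j} {k} {L} {L'} dj dk g h f refl (v-bc q x) = bcI q (CutBody-here {n = n} {j} {k} {L} {L'} h f x)

-- Derivability from no hypotheses

hold-tt : w ⊨ hold (k0 tt)
hold-tt = holdI nat-z ttI

hold-and₁ : w ⊨ hold (B & C) → w ⊨ hold B
hold-and₁ d = holdC d λ r (n , dn , x) → holdI dn (seq-andE₁ dn x)

hold-and₂ : w ⊨ hold (B & C) → w ⊨ hold C
hold-and₂ d = holdC d λ r (n , dn , x) → holdI dn (seq-andE₂ dn x)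

hold-rule : Rule A B → w ⊨ hold B → w ⊨ hold ⟨ A ⟩
hold-rule q d = holdC d λ r (n , dn , x) → holdI (nat-s dn) (seq-prog (tr r (Rule⇒prog q)) x)

¬element-nil : w ⊨ fm (k2 element X nilL) → {G : Goal (cx w)} → w ⊨ G
¬element-nil d = elementC d λ { r (elementAt e e' v) → view e' v }
  where
    view : ∀ {w X L} {S : Set₁} → L ≡ nilL → ElementView w X L → S
    view () v-here
    view () (v-there x)

Derives-single : w ⊨ seqG j nilL ⟨ A ⟩ → Derives w j (A :: nilL) nilL
Derives-single y r X d = elementC d λ { r' (elementAt e e' v) → view (tr r' (tr r y)) e e' v }
  where
    view : ∀ {w j X X' A L} → w ⊨ seqG j nilL ⟨ A ⟩ → X ≡ X' → L ≡ A :: nilL → ElementView w X L → w ⊨ seqG j nilL ⟨ X' ⟩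
    view y refl refl v-here = y
    view y refl refl (v-there x) = ¬element-nil x

hold-cut : w ⊨ hold (k2 imp A B) → w ⊨ hold ⟨ A ⟩ → w ⊨ hold B
hold-cut {A = A} {B} d e = holdC d λ r (n , dn , x) → holdC (tr r e) λ r' (j , dj , y) →
  seq-cut (tr r' dn) j dj _ λ r'' k dk g h → holdI dk (CutBody-here {n = sub (inst r'') (sub (inst r') n)} {sub (inst r'') j} {k}
    h (Derives-single (tr r'' y)) (tr r'' (tr r' (seq-impE dn x))))

hold-big : ∀ {R} → w ⊨ hold (k1 bigand R) → (N : Nf (cx w) I') → w ⊨ hold (R ·₁ N)
hold-big {R = R} d N = holdC d λ r (n , dn , x) →
  holdI dn (subst (λ D → _ ⊨ seqG n nilL D) (sym (sub-·₁ (inst r) R N)) (seq-bigE dn x (sub (inst r) N)))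

data HoldAt {w w'} (r : w ⊑ w') (A : Nf (cx w) Atm) : Set₁ where
  holdAt : ∀ {A' B} → A' ≡ sub (inst r) A → Rule A' B → w' ⊨ hold B → HoldAt r A

-- The axiom clause needs a nonempty list, so without hypotheses only backchaining is left.
-- `nat-pred` types the index of its premise, which makes that premise derivable in the sense of
-- `hold`.
hold-atomC : w ⊨ hold ⟨ A ⟩ → Cont w (λ r → HoldAt r A)
hold-atomC {w} {A} d = _>>=_ {X = λ {w'} r → Σ[ n ∈ Nf (cx w') Nt ] (w' ⊨ natG n × w' ⊨ seqG n nilL ⟨ sub (inst r) A ⟩)}
  (holdC d) λ r (n , dn , x) k → seqC x λ where
    r' (seqAt e e' e'' v) → k r' (view {r = r} {r'} (sub-∘ (inst r) (inst r') A) (tr r' dn) e e' e'' v)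
  where
    view : ∀ {w' w'' A' n n' L B} {r : w ⊑ w'} {r' : w' ⊑ w''} → A' ≡ sub (inst (⊑-trans r r')) A → w'' ⊨ natG n → n' ≡ n →
           L ≡ nilL → B ≡ ⟨ A' ⟩ → SeqView w'' n' L B → HoldAt (⊑-trans r r') A
    view e dn refl () refl (v-ax x)
    view e dn refl refl refl (v-bc q x) = holdAt e q (holdI (nat-pred dn) x)

-- Induction principles for object-level judgements

renG : Ren Γ Δ → Goal Γ → Goal Δ
renG ρ (fm F) = fm (renNf ρ F)
renG ρ (hold B) = hold (renNf ρ B)

subG-ren : (θ : Sub Ψ Δ) (ρ : Ren Γ Δ) (G : Goal Γ) → subG θ (renG ρ G) ≡ subG (λ x → θ (ρ x)) G
subG-ren θ ρ (fm F) = cong fm (sub-ren θ ρ F)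
subG-ren θ ρ (hold B) = cong hold (sub-ren θ ρ B)

-- Moves a property of object terms into an invariant whose context also contains the index.
renC : Ren Γ Δ → Code Γ → Code Δ
renC ρ (at G) = at (renG ρ G)
renC ρ (G ⊃ᶜ B) = renG ρ G ⊃ᶜ renC ρ B
renC ρ (B ⊃□ C) = renC ρ B ⊃□ renC ρ C
renC ρ (all p B) = all p (renC (liftR ρ) B)

mutual
  ⟦renC⟧⇒ : (ρ : Ren Γ Δ) (B : Code Γ) {θ : Sub (cx w) Δ} → ⟦ renC ρ B ⟧ w θ → ⟦ B ⟧ w (λ x → θ (ρ x))
  ⟦renC⟧⇒ ρ (at G) {θ} d = subst (_ ⊨_) (subG-ren θ ρ G) d
  ⟦renC⟧⇒ ρ (G ⊃ᶜ B) {θ} f g = ⟦renC⟧⇒ ρ B (f (subst (_ ⊨_) (sym (subG-ren θ ρ G)) g))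
  ⟦renC⟧⇒ ρ (B ⊃□ C) f g = ⟦renC⟧⇒ ρ C (f λ r → ⟦renC⟧⇐ ρ B (g r))
  ⟦renC⟧⇒ ρ (all p B) f t = ⟦⟧-cong B (λ { vz → refl ; (vs x) → refl }) (⟦renC⟧⇒ (liftR ρ) B (f t))

  ⟦renC⟧⇐ : (ρ : Ren Γ Δ) (B : Code Γ) {θ : Sub (cx w) Δ} → ⟦ B ⟧ w (λ x → θ (ρ x)) → ⟦ renC ρ B ⟧ w θ
  ⟦renC⟧⇐ ρ (at G) {θ} d = subst (_ ⊨_) (sym (subG-ren θ ρ G)) d
  ⟦renC⟧⇐ ρ (G ⊃ᶜ B) {θ} f g = ⟦renC⟧⇐ ρ B (f (subst (_ ⊨_) (subG-ren θ ρ G) g))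
  ⟦renC⟧⇐ ρ (B ⊃□ C) f g = ⟦renC⟧⇐ ρ C (f λ r → ⟦renC⟧⇒ ρ B (g r))
  ⟦renC⟧⇐ ρ (all p B) f t = ⟦renC⟧⇐ (liftR ρ) B (⟦⟧-cong B (λ { vz → refl ; (vs x) → refl }) (f t))

-- Every code ends in a goal. Its arguments and antecedents are carried to the extended world, and
-- the continuation runs once the goal is reached.
Cont-code : {X : ∀ {w'} → w ⊑ w' → Set₁} (B : Code Δ) {θ : Sub (cx w) Δ} → Cont w X →
            (∀ {w'} (r : w ⊑ w') → X r → ⟦ B ⟧ w' (θ ⊙ inst r)) → ⟦ B ⟧ w θ
Cont-code (at G) {θ} c k = c λ r x → subst (_ ⊨_) (sym (subG-∘ θ (inst r) G)) (k r x)
Cont-code {X = X} (G ⊃ᶜ B) {θ} c k g = Cont-code {X = X} B c λ r x → k r x (subst (_ ⊨_) (subG-∘ θ (inst r) G) (tr r g))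
Cont-code {X = X} (A ⊃□ B) {θ} c k a = Cont-code {X = X} B c λ r x → k r x (□-tr A {θ} r a)
Cont-code {X = X} (all p B) {θ} c k t = Cont-code {X = X} B c λ r x → ⟦⟧-cong B (λ { vz → refl ; (vs y) → refl }) (k r x (sub (inst r) t))

IH₁ : NonLog (I' ⇒ Atm) → Code (I' ∷ []) → (w : World) → Nf (cx w) Nt → Set₁
IH₁ p G w n = ∀ {w'} (r : w ⊑ w') {m} → w' ⊨ seqG (sub (inst r) n) nilL ⟨ k1 p m ⟩ → ⟦ G ⟧ w' (m ▸ ∅)

IH₂ : NonLog (I' ⇒ I' ⇒ Atm) → Code (I' ∷ I' ∷ []) → (w : World) → Nf (cx w) Nt → Set₁
IH₂ p G w n = ∀ {w'} (r : w ⊑ w') {m v} → w' ⊨ seqG (sub (inst r) n) nilL ⟨ k2 p m v ⟩ → ⟦ G ⟧ w' (m ▸ v ▸ ∅)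

data RuleView (w : World) (n : Nf (cx w) Nt) (A : Nf (cx w) Atm) : Set₁ where
  ruleView : ∀ {n' B} → n ≡ sN n' → Rule A B → w ⊨ seqG n' nilL B → RuleView w n A

rule-view : ∀ {n' L A' B} → SeqView w n' L B → n' ≡ n → L ≡ nilL → B ≡ ⟨ A' ⟩ → RuleView w n A'
rule-view (v-ax x) refl () refl
rule-view (v-bc q x) refl refl refl = ruleView refl q x

module _ (p : NonLog (I' ⇒ I' ⇒ Atm)) (G : Code (I' ∷ I' ∷ [])) where
  private
    keep : Ren (I' ∷ I' ∷ []) (I' ∷ I' ∷ Nt ∷ [])
    keep vz = vz
    keep (vs vz) = vs vz

    Gᶜ : Code (Nt ∷ [])
    Gᶜ = all ofi (all ofi (seqG #2 nilL ⟨ k2 p #0 #1 ⟩ ⊃ᶜ renC keep G))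

    env : {θ : Sub (cx w) (I' ∷ I' ∷ Nt ∷ [])} → ⟦ G ⟧ w (θ vz ▸ θ (vs vz) ▸ ∅) → ⟦ renC keep G ⟧ w θ
    env {θ = θ} g = ⟦renC⟧⇐ keep G (⟦⟧-cong G (λ { vz → refl ; (vs vz) → refl }) g)

  -- The hypothesis `IH₂` speaks of every `p`-atom derivable at the index `n` of the rule's body. A
  -- conjunctive body splits at that same index by `seq-andE₁` and `seq-andE₂`, so each conjunct is
  -- covered.
  induction₂ : (∀ {w n m v B} → w ⊨ natG n → Rule (k2 p m v) B → w ⊨ seqG n nilL B → IH₂ p G w n → ⟦ G ⟧ w (m ▸ v ▸ ∅)) →
               ∀ {w m v} → w ⊨ hold ⟨ k2 p m v ⟩ → ⟦ G ⟧ w (m ▸ v ▸ ∅)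
  induction₂ closed {w} {m} {v} d = Cont-code {X = λ {w'} r → Σ[ n ∈ Nf (cx w') Nt ] (w' ⊨ natG n × w' ⊨ seqG n nilL ⟨ k2 p (sub (inst r) m) (sub (inst r) v) ⟩)}
      G (holdC d) λ r (n , dn , x) → ⟦⟧-cong G (λ { vz → refl ; (vs vz) → refl }) (⟦renC⟧⇒ keep G (seqs dn _ _ x))
    where
      seqs : ∀ {w n} → w ⊨ natG n → ⟦ Gᶜ ⟧ w (n ▸ ∅)
      seqs = nat-induction Gᶜ
        (λ v m x → Cont-code {X = λ r → SeqAt r zN nilL ⟨ k2 p m v ⟩} (renC keep G) (seqC x) λ where
          r (seqAt e₁ e₂ e₃ u) → case-z (rule-view u e₁ e₂ e₃))
        (λ {w} {n} dn ih v m x → Cont-code {X = λ r → SeqAt r (sN n) nilL ⟨ k2 p m v ⟩} (renC keep G) (seqC x) λ where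
          r (seqAt e₁ e₂ e₃ u) → env (case-s (tr r dn)
            (λ r' y → ⟦⟧-cong G (λ { vz → refl ; (vs vz) → refl })
               (⟦renC⟧⇒ keep G (□-tr Gᶜ {n ▸ ∅} r ih r' _ _ y)))
            (rule-view u e₁ e₂ e₃)))
        where
          case-z : ∀ {w A} {S : Set₁} → RuleView w zN A → S
          case-z (ruleView () q x)

          case-s : ∀ {w n m v} → w ⊨ natG n → IH₂ p G w n → RuleView w (sN n) (k2 p m v) → ⟦ G ⟧ w (m ▸ v ▸ ∅)
          case-s dn ih (ruleView refl q x) = closed dn q x ih

module _ (p : NonLog (I' ⇒ Atm)) (G : Code (I' ∷ [])) where
  private
    keep : Ren (I' ∷ []) (I' ∷ Nt ∷ [])
    keep vz = vz

    Gᶜ : Code (Nt ∷ [])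
    Gᶜ = all ofi (seqG #1 nilL ⟨ k1 p #0 ⟩ ⊃ᶜ renC keep G)

  induction₁ : (∀ {w n m B} → w ⊨ natG n → Rule (k1 p m) B → w ⊨ seqG n nilL B → IH₁ p G w n → ⟦ G ⟧ w (m ▸ ∅)) →
               ∀ {w m} → w ⊨ hold ⟨ k1 p m ⟩ → ⟦ G ⟧ w (m ▸ ∅)
  induction₁ closed {w} {m} d = Cont-code {X = λ {w'} r → Σ[ n ∈ Nf (cx w') Nt ] (w' ⊨ natG n × w' ⊨ seqG n nilL ⟨ k1 p (sub (inst r) m) ⟩)}
      G (holdC d) λ r (n , dn , x) → ⟦⟧-cong G (λ { vz → refl }) (⟦renC⟧⇒ keep G (seqs dn _ x))
    where
      seqs : ∀ {w n} → w ⊨ natG n → ⟦ Gᶜ ⟧ w (n ▸ ∅)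
      seqs = nat-induction Gᶜ
        (λ m x → Cont-code {X = λ r → SeqAt r zN nilL ⟨ k1 p m ⟩} (renC keep G) (seqC x) λ where
          r (seqAt e₁ e₂ e₃ u) → case-z (rule-view u e₁ e₂ e₃))
        (λ {w} {n} dn ih m x → Cont-code {X = λ r → SeqAt r (sN n) nilL ⟨ k1 p m ⟩} (renC keep G) (seqC x) λ where
          r (seqAt e₁ e₂ e₃ u) → ⟦renC⟧⇐ keep G (⟦⟧-cong G (λ { vz → refl }) (case-s (tr r dn)
            (λ r' y → ⟦⟧-cong G (λ { vz → refl }) (⟦renC⟧⇒ keep G (□-tr Gᶜ {n ▸ ∅} r ih r' _ y)))
            (rule-view u e₁ e₂ e₃))))
        where
          case-z : ∀ {w A} {S : Set₁} → RuleView w zN A → S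
          case-z (ruleView () q x)

          case-s : ∀ {w n m} → w ⊨ natG n → IH₁ p G w n → RuleView w (sN n) (k1 p m) → ⟦ G ⟧ w (m ▸ ∅)
          case-s dn ih (ruleView refl q x) = closed dn q x ih

data Cases₁ {w w'} (r : w ⊑ w') (p : NonLog (I' ⇒ Atm)) (m : Nf (cx w) I') : Set₁ where
  cs₁ : ∀ {m' B} → m' ≡ sub (inst r) m → Rule (k1 p m') B → w' ⊨ hold B → Cases₁ r p m

data Cases₂ {w w'} (r : w ⊑ w') (p : NonLog (I' ⇒ I' ⇒ Atm)) (m v : Nf (cx w) I') : Set₁ where
  cs : ∀ {m' v' B} → m' ≡ sub (inst r) m → v' ≡ sub (inst r) v → Rule (k2 p m' v') B → w' ⊨ hold B → Cases₂ r p m v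

cases₁ : ∀ {p} → w ⊨ hold ⟨ k1 p m ⟩ → Cont w (λ r → Cases₁ r p m)
cases₁ d k = hold-atomC d λ { r (holdAt refl q h) → k r (cs₁ refl q h) }

cases₂ : ∀ {p} → w ⊨ hold ⟨ k2 p m v ⟩ → Cont w (λ r → Cases₂ r p m v)
cases₂ d k = hold-atomC d λ { r (holdAt refl q h) → k r (cs refl refl q h) }

IH₂-tr : ∀ {p} (G : Code (I' ∷ I' ∷ [])) (r : w ⊑ w') → IH₂ p G w n → IH₂ p G w' (sub (inst r) n)
IH₂-tr {n = n} G r ih r' y = ih (⊑-trans r r') (subst (λ a → _ ⊨ seqG a nilL _) (sub-∘ (inst r) (inst r') n) y)

IH₂-here : ∀ {p} (G : Code (I' ∷ I' ∷ [])) → IH₂ p G w n → w ⊨ seqG n nilL ⟨ k2 p m v ⟩ → ⟦ G ⟧ w (m ▸ v ▸ ∅)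
IH₂-here {n = n} G ih y = ih ⊑-refl (subst (λ a → _ ⊨ seqG a nilL _) (sym (sub-id n)) y)

IH₁-here : ∀ {p} (G : Code (I' ∷ [])) → IH₁ p G w n → w ⊨ seqG n nilL ⟨ k1 p m ⟩ → ⟦ G ⟧ w (m ▸ ∅)
IH₁-here {n = n} G ih y = ih ⊑-refl (subst (λ a → _ ⊨ seqG a nilL _) (sym (sub-id n)) y)

⊥E : {G : Goal (cx w)} → w ⊨ fm ⊥F → w ⊨ G
⊥E {w} ⊢⌊ d ⌋ = ⊢⌊ cut′ d ⊥L ⌋

k1-inj : {c : NonLog (I' ⇒ I')} → k1 c M ≡ k1 c N → M ≡ N
k1-inj refl = refl

k2-inj₁ : ∀ {σ} {c : NonLog (I' ⇒ σ ⇒ I')} {x y : Nf Ψ σ} → k2 c M x ≡ k2 c N y → M ≡ N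
k2-inj₁ refl = refl

k2-inj₂ : ∀ {σ} {c : NonLog (I' ⇒ σ ⇒ I')} {x y : Nf Ψ σ} → k2 c M x ≡ k2 c N y → x ≡ y
k2-inj₂ refl = refl

k3-inj₁ : ∀ {c : NonLog (I' ⇒ I' ⇒ I' ⇒ I')} → k3 c M N V ≡ k3 c M' N' U → M ≡ M'
k3-inj₁ refl = refl

hold-subst₂ : {p : NonLog (I' ⇒ I' ⇒ Atm)} → M ≡ M' → N ≡ N' → w ⊨ hold ⟨ k2 p M N ⟩ → w ⊨ hold ⟨ k2 p M' N' ⟩
hold-subst₂ refl refl d = d

-- Determinacy

det-evalᶜ : Code (I' ∷ I' ∷ [])
det-evalᶜ = all ofi (hold ⟨ #1 ⇓ #0 ⟩ ⊃ᶜ at (fm (#2 ≡F #0)))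

eval-deterministic : ∀ {w m v₁} → w ⊨ hold ⟨ m ⇓ v₁ ⟩ → ∀ v₂ → w ⊨ hold ⟨ m ⇓ v₂ ⟩ → w ⊨ fm (v₁ ≡F v₂)
eval-deterministic = induction₂ eval det-evalᶜ λ dn q x ih v₂ h → go dn q x ih v₂ h
  where
    go : ∀ {w n m v B} → w ⊨ natG n → Rule (m ⇓ v) B → w ⊨ seqG n nilL B → IH₂ eval det-evalᶜ w n →
         ∀ v₂ → w ⊨ hold ⟨ m ⇓ v₂ ⟩ → w ⊨ fm (v ≡F v₂)
    go dn ev-zero x ih v₂ h = cases₂ h λ { r (cs refl e ev-zero _) → ≡I e }
    go dn ev-true x ih v₂ h = cases₂ h λ { r (cs refl e ev-true _) → ≡I e }
    go dn ev-false x ih v₂ h = cases₂ h λ { r (cs refl e ev-false _) → ≡I e }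
    go dn ev-succ x ih v₂ h = cases₂ h λ where
      r (cs refl e ev-succ h₁) → ≡C (ih r (tr r x) _ h₁) λ where
        r' (eqAt q) → ≡I (trans (cong (k1 succ) q) (cong (sub (inst r')) e))
    go dn ev-pred-zero x ih v₂ h = cases₂ h λ where
      r (cs refl e ev-pred-zero h₁) → ≡I e
      r (cs refl e ev-pred-succ h₁) → ≡C (ih r (tr r x) _ h₁) λ { r' (eqAt ()) }
    go dn ev-pred-succ x ih v₂ h = cases₂ h λ where
      r (cs refl e ev-pred-zero h₁) → ≡C (ih r (tr r x) _ h₁) λ { r' (eqAt ()) }
      r (cs refl refl ev-pred-succ h₁) → ≡C (ih r (tr r x) _ h₁) λ { r' (eqAt q) → ≡I (k1-inj q) }
    go dn ev-is-zero-true x ih v₂ h = cases₂ h λ where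
      r (cs refl e ev-is-zero-true h₁) → ≡I e
      r (cs refl e ev-is-zero-false h₁) → ≡C (ih r (tr r x) _ h₁) λ { r' (eqAt ()) }
    go dn ev-is-zero-false x ih v₂ h = cases₂ h λ where
      r (cs refl e ev-is-zero-true h₁) → ≡C (ih r (tr r x) _ h₁) λ { r' (eqAt ()) }
      r (cs refl e ev-is-zero-false h₁) → ≡I e
    go dn ev-if-true x ih v₂ h = cases₂ h λ where
      r (cs refl refl ev-if-true h₁) → ih r (tr r (seq-andE₂ dn x)) _ (hold-and₂ h₁)
      r (cs refl refl ev-if-false h₁) → ≡C (ih r (tr r (seq-andE₁ dn x)) _ (hold-and₁ h₁)) λ { r' (eqAt ()) }
    go dn ev-if-false x ih v₂ h = cases₂ h λ where
      r (cs refl refl ev-if-true h₁) → ≡C (ih r (tr r (seq-andE₁ dn x)) _ (hold-and₁ h₁)) λ { r' (eqAt ()) }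
      r (cs refl refl ev-if-false h₁) → ih r (tr r (seq-andE₂ dn x)) _ (hold-and₂ h₁)
    go dn ev-abs x ih v₂ h = cases₂ h λ { r (cs refl e ev-abs _) → ≡I e }
    go {n = n} dn (ev-app {N = N} {R = R}) x ih v₂ h = cases₂ h λ where
      -- By induction both derivations evaluate the operator to one abstraction, so `R'` may be
      -- replaced by `R` and the second premises concern the same term.
      r (cs refl refl (ev-app {R = R'}) h₁) → ≡C (ih r (tr r (seq-andE₁ dn x)) _ (hold-and₁ h₁)) λ where
        r' (eqAt q) → IH₂-tr {n = n} det-evalᶜ r ih r' (tr r' (tr r (seq-andE₂ dn x))) _
          (hold-subst₂ (trans (sub-·₁ (inst r') R' (sub (inst r) N))
              (trans (cong (_·₁ _) (sym (k2-inj₂ q)))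
                (sym (trans (cong (sub (inst r')) (sub-·₁ (inst r) R N)) (sub-·₁ (inst r') (sub (inst r) R) (sub (inst r) N))))))
            refl (tr r' (hold-and₂ h₁)))
    go dn (ev-rec {T} {R}) x ih v₂ h = cases₂ h λ where
      r (cs refl refl ev-rec h₁) → ih r (tr r x) _ (hold-subst₂ (sym (sub-·₁ (inst r) R (k2 rec T R))) refl h₁)

no-stepᶜ : Code (I' ∷ [])
no-stepᶜ = all ofi (hold ⟨ #1 ↝ #0 ⟩ ⊃ᶜ at (fm ⊥F))

value-no-step : ∀ {w v} → w ⊨ hold ⟨ valueA v ⟩ → ∀ m → w ⊨ hold ⟨ v ↝ m ⟩ → w ⊨ fm ⊥F
value-no-step = induction₁ value no-stepᶜ λ dn q x ih m h → go dn q x ih m h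
  where
    go : ∀ {w n v B} → w ⊨ natG n → Rule (valueA v) B → w ⊨ seqG n nilL B → IH₁ value no-stepᶜ w n →
         ∀ m → w ⊨ hold ⟨ v ↝ m ⟩ → w ⊨ fm ⊥F
    go dn val-zero x ih m h = cases₂ h λ { r (cs refl e () _) }
    go dn val-true x ih m h = cases₂ h λ { r (cs refl e () _) }
    go dn val-false x ih m h = cases₂ h λ { r (cs refl e () _) }
    go dn val-succ x ih m h = cases₂ h λ { r (cs refl e st-succ h₁) → ih r (tr r x) _ h₁ }
    go dn val-abs x ih m h = cases₂ h λ { r (cs refl e () _) }

-- Rules out the overlaps between a contraction and a congruence rule on the same term: the subterm
-- that would have to move is a value.
stuck : {G : Goal (cx w)} → w ⊨ hold ⟨ valueA V ⟩ → V ≡ M → w ⊨ hold ⟨ M ↝ N ⟩ → w ⊨ G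
stuck d refl h = ⊥E (value-no-step d _ h)

zero-value : w ⊨ hold ⟨ valueA (k0 zero) ⟩
zero-value = hold-rule val-zero hold-tt

det-stepᶜ : Code (I' ∷ I' ∷ [])
det-stepᶜ = all ofi (hold ⟨ #1 ↝ #0 ⟩ ⊃ᶜ at (fm (#2 ≡F #0)))

step-deterministic : ∀ {w m v₁} → w ⊨ hold ⟨ m ↝ v₁ ⟩ → ∀ v₂ → w ⊨ hold ⟨ m ↝ v₂ ⟩ → w ⊨ fm (v₁ ≡F v₂)
step-deterministic = induction₂ step det-stepᶜ λ dn q x ih v₂ h → go dn q x ih v₂ h
  where
    go : ∀ {w n m v B} → w ⊨ natG n → Rule (m ↝ v) B → w ⊨ seqG n nilL B → IH₂ step det-stepᶜ w n →
         ∀ v₂ → w ⊨ hold ⟨ m ↝ v₂ ⟩ → w ⊨ fm (v ≡F v₂)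
    go dn st-succ x ih v₂ h = cases₂ h λ where
      r (cs refl e st-succ h₁) → ≡C (ih r (tr r x) _ h₁) λ where
        r' (eqAt q) → ≡I (trans (cong (k1 succ) q) (cong (sub (inst r')) e))
    go dn st-pred-zero x ih v₂ h = cases₂ h λ where
      r (cs refl e st-pred-zero h₁) → ≡I e
      r (cs refl e st-pred h₁) → stuck zero-value refl h₁
    go dn st-pred-succ x ih v₂ h = cases₂ h λ where
      r (cs refl e st-pred-succ h₁) → ≡I e
      r (cs refl e st-pred h₁) → stuck (hold-rule val-succ (tr r (holdI dn x))) refl h₁
    go dn st-pred x ih v₂ h = cases₂ h λ where
      r (cs e₁ e st-pred-zero h₁) → stuck zero-value (k1-inj e₁) (tr r (holdI dn x))
      r (cs e₁ e st-pred-succ h₁) → stuck (hold-rule val-succ h₁) (k1-inj e₁) (tr r (holdI dn x))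
      r (cs refl e st-pred h₁) → ≡C (ih r (tr r x) _ h₁) λ where
        r' (eqAt q) → ≡I (trans (cong (k1 pred) q) (cong (sub (inst r')) e))
    go dn st-is-zero-zero x ih v₂ h = cases₂ h λ where
      r (cs refl e st-is-zero-zero h₁) → ≡I e
      r (cs refl e st-is-zero h₁) → stuck zero-value refl h₁
    go dn st-is-zero-succ x ih v₂ h = cases₂ h λ where
      r (cs refl e st-is-zero-succ h₁) → ≡I e
      r (cs refl e st-is-zero h₁) → stuck (hold-rule val-succ (tr r (holdI dn x))) refl h₁
    go dn st-is-zero x ih v₂ h = cases₂ h λ where
      r (cs e₁ e st-is-zero-zero h₁) → stuck zero-value (k1-inj e₁) (tr r (holdI dn x))
      r (cs e₁ e st-is-zero-succ h₁) → stuck (hold-rule val-succ h₁) (k1-inj e₁) (tr r (holdI dn x))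
      r (cs refl e st-is-zero h₁) → ≡C (ih r (tr r x) _ h₁) λ where
        r' (eqAt q) → ≡I (trans (cong (k1 is-zero) q) (cong (sub (inst r')) e))
    go dn st-if-true x ih v₂ h = cases₂ h λ where
      r (cs refl e st-if-true h₁) → ≡I e
      r (cs refl e st-if h₁) → stuck (hold-rule val-true hold-tt) refl h₁
    go dn st-if-false x ih v₂ h = cases₂ h λ where
      r (cs refl e st-if-false h₁) → ≡I e
      r (cs refl e st-if h₁) → stuck (hold-rule val-false hold-tt) refl h₁
    go dn st-if x ih v₂ h = cases₂ h λ where
      r (cs e₁ e st-if-true h₁) → stuck (hold-rule val-true hold-tt) (k3-inj₁ e₁) (tr r (holdI dn x))
      r (cs e₁ e st-if-false h₁) → stuck (hold-rule val-false hold-tt) (k3-inj₁ e₁) (tr r (holdI dn x))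
      r (cs refl e st-if h₁) → ≡C (ih r (tr r x) _ h₁) λ where
        r' (eqAt q) → ≡I (trans (cong (λ M → k3 if M _ _) q) (cong (sub (inst r')) e))
    go dn (st-beta {R = R} {N}) x ih v₂ h = cases₂ h λ where
      r (cs refl e st-beta h₁) → ≡I (trans (sub-·₁ (inst r) R N) e)
      r (cs refl e st-app h₁) → stuck (hold-rule val-abs hold-tt) refl h₁
    go dn st-app x ih v₂ h = cases₂ h λ where
      r (cs e₁ e st-beta h₁) → stuck (hold-rule val-abs hold-tt) (k2-inj₁ e₁) (tr r (holdI dn x))
      r (cs refl e st-app h₁) → ≡C (ih r (tr r x) _ h₁) λ where
        r' (eqAt q) → ≡I (trans (cong (λ M → k2 app M _) q) (cong (sub (inst r')) e))
    go dn (st-rec {T} {R}) x ih v₂ h = cases₂ h λ where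
      r (cs refl e st-rec h₁) → ≡I (trans (sub-·₁ (inst r) R (k2 rec T R)) e)

det-stepsᶜ : Code (I' ∷ I' ∷ [])
det-stepsᶜ = all ofi (hold ⟨ valueA #2 ⟩ ⊃ᶜ hold ⟨ valueA #0 ⟩ ⊃ᶜ hold ⟨ #1 ↝* #0 ⟩ ⊃ᶜ at (fm (#2 ≡F #0)))

-- A sequence that has reached a value cannot be continued, so both stop together; before that,
-- `step-deterministic` makes their next terms equal.
steps-deterministic : ∀ {w m v₁} → w ⊨ hold ⟨ m ↝* v₁ ⟩ → ∀ v₂ → w ⊨ hold ⟨ valueA v₁ ⟩ → w ⊨ hold ⟨ valueA v₂ ⟩ →
                      w ⊨ hold ⟨ m ↝* v₂ ⟩ → w ⊨ fm (v₁ ≡F v₂)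
steps-deterministic = induction₂ steps det-stepsᶜ λ dn q x ih v₂ d₁ d₂ h → go dn q x ih v₂ d₁ d₂ h
  where
    go : ∀ {w n m v B} → w ⊨ natG n → Rule (m ↝* v) B → w ⊨ seqG n nilL B → IH₂ steps det-stepsᶜ w n →
         ∀ v₂ → w ⊨ hold ⟨ valueA v ⟩ → w ⊨ hold ⟨ valueA v₂ ⟩ → w ⊨ hold ⟨ m ↝* v₂ ⟩ → w ⊨ fm (v ≡F v₂)
    go dn sts-refl x ih v₂ d₁ d₂ h = cases₂ h λ where
      r (cs e₁ e sts-refl h₁) → ≡I (trans (sym e₁) e)
      r (cs refl e sts-step h₁) → stuck (tr r d₁) refl (hold-and₁ h₁)
    go {n = n} dn sts-step x ih v₂ d₁ d₂ h = cases₂ h λ where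
      r (cs e₁ e sts-refl h₁) → stuck (tr r d₂) (trans (sym e) e₁) (tr r (holdI dn (seq-andE₁ dn x)))
      r (cs refl refl sts-step h₁) → ≡C (step-deterministic (tr r (holdI dn (seq-andE₁ dn x))) _ (hold-and₁ h₁)) λ where
        r' (eqAt q) → IH₂-tr {n = n} det-stepsᶜ r ih r' (tr r' (tr r (seq-andE₂ dn x))) _ (tr r' (tr r d₁)) (tr r' (tr r d₂))
          (hold-subst₂ (sym q) refl (tr r' (hold-and₂ h₁)))

-- Equivalence of the two semantics

eval-valueᶜ : Code (I' ∷ I' ∷ [])
eval-valueᶜ = at (hold ⟨ valueA #1 ⟩)

value-succ⁻¹ : w ⊨ hold ⟨ valueA (k1 succ V) ⟩ → w ⊨ hold ⟨ valueA V ⟩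
value-succ⁻¹ d = cases₁ d λ { r (cs₁ refl val-succ h) → h }

eval-value : w ⊨ hold ⟨ M ⇓ V ⟩ → w ⊨ hold ⟨ valueA V ⟩
eval-value = induction₂ eval eval-valueᶜ λ dn q x ih → go dn q x (IH₂-here eval-valueᶜ ih)
  where
    go : ∀ {w n m v B} → w ⊨ natG n → Rule (m ⇓ v) B → w ⊨ seqG n nilL B →
         (∀ {m v} → w ⊨ seqG n nilL ⟨ m ⇓ v ⟩ → w ⊨ hold ⟨ valueA v ⟩) → w ⊨ hold ⟨ valueA v ⟩
    go dn ev-zero x ih = zero-value
    go dn ev-true x ih = hold-rule val-true hold-tt
    go dn ev-false x ih = hold-rule val-false hold-tt
    go dn ev-succ x ih = hold-rule val-succ (ih x)
    go dn ev-pred-zero x ih = zero-value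
    go dn ev-pred-succ x ih = value-succ⁻¹ (ih x)
    go dn ev-is-zero-true x ih = hold-rule val-true hold-tt
    go dn ev-is-zero-false x ih = hold-rule val-false hold-tt
    go dn ev-if-true x ih = ih (seq-andE₂ dn x)
    go dn ev-if-false x ih = ih (seq-andE₂ dn x)
    go dn ev-abs x ih = hold-rule val-abs hold-tt
    go dn ev-app x ih = ih (seq-andE₂ dn x)
    go dn ev-rec x ih = ih x

steps-refl : w ⊨ hold ⟨ M ↝* M ⟩
steps-refl = hold-rule sts-refl hold-tt

steps-step : w ⊨ hold ⟨ M ↝ M' ⟩ → w ⊨ hold ⟨ M' ↝* N ⟩ → w ⊨ hold ⟨ M ↝* N ⟩
steps-step d e = hold-rule sts-step (hold-and d e)

steps-transᶜ : Code (I' ∷ I' ∷ [])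
steps-transᶜ = all ofi (hold ⟨ #2 ↝* #0 ⟩ ⊃ᶜ at (hold ⟨ #1 ↝* #0 ⟩))

steps-trans : w ⊨ hold ⟨ M ↝* M' ⟩ → w ⊨ hold ⟨ M' ↝* N ⟩ → w ⊨ hold ⟨ M ↝* N ⟩
steps-trans d = induction₂ steps steps-transᶜ (λ dn q x ih N → go dn q x (IH₂-here steps-transᶜ ih) N) d _
  where
    go : ∀ {w n m v B} → w ⊨ natG n → Rule (m ↝* v) B → w ⊨ seqG n nilL B →
         (∀ {m v} → w ⊨ seqG n nilL ⟨ m ↝* v ⟩ → ∀ N → w ⊨ hold ⟨ v ↝* N ⟩ → w ⊨ hold ⟨ m ↝* N ⟩) →
         ∀ N → w ⊨ hold ⟨ v ↝* N ⟩ → w ⊨ hold ⟨ m ↝* N ⟩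
    go dn sts-refl x ih N h = h
    go dn sts-step x ih N h = steps-step (holdI dn (seq-andE₁ dn x)) (ih (seq-andE₂ dn x) N h)

module _ (c : NonLog (I' ⇒ I')) (cong-rule : ∀ {Ψ} {M M' : Nf Ψ I'} → Rule (k1 c M ↝ k1 c M') ⟨ M ↝ M' ⟩) where
  private
    Gᶜ : Code (I' ∷ I' ∷ [])
    Gᶜ = at (hold ⟨ k1 c #0 ↝* k1 c #1 ⟩)

  steps-cong₁ : w ⊨ hold ⟨ M ↝* M' ⟩ → w ⊨ hold ⟨ k1 c M ↝* k1 c M' ⟩
  steps-cong₁ = induction₂ steps Gᶜ λ dn q x ih → go dn q x (IH₂-here Gᶜ ih)
    where
      go : ∀ {w n m v B} → w ⊨ natG n → Rule (m ↝* v) B → w ⊨ seqG n nilL B →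
           (∀ {m v} → w ⊨ seqG n nilL ⟨ m ↝* v ⟩ → w ⊨ hold ⟨ k1 c m ↝* k1 c v ⟩) → w ⊨ hold ⟨ k1 c m ↝* k1 c v ⟩
      go dn sts-refl x ih = steps-refl
      go dn sts-step x ih = steps-step (hold-rule cong-rule (holdI dn (seq-andE₁ dn x))) (ih (seq-andE₂ dn x))

steps-appᶜ : Code (I' ∷ I' ∷ [])
steps-appᶜ = all ofi (at (hold ⟨ k2 app #1 #0 ↝* k2 app #2 #0 ⟩))

steps-app : w ⊨ hold ⟨ M ↝* M' ⟩ → ∀ N → w ⊨ hold ⟨ k2 app M N ↝* k2 app M' N ⟩
steps-app = induction₂ steps steps-appᶜ λ dn q x ih → go dn q x (IH₂-here steps-appᶜ ih)
  where
    go : ∀ {w n m v B} → w ⊨ natG n → Rule (m ↝* v) B → w ⊨ seqG n nilL B →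
         (∀ {m v} → w ⊨ seqG n nilL ⟨ m ↝* v ⟩ → ∀ N → w ⊨ hold ⟨ k2 app m N ↝* k2 app v N ⟩) →
         ∀ N → w ⊨ hold ⟨ k2 app m N ↝* k2 app v N ⟩
    go dn sts-refl x ih N = steps-refl
    go dn sts-step x ih N = steps-step (hold-rule st-app (holdI dn (seq-andE₁ dn x))) (ih (seq-andE₂ dn x) N)

steps-ifᶜ : Code (I' ∷ I' ∷ [])
steps-ifᶜ = all ofi (all ofi (at (hold ⟨ k3 if #2 #1 #0 ↝* k3 if #3 #1 #0 ⟩)))

steps-if : w ⊨ hold ⟨ M ↝* M' ⟩ → ∀ N₁ N₂ → w ⊨ hold ⟨ k3 if M N₁ N₂ ↝* k3 if M' N₁ N₂ ⟩
steps-if = induction₂ steps steps-ifᶜ λ dn q x ih → go dn q x (IH₂-here steps-ifᶜ ih)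
  where
    go : ∀ {w n m v B} → w ⊨ natG n → Rule (m ↝* v) B → w ⊨ seqG n nilL B →
         (∀ {m v} → w ⊨ seqG n nilL ⟨ m ↝* v ⟩ → ∀ N₁ N₂ → w ⊨ hold ⟨ k3 if m N₁ N₂ ↝* k3 if v N₁ N₂ ⟩) →
         ∀ N₁ N₂ → w ⊨ hold ⟨ k3 if m N₁ N₂ ↝* k3 if v N₁ N₂ ⟩
    go dn sts-refl x ih N₁ N₂ = steps-refl
    go dn sts-step x ih N₁ N₂ = steps-step (hold-rule st-if (holdI dn (seq-andE₁ dn x))) (ih (seq-andE₂ dn x) N₁ N₂)

eval-stepsᶜ : Code (I' ∷ I' ∷ [])
eval-stepsᶜ = at (hold ⟨ #0 ↝* #1 ⟩)

eval-steps : w ⊨ hold ⟨ M ⇓ V ⟩ → w ⊨ hold ⟨ M ↝* V ⟩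
eval-steps = induction₂ eval eval-stepsᶜ λ dn q x ih → go dn q x (IH₂-here eval-stepsᶜ ih)
  where
    go : ∀ {w n m v B} → w ⊨ natG n → Rule (m ⇓ v) B → w ⊨ seqG n nilL B →
         (∀ {m v} → w ⊨ seqG n nilL ⟨ m ⇓ v ⟩ → w ⊨ hold ⟨ m ↝* v ⟩) → w ⊨ hold ⟨ m ↝* v ⟩
    go dn ev-zero x ih = steps-refl
    go dn ev-true x ih = steps-refl
    go dn ev-false x ih = steps-refl
    go dn ev-succ x ih = steps-cong₁ succ st-succ (ih x)
    go dn ev-pred-zero x ih = steps-trans (steps-cong₁ pred st-pred (ih x)) (steps-step (hold-rule st-pred-zero hold-tt) steps-refl)
    -- The transition from `pred (succ V)` requires `V` to be a value, which follows since the
    -- result `succ V` of an evaluation is one.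
    go dn ev-pred-succ x ih = steps-trans (steps-cong₁ pred st-pred (ih x))
      (steps-step (hold-rule st-pred-succ (value-succ⁻¹ (eval-value (holdI dn x)))) steps-refl)
    go dn ev-is-zero-true x ih = steps-trans (steps-cong₁ is-zero st-is-zero (ih x))
      (steps-step (hold-rule st-is-zero-zero hold-tt) steps-refl)
    go dn ev-is-zero-false x ih = steps-trans (steps-cong₁ is-zero st-is-zero (ih x))
      (steps-step (hold-rule st-is-zero-succ (value-succ⁻¹ (eval-value (holdI dn x)))) steps-refl)
    go dn ev-if-true x ih = steps-trans (steps-if (ih (seq-andE₁ dn x)) _ _)
      (steps-step (hold-rule st-if-true hold-tt) (ih (seq-andE₂ dn x)))
    go dn ev-if-false x ih = steps-trans (steps-if (ih (seq-andE₁ dn x)) _ _)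
      (steps-step (hold-rule st-if-false hold-tt) (ih (seq-andE₂ dn x)))
    go dn ev-abs x ih = steps-refl
    go dn ev-app x ih = steps-trans (steps-app (ih (seq-andE₁ dn x)) _)
      (steps-step (hold-rule st-beta hold-tt) (ih (seq-andE₂ dn x)))
    go dn ev-rec x ih = steps-step (hold-rule st-rec hold-tt) (ih x)

value-evalᶜ : Code (I' ∷ [])
value-evalᶜ = at (hold ⟨ #0 ⇓ #0 ⟩)

value-eval : w ⊨ hold ⟨ valueA V ⟩ → w ⊨ hold ⟨ V ⇓ V ⟩
value-eval = induction₁ value value-evalᶜ λ dn q x ih → go q x (IH₁-here value-evalᶜ ih)
  where
    go : ∀ {w n v B} → Rule (valueA v) B → w ⊨ seqG n nilL B →
         (∀ {v} → w ⊨ seqG n nilL ⟨ valueA v ⟩ → w ⊨ hold ⟨ v ⇓ v ⟩) → w ⊨ hold ⟨ v ⇓ v ⟩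
    go val-zero x ih = hold-rule ev-zero hold-tt
    go val-true x ih = hold-rule ev-true hold-tt
    go val-false x ih = hold-rule ev-false hold-tt
    go val-succ x ih = hold-rule ev-succ (ih x)
    go val-abs x ih = hold-rule ev-abs hold-tt

step-evalᶜ : Code (I' ∷ I' ∷ [])
step-evalᶜ = all ofi (hold ⟨ #2 ⇓ #0 ⟩ ⊃ᶜ at (hold ⟨ #1 ⇓ #0 ⟩))

-- Evaluation is closed under prefixing one transition. `steps-eval` repeats this along a sequence,
-- starting from the evaluation of the final value to itself.
step-eval : ∀ {w m m'} → w ⊨ hold ⟨ m ↝ m' ⟩ → ∀ v → w ⊨ hold ⟨ m' ⇓ v ⟩ → w ⊨ hold ⟨ m ⇓ v ⟩
step-eval = induction₂ step step-evalᶜ λ dn q x ih v h → go dn q x ih v h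
  where
    go : ∀ {w n m m' B} → w ⊨ natG n → Rule (m ↝ m') B → w ⊨ seqG n nilL B → IH₂ step step-evalᶜ w n →
         ∀ v → w ⊨ hold ⟨ m' ⇓ v ⟩ → w ⊨ hold ⟨ m ⇓ v ⟩
    go dn st-succ x ih v h = cases₂ h λ where
      r (cs refl e ev-succ h₁) → hold-subst₂ refl e (hold-rule ev-succ (ih r (tr r x) _ h₁))
    go dn st-pred-zero x ih v h = cases₂ h λ where
      r (cs refl e ev-zero h₁) → hold-subst₂ refl e (hold-rule ev-pred-zero (hold-rule ev-zero hold-tt))
    go dn st-pred-succ x ih v h = hold-rule ev-pred-succ (hold-rule ev-succ h)
    go dn st-pred x ih v h = cases₂ h λ where
      r (cs refl e ev-pred-zero h₁) → hold-subst₂ refl e (hold-rule ev-pred-zero (ih r (tr r x) _ h₁))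
      r (cs refl refl ev-pred-succ h₁) → hold-rule ev-pred-succ (ih r (tr r x) _ h₁)
    go dn st-is-zero-zero x ih v h = cases₂ h λ where
      r (cs refl e ev-true h₁) → hold-subst₂ refl e (hold-rule ev-is-zero-true (hold-rule ev-zero hold-tt))
    go dn st-is-zero-succ x ih v h = cases₂ h λ where
      -- The transition only records that the argument of `succ` is a value; `value-eval` supplies
      -- the evaluation that `ev-is-zero-false` asks for.
      r (cs refl e ev-false h₁) → hold-subst₂ refl e
        (hold-rule ev-is-zero-false (hold-rule ev-succ (tr r (value-eval (holdI dn x)))))
    go dn st-is-zero x ih v h = cases₂ h λ where
      r (cs refl e ev-is-zero-true h₁) → hold-subst₂ refl e (hold-rule ev-is-zero-true (ih r (tr r x) _ h₁))
      r (cs refl e ev-is-zero-false h₁) → hold-subst₂ refl e (hold-rule ev-is-zero-false (ih r (tr r x) _ h₁))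
    go dn st-if-true x ih v h = hold-rule ev-if-true (hold-and (hold-rule ev-true hold-tt) h)
    go dn st-if-false x ih v h = hold-rule ev-if-false (hold-and (hold-rule ev-false hold-tt) h)
    go dn st-if x ih v h = cases₂ h λ where
      r (cs refl refl ev-if-true h₁) → hold-rule ev-if-true (hold-and (ih r (tr r x) _ (hold-and₁ h₁)) (hold-and₂ h₁))
      r (cs refl refl ev-if-false h₁) → hold-rule ev-if-false (hold-and (ih r (tr r x) _ (hold-and₁ h₁)) (hold-and₂ h₁))
    go dn (st-beta {T}) x ih v h = hold-rule (ev-app {T = T}) (hold-and (hold-rule ev-abs hold-tt) h)
    go dn st-app x ih v h = cases₂ h λ where
      r (cs refl refl ev-app h₁) → hold-rule ev-app (hold-and (ih r (tr r x) _ (hold-and₁ h₁)) (hold-and₂ h₁))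
    go dn st-rec x ih v h = hold-rule ev-rec h

steps-evalᶜ : Code (I' ∷ I' ∷ [])
steps-evalᶜ = hold ⟨ valueA #1 ⟩ ⊃ᶜ at (hold ⟨ #0 ⇓ #1 ⟩)

steps-eval : w ⊨ hold ⟨ M ↝* V ⟩ → w ⊨ hold ⟨ valueA V ⟩ → w ⊨ hold ⟨ M ⇓ V ⟩
steps-eval = induction₂ steps steps-evalᶜ λ dn q x ih → go dn q x (IH₂-here steps-evalᶜ ih)
  where
    go : ∀ {w n m v B} → w ⊨ natG n → Rule (m ↝* v) B → w ⊨ seqG n nilL B →
         (∀ {m v} → w ⊨ seqG n nilL ⟨ m ↝* v ⟩ → w ⊨ hold ⟨ valueA v ⟩ → w ⊨ hold ⟨ m ⇓ v ⟩) →
         w ⊨ hold ⟨ valueA v ⟩ → w ⊨ hold ⟨ m ⇓ v ⟩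
    go dn sts-refl x ih d = value-eval d
    go dn sts-step x ih d = step-eval (holdI dn (seq-andE₁ dn x)) _ (ih (seq-andE₂ dn x) d)

-- Subject reduction

typeof-body-fun : (T : Nf Ψ I') (R : Nf Ψ (I' ⇒ I')) (U : Nf Ψ I') → Nf Ψ (I' ⇒ Prp)
typeof-body-fun T R U = lam (k2 imp (typeofA #0 (wk T)) ⟨ typeofA (wk R ·₁ #0) (wk U) ⟩)

typeof-body-·₁ : (T : Nf Ψ I') (R : Nf Ψ (I' ⇒ I')) (U N : Nf Ψ I') →
                 typeof-body-fun T R U ·₁ N ≡ k2 imp (typeofA N T) ⟨ typeofA (R ·₁ N) U ⟩
typeof-body-·₁ T R U N = trans (lam-·₁ (k2 imp (typeofA #0 (wk T)) ⟨ typeofA (wk R ·₁ #0) (wk U) ⟩) N) e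
  where
    back : ∀ {τ} (t : Nf _ τ) → sub (N ▸ nvar) (wk t) ≡ t
    back t = trans (sub-▸-wk N nvar t) (sub-id t)

    e : sub (N ▸ nvar) (k2 imp (typeofA #0 (wk T)) ⟨ typeofA (wk R ·₁ #0) (wk U) ⟩) ≡ k2 imp (typeofA N T) ⟨ typeofA (R ·₁ N) U ⟩
    e rewrite back T | back U | sub-·₁ (N ▸ nvar) (wk R) #0 | back R = refl

sub-typeof-body-fun : (θ : Sub Γ Δ) (T : Nf Δ I') (R : Nf Δ (I' ⇒ I')) (U : Nf Δ I') →
                      sub θ (typeof-body-fun T R U) ≡ typeof-body-fun (sub θ T) (sub θ R) (sub θ U)
sub-typeof-body-fun θ T R U rewrite sub-wk {σ = I'} θ T | sub-wk {σ = I'} θ U | sub-wk·₁-nvar θ R = refl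

hold-cast : ∀ {B C} → B ≡ C → w ⊨ hold B → w ⊨ hold C
hold-cast refl d = d

seq-cast : ∀ {B C} → B ≡ C → w ⊨ seqG n L B → w ⊨ seqG n L C
seq-cast refl d = d

-- The substitution lemma of the typing system, obtained from the object logic: instantiate ⋀ at
-- `N`, then cut the hypothesis on the type of `N`.
typeof-instance : (R : Nf (cx w) (I' ⇒ I')) → w ⊨ hold (typeof-body T R U) → w ⊨ hold ⟨ typeofA N T ⟩ → w ⊨ hold ⟨ typeofA (R ·₁ N) U ⟩
typeof-instance {T = T} {U} {N} R d e =
  hold-cut (hold-cast (typeof-body-·₁ T R U N) (hold-big {R = typeof-body-fun T R U} d N)) e

step-typeᶜ : Code (I' ∷ I' ∷ [])
step-typeᶜ = all ofi (hold ⟨ typeofA #1 #0 ⟩ ⊃ᶜ at (hold ⟨ typeofA #2 #0 ⟩))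

step-type : ∀ {w m m'} → w ⊨ hold ⟨ m ↝ m' ⟩ → ∀ t → w ⊨ hold ⟨ typeofA m t ⟩ → w ⊨ hold ⟨ typeofA m' t ⟩
step-type = induction₂ step step-typeᶜ λ dn q x ih t h → go dn q x ih t h
  where
    go : ∀ {w n m m' B} → w ⊨ natG n → Rule (m ↝ m') B → w ⊨ seqG n nilL B → IH₂ step step-typeᶜ w n →
         ∀ t → w ⊨ hold ⟨ typeofA m t ⟩ → w ⊨ hold ⟨ typeofA m' t ⟩
    go dn st-succ x ih t h = cases₂ h λ where
      r (cs refl e ty-succ h₁) → hold-subst₂ refl e (hold-rule ty-succ (ih r (tr r x) _ h₁))
    go dn st-pred-zero x ih t h = cases₂ h λ { r (cs refl e ty-pred h₁) → hold-subst₂ refl e h₁ }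
    go dn st-pred-succ x ih t h = cases₂ h λ where
      r (cs refl e ty-pred h₁) → hold-subst₂ refl e (cases₂ h₁ λ { r' (cs refl e' ty-succ h₂) → h₂ })
    go dn st-pred x ih t h = cases₂ h λ where
      r (cs refl e ty-pred h₁) → hold-subst₂ refl e (hold-rule ty-pred (ih r (tr r x) _ h₁))
    go dn st-is-zero-zero x ih t h = cases₂ h λ { r (cs refl e ty-is-zero h₁) → hold-subst₂ refl e (hold-rule ty-true hold-tt) }
    go dn st-is-zero-succ x ih t h = cases₂ h λ { r (cs refl e ty-is-zero h₁) → hold-subst₂ refl e (hold-rule ty-false hold-tt) }
    go dn st-is-zero x ih t h = cases₂ h λ where
      r (cs refl e ty-is-zero h₁) → hold-subst₂ refl e (hold-rule ty-is-zero (ih r (tr r x) _ h₁))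
    go dn st-if-true x ih t h = cases₂ h λ { r (cs refl refl ty-if h₁) → hold-and₁ (hold-and₂ h₁) }
    go dn st-if-false x ih t h = cases₂ h λ { r (cs refl refl ty-if h₁) → hold-and₂ (hold-and₂ h₁) }
    go dn st-if x ih t h = cases₂ h λ where
      r (cs refl refl ty-if h₁) → hold-rule ty-if (hold-and (ih r (tr r x) _ (hold-and₁ h₁)) (hold-and₂ h₁))
    go dn (st-beta {R = R} {N}) x ih t h = cases₂ h λ where
      r (cs refl refl ty-app h₁) → cases₂ (hold-and₁ h₁) λ where
        r' (cs refl e ty-abs h₂) → hold-subst₂
          (sym (trans (cong (sub (inst r')) (sub-·₁ (inst r) R N)) (sub-·₁ (inst r') (sub (inst r) R) (sub (inst r) N))))
          (k2-inj₂ e)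
          (typeof-instance (sub (inst r') (sub (inst r) R)) h₂ (hold-subst₂ refl (sym (k2-inj₁ e)) (tr r' (hold-and₂ h₁))))
    go dn st-app x ih t h = cases₂ h λ where
      r (cs refl refl ty-app h₁) → hold-rule ty-app (hold-and (ih r (tr r x) _ (hold-and₁ h₁)) (hold-and₂ h₁))
    go dn (st-rec {T} {R}) x ih t h = cases₂ h λ where
      -- The body is instantiated at the recursive term itself, whose typing `ty-rec` rebuilds from
      -- the same premise `h₁`.
      r (cs refl e ty-rec h₁) → hold-subst₂ (sym (sub-·₁ (inst r) R (k2 rec T R))) e
        (typeof-instance (sub (inst r) R) h₁ (hold-rule (ty-rec {R = sub (inst r) R}) h₁))

steps-type : ∀ {w m m'} → w ⊨ hold ⟨ m ↝* m' ⟩ → ∀ t → w ⊨ hold ⟨ typeofA m t ⟩ → w ⊨ hold ⟨ typeofA m' t ⟩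
steps-type = induction₂ steps step-typeᶜ λ dn q x ih t h → go dn q x (IH₂-here step-typeᶜ ih) t h
  where
    go : ∀ {w n m m' B} → w ⊨ natG n → Rule (m ↝* m') B → w ⊨ seqG n nilL B →
         (∀ {m m'} → w ⊨ seqG n nilL ⟨ m ↝* m' ⟩ → ∀ t → w ⊨ hold ⟨ typeofA m t ⟩ → w ⊨ hold ⟨ typeofA m' t ⟩) →
         ∀ t → w ⊨ hold ⟨ typeofA m t ⟩ → w ⊨ hold ⟨ typeofA m' t ⟩
    go dn sts-refl x ih t h = h
    go dn sts-step x ih t h = ih (seq-andE₂ dn x) t (step-type (holdI dn (seq-andE₁ dn x)) t h)

-- Unicity of typing

inhabitant : Nf Ψ I' → Nf Ψ I'
inhabitant T = k2 rec T (lam #0)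

inhabitant-type : w ⊨ hold ⟨ typeofA (inhabitant T) T ⟩
-- Index two for the body of `ty-rec`: one for ⋀, one for ⇒, and the axiom at zero.
inhabitant-type {T = T} = hold-rule ty-rec (holdI (nat-s (nat-s nat-z)) (bigI {R = typeof-body-fun T (lam #0) T} λ r N →
  seq-cast
    (sym (trans (cong (_·₁ N) (sub-typeof-body-fun (inst r) T (lam #0) T))
      (typeof-body-·₁ (sub (inst r) T) (lam #0) (sub (inst r) T) N)))
    (impI (ax hereI))))

-- Deliberately asymmetric: one typing is read off the list, the other is derivable from no
-- hypotheses. Thus only one of the two derivations compared is ever under hypotheses.
Good : (w : World) → Nf (cx w) AL → Set₁
Good w L = ∀ {w'} (r : w ⊑ w') m t t' → w' ⊨ fm (k2 element (typeofA m t) (sub (inst r) L)) →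
           w' ⊨ hold ⟨ typeofA m t' ⟩ → w' ⊨ fm (t ≡F t')

goodᶜ : Nf Δ AL → Code Δ
goodᶜ L = all ofi (all ofi (all ofi (fm (k2 element (typeofA #2 #1) (wk (wk (wk L)))) ⊃ᶜ
  hold ⟨ typeofA #2 #0 ⟩ ⊃ᶜ at (fm (#1 ≡F #0)))))

Good-tr : (r : w ⊑ w') → Good w L → Good w' (sub (inst r) L)
Good-tr {L = L} r f = □-tr (goodᶜ #0) {L ▸ ∅} r f

Good-here : Good w L → w ⊨ fm (k2 element (typeofA M T) L) → w ⊨ hold ⟨ typeofA M U ⟩ → w ⊨ fm (T ≡F U)
Good-here {L = L} f = □-here (goodᶜ #0) {L ▸ ∅} f _ _ _

Good-nil : Good w nilL
Good-nil r m t t' d h = ¬element-nil d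

Good-cons : Good w L → Good w (typeofA (inhabitant T) T :: L)
Good-cons {L = L} {T} f r m t t' d h = elementC d λ where
    r' (elementAt e e' v) → view (Good-tr {L = sub (inst r) L} r' (Good-tr {L = L} r f)) e e' v (tr r' h)
  where
    view : ∀ {w X L₀ L T m t t'} → Good w L → X ≡ typeofA m t → L₀ ≡ typeofA (inhabitant T) T :: L → ElementView w X L₀ →
           w ⊨ hold ⟨ typeofA m t' ⟩ → w ⊨ fm (t ≡F t')
    -- The only typing rule for `rec` returns its annotation `T`.
    view f refl refl v-here h = cases₂ h λ { r (cs refl e ty-rec h₁) → ≡I e }
    view {L = L} f refl refl (v-there x) h = Good-here {L = L} f x h

uniqueᶜ : Code (Nt ∷ [])
uniqueᶜ = all ofatmlst (goodᶜ #0 ⊃□ all ofi (all ofi (all ofi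
  (seqG #4 #3 ⟨ typeofA #2 #1 ⟩ ⊃ᶜ hold ⟨ typeofA #2 #0 ⟩ ⊃ᶜ at (fm (#1 ≡F #0))))))
  where
    #4 : ∀ {Γ a b c d e} → Nf (e ∷ d ∷ c ∷ b ∷ a ∷ Γ) a
    #4 = nvar (vs (vs (vs (vs vz))))

-- Under ⋀n (typeof n T ⇒ ⟨typeof (R n) U⟩) the variable n is instantiated by rec T (λx. x), whose
-- only type is T: this keeps the hypotheses good on one side and is cut away on the other.
seq-unique : w ⊨ natG n → ⟦ uniqueᶜ ⟧ w (n ▸ ∅)
seq-unique = nat-induction uniqueᶜ
  (λ L f m t₁ t₂ d h → seqC d λ { r (seqAt e₁ refl e₃ u) → base (Good-tr {L = L} r f) e₁ e₃ u (tr r h) })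
  (λ {w} {n} dn ih L f m t₁ t₂ d h → seqC d λ { r (seqAt e₁ refl e₃ u) →
    view (tr r dn) (□-tr uniqueᶜ {n ▸ ∅} r ih) (Good-tr {L = L} r f) e₁ e₃ u (tr r h) })
  where
    base : ∀ {w n L B m t₁ t₂} → Good w L → n ≡ zN → B ≡ ⟨ typeofA m t₁ ⟩ → SeqView w n L B →
           w ⊨ hold ⟨ typeofA m t₂ ⟩ → w ⊨ fm (t₁ ≡F t₂)
    base {L = L} f e refl (v-ax x) h = Good-here {L = L} f x h
    base f () refl (v-bc q x) h

    go : ∀ {w n L B m t₁ t₂} → w ⊨ natG n → □ uniqueᶜ w (n ▸ ∅) → Good w L → Rule (typeofA m t₁) B → w ⊨ seqG n L B →
         w ⊨ hold ⟨ typeofA m t₂ ⟩ → w ⊨ fm (t₁ ≡F t₂)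
    go dn ih f ty-zero x h = cases₂ h λ { r (cs refl e ty-zero _) → ≡I e }
    go dn ih f ty-true x h = cases₂ h λ { r (cs refl e ty-true _) → ≡I e }
    go dn ih f ty-false x h = cases₂ h λ { r (cs refl e ty-false _) → ≡I e }
    go dn ih f ty-succ x h = cases₂ h λ { r (cs refl e ty-succ _) → ≡I e }
    go dn ih f ty-pred x h = cases₂ h λ { r (cs refl e ty-pred _) → ≡I e }
    go dn ih f ty-is-zero x h = cases₂ h λ { r (cs refl e ty-is-zero _) → ≡I e }
    go {L = L} dn ih f ty-if x h = cases₂ h λ where
      r (cs refl refl ty-if h₁) → ih r _ (Good-tr {L = L} r f) _ _ _
        (tr r (seq-andE₁ dn (seq-andE₂ dn x))) (hold-and₁ (hold-and₂ h₁))
    go {L = L} dn ih f (ty-abs {T} {R} {U}) x h = cases₂ h λ where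
      r (cs refl e ty-abs h₁) → ≡C
        (ih r _ (Good-tr {L = typeofA (inhabitant T) T :: L} r (Good-cons {L = L} {T} f)) _ _ _
          (tr r (seq-impE dn (seq-cast (typeof-body-·₁ T R U (inhabitant T))
            (seq-bigE {R = typeof-body-fun T R U} dn x (inhabitant T)))))
          (hold-subst₂ (sym (sub-·₁ (inst r) R (inhabitant T))) refl (typeof-instance (sub (inst r) R) h₁ inhabitant-type)))
        λ { r' (eqAt q) → ≡I (trans (cong (k2 arr _) q) (cong (sub (inst r')) e)) }
    go {L = L} dn ih f ty-app x h = cases₂ h λ where
      r (cs refl refl ty-app h₁) → ≡C (ih r _ (Good-tr {L = L} r f) _ _ _ (tr r (seq-andE₁ dn x)) (hold-and₁ h₁))
        λ { r' (eqAt q) → ≡I (k2-inj₂ q) }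
    go dn ih f ty-rec x h = cases₂ h λ { r (cs refl e ty-rec _) → ≡I e }

    view : ∀ {w n' n L B m t₁ t₂} → w ⊨ natG n → □ uniqueᶜ w (n ▸ ∅) → Good w L → n' ≡ sN n → B ≡ ⟨ typeofA m t₁ ⟩ →
           SeqView w n' L B → w ⊨ hold ⟨ typeofA m t₂ ⟩ → w ⊨ fm (t₁ ≡F t₂)
    view {L = L} dn ih f e refl (v-ax x) h = Good-here {L = L} f x h
    view {n = n} {L} dn ih f refl refl (v-bc q x) h = go {n = n} {L} dn ih f q x h

typeof-unique : w ⊨ hold ⟨ typeofA M T ⟩ → w ⊨ hold ⟨ typeofA M U ⟩ → w ⊨ fm (T ≡F U)
typeof-unique d h = holdC d λ r (n , dn , x) → seq-unique dn nilL Good-nil _ _ _ x (tr r h)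

-- Validity in every world gives the boxed reading at the empty one. For the codes below,
-- `sub ∅ ⌊ B ⌋` computes to the formula to be derived.
derive : (B : Code []) → (∀ {w} → ⟦ B ⟧ w ∅) → Derivable (sub ∅ ⌊ B ⌋)
derive B f = reify {w = world [] [] []} B {∅} (λ r → ⟦⟧-cong B (λ ()) f)

theorem8p2 : Derivable det-eval × Derivable det-step × Derivable det-steps ×
    Derivable equiv₁ × Derivable equiv₂ ×
    Derivable (subject-reduction _⇓_) ×
    Derivable (subject-reduction _↝_) ×
    Derivable (subject-reduction _↝*_) ×
    Derivable unicity
theorem8p2 =
    derive (all ofi (all ofi (all ofi (hold ⟨ #2 ⇓ #1 ⟩ ⊃ᶜ hold ⟨ #2 ⇓ #0 ⟩ ⊃ᶜ at (fm (#1 ≡F #0))))))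
      (λ m m₁ m₂ d e → eval-deterministic d m₂ e)
  , derive (all ofi (all ofi (all ofi (hold ⟨ #2 ↝ #1 ⟩ ⊃ᶜ hold ⟨ #2 ↝ #0 ⟩ ⊃ᶜ at (fm (#1 ≡F #0))))))
      (λ m m₁ m₂ d e → step-deterministic d m₂ e)
  , derive (all ofi (all ofi (all ofi (hold ⟨ valueA #1 ⟩ ⊃ᶜ hold ⟨ #2 ↝* #1 ⟩ ⊃ᶜ
                                      hold ⟨ valueA #0 ⟩ ⊃ᶜ hold ⟨ #2 ↝* #0 ⟩ ⊃ᶜ at (fm (#1 ≡F #0))))))
      (λ m v₁ v₂ d₁ s₁ d₂ s₂ → steps-deterministic s₁ v₂ d₁ d₂ s₂)
  -- Codes have no conjunction, so it stays an opaque formula; `∧I` builds it here, and `∧fst` and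
  -- `∧snd` take it apart in the converse.
  , derive (all ofi (all ofi (hold ⟨ #1 ⇓ #0 ⟩ ⊃ᶜ at (fm (⊢F ⟨ valueA #0 ⟩ ∧F ⊢F ⟨ #1 ↝* #0 ⟩)))))
      (λ m v d → ∧I ⊢⌊ der (eval-value d) ⌋ ⊢⌊ der (eval-steps d) ⌋)
  , derive (all ofi (all ofi (fm (⊢F ⟨ valueA #0 ⟩ ∧F ⊢F ⟨ #1 ↝* #0 ⟩) ⊃ᶜ at (hold ⟨ #1 ⇓ #0 ⟩))))
      (λ m v d → steps-eval ⊢⌊ der (∧snd d) ⌋ ⊢⌊ der (∧fst d) ⌋)
  , derive (all ofi (all ofi (hold ⟨ #1 ⇓ #0 ⟩ ⊃ᶜ all ofi (hold ⟨ typeofA #2 #0 ⟩ ⊃ᶜ at (hold ⟨ typeofA #1 #0 ⟩)))))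
      (λ m n d t → steps-type (eval-steps d) t)
  , derive (all ofi (all ofi (hold ⟨ #1 ↝ #0 ⟩ ⊃ᶜ all ofi (hold ⟨ typeofA #2 #0 ⟩ ⊃ᶜ at (hold ⟨ typeofA #1 #0 ⟩)))))
      (λ m n d t → step-type d t)
  , derive (all ofi (all ofi (hold ⟨ #1 ↝* #0 ⟩ ⊃ᶜ all ofi (hold ⟨ typeofA #2 #0 ⟩ ⊃ᶜ at (hold ⟨ typeofA #1 #0 ⟩)))))
      (λ m n d t → steps-type d t)
  , derive (all ofi (all ofi (all ofi (hold ⟨ typeofA #2 #1 ⟩ ⊃ᶜ hold ⟨ typeofA #2 #0 ⟩ ⊃ᶜ at (fm (#1 ≡F #0))))))
      (λ m t₁ t₂ d e → typeof-unique d e)
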